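{- Let $\epsilon\in(0,1)$ and let $F=(f_n)_{n\ge1}$ be any sequence of positive integers for which $f_n=\sum_{i\le\epsilon n}f_i$ for all sufficiently large $n$. Then every $\epsilon$-complete sequence $A=(a_n)_{n\ge1}$ (listed in increasing order) satisfies $a_n=O(f_n)$, and there is an $\epsilon$-complete sequence $A=(a_n)_{n\ge1}$ with $a_n=\Theta(f_n)$.
   Context: For a sequence $A$ of positive integers, $\Sigma(A)$ is the set of integers representable as a sum of distinct terms of $A$; $A$ is complete if every sufficiently large positive integer lies in $\Sigma(A)$. A sequence $A$ of positive integers is $\epsilon$-complete if every subsequence $A'$ of $A$ with $|A'\cap[n]|\ge\epsilon|A\cap[n]|$ for all sufficiently large $n$ is complete. Here $[n]=\{1,\dots,n\}$. -}

module Defs where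

open import Data.Integer.Base using (+_)
open import Data.List.Base using (List; applyUpTo; filter; length; map; sum)
open import Data.List.Relation.Unary.All using (All)
open import Data.List.Relation.Unary.Unique.Propositional using (Unique)
open import Data.Nat.Base using (ℕ; suc; _*_; _≤_; _<_)
open import Data.Nat.Properties using (_≤?_)
open import Data.Product.Base using (_×_; ∃-syntax)
open import Data.Rational.Base as ℚ using (ℚ; 0ℚ; 1ℚ)
open import Data.Sum.Base using (_⊎_)
open import Function.Bundles using (_⇔_)
open import Relation.Binary.PropositionalEquality using (_≡_)
open import Relation.Nullary.Negation using (¬_)

-- Real numbers as two-sided Dedekind cuts: L q means q < x, U q means x < q.
record ℝ : Set₁ where
  field
    L U         : ℚ → Set
    L-inhabited : ∃[ q ] L q
    U-inhabited : ∃[ q ] U q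
    L-rounded   : ∀ q → L q ⇔ (∃[ r ] (q ℚ.< r × L r))
    U-rounded   : ∀ q → U q ⇔ (∃[ r ] (r ℚ.< q × U r))
    disjoint    : ∀ q → ¬ (L q × U q)
    located     : ∀ q r → q ℚ.< r → L q ⊎ U r

fromℕ : ℕ → ℚ
fromℕ n = + n ℚ./ 1

InUnitInterval : ℝ → Set
InUnitInterval x = ℝ.L x 0ℚ × ℝ.U x 1ℚ

-- k ≤ x · n, where x is the infimum of its upper cut.
_≤_·_ : ℕ → ℝ → ℕ → Set
k ≤ x · n = ∀ q → ℝ.U x q → fromℕ k ℚ.≤ q ℚ.* fromℕ n

-- x · n ≤ k, where x is the supremum of its lower cut.
_·_≤_ : ℝ → ℕ → ℕ → Set
x · n ≤ k = ∀ q → ℝ.L x q → q ℚ.* fromℕ n ℚ.≤ fromℕ k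

Eventually : (ℕ → Set) → Set
Eventually P = ∃[ N ] (∀ n → N ≤ n → P n)

[1⋯_] : ℕ → List ℕ
[1⋯ n ] = applyUpTo suc n

-- Sequences (u_n)_{n ≥ 1} are functions ℕ → ℕ whose value at 0 is ignored.
Positive : (ℕ → ℕ) → Set
Positive u = ∀ n → 1 ≤ n → 1 ≤ u n

StrictlyIncreasing : (ℕ → ℕ) → Set
StrictlyIncreasing u = ∀ m n → 1 ≤ m → m < n → u m < u n

-- f_n = Σ_{i ≤ εn} f_i for all large n.  The index set {i ≥ 1 : i ≤ εn} is
-- presented as {1, …, k}, because i ≤ εn has no decision procedure for a
-- general real ε.
SatisfiesRecurrence : ℝ → (ℕ → ℕ) → Set
SatisfiesRecurrence ε f = Eventually λ n →
  ∃[ k ] ((∀ i → 1 ≤ i → (i ≤ k) ⇔ (i ≤ ε · n)) × f n ≡ sum (map f [1⋯ k ]))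

-- An infinite set of positive integers, listed in increasing order.
record Sequence : Set where
  field
    term       : ℕ → ℕ
    positive   : Positive term
    increasing : StrictlyIncreasing term

open Sequence public using (term)

_∈ˢ_ : ℕ → Sequence → Set
x ∈ˢ A = ∃[ i ] (1 ≤ i × x ≡ term A i)

_∈Σ_ : ℕ → Sequence → Set
m ∈Σ A = ∃[ xs ] (Unique xs × All (_∈ˢ A) xs × m ≡ sum xs)

Complete : Sequence → Set
Complete A = Eventually (_∈Σ A)

_IsSubsequenceOf_ : Sequence → Sequence → Set
B IsSubsequenceOf A = ∃[ φ ] (Positive φ × StrictlyIncreasing φ ×
  (∀ n → 1 ≤ n → term B n ≡ term A (φ n)))

-- |A ∩ [n]|, counted by indices: a_i ≥ i, so a_i ≤ n forces i ≤ n.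
∣_∩[_]∣ : Sequence → ℕ → ℕ
∣ A ∩[ n ]∣ = length (filter (λ i → term A i ≤? n) [1⋯ n ])

_-Complete_ : ℝ → Sequence → Set
ε -Complete A = ∀ B → B IsSubsequenceOf A →
  Eventually (λ n → ε · ∣ A ∩[ n ]∣ ≤ ∣ B ∩[ n ]∣) → Complete B

_=O_ : (ℕ → ℕ) → (ℕ → ℕ) → Set
u =O v = ∃[ C ] Eventually (λ n → u n ≤ C * v n)

_=Θ_ : (ℕ → ℕ) → (ℕ → ℕ) → Set
u =Θ v = u =O v × v =O u

{-# OPTIONS --safe #-}

-- Write κ n for the integer part of εn.
--
-- Upper bound.  Suppose that for every r the term a_n infinitely often exceeds 1 plus the sum of the
-- first κ n + r terms.  Deleting the indices between κ n + r and n for a sparse set of such n, where r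
-- is the previous such n, leaves a set of density at least ε, yet 1 plus the sum of the terms below
-- each gap is not represented.  Hence for some r eventually a_n ≤ 1 + Σ_{i ≤ κ n + r} a_i, and this
-- recursive inequality forces a_n = O(f_n).
--
-- Construction.  Put s_j = Σ_{i ≤ κ(j-1)} a_i.  In stage r, that is for 2^{Ar} ≤ j < 2^{A(r+1)}, the
-- term a_j is chosen with (1 - 4/θ) s_j ≤ a_j < (1 - 2/θ) s_j, θ = 2^r; the losses telescope along
-- j ↦ κ j, so a_j = Θ(f_j).  The low-order part of a_j contains the product g(x) h(z), where x and z
-- are the two halves of the digits of j mod T, which g and h reread in much larger bases G and Q.  The mixed
-- second difference over a change of the i-th digit of x and of the k-th digit of z is c G^i Q^k with
-- c bounded, and every dense set of indices contains such a box for every (i , k).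
--
-- Completeness.  A subset of density ε is dense in some window of stage r on which the high-order part
-- of a_j is constant.  Exchanging the two diagonals of a box, or two indices of the window congruent
-- mod T, changes a subset sum by an amount of any prescribed order of magnitude, so that an interval of
-- subset sums is stretched geometrically to the size of the terms at the cost of few terms.  The first
-- interval comes from exchanges of a fixed amount Uc together with finitely many early terms, which
-- reach all residues mod U² because a_j ≡ 1 mod U.  Finally all other terms are adjoined in increasing
-- order: each is at most the length of the interval reached so far, since the slack 2/θ outweighs the
-- terms that were spent.
module Submission where

open import Axiom.ExcludedMiddle using (ExcludedMiddle)
open import Data.Empty using (⊥-elim)
import Data.Integer.Base as ℤ
import Data.Integer.Properties as ℤP
open import Data.List.Base using (List; []; _∷_; _++_; applyUpTo; filter; length; map)
open import Data.List.Membership.Propositional using (_∈_; _∉_)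
open import Data.List.Membership.Propositional.Properties using (∈-∃++; ∈-++⁻; ∈-++⁺ˡ; ∈-++⁺ʳ; ∈-map⁺; ∈-applyUpTo⁺)
open import Data.List.Properties using (map-applyUpTo; length-filter; length-applyUpTo; length-++)
open import Data.List.Relation.Unary.All as All using (All; []; _∷_)
open import Data.List.Relation.Unary.All.Properties as AllP using ()
open import Data.List.Relation.Unary.Any using (here; there)
open import Data.List.Relation.Unary.Unique.Propositional using (Unique; []; _∷_)
open import Data.List.Relation.Unary.Unique.Propositional.Properties as UniqueP using ()
open import Data.Nat.Base
import Data.Nat.Coprimality as Coprimality
open import Data.Nat.DivMod
open import Data.Nat.Divisibility
open import Data.Nat.Induction using (<-rec)
open import Data.Nat.ListAction using (sum)
open import Data.Nat.Properties
open import Data.Nat.Tactic.RingSolver using (solve-∀)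
open import Data.Product.Base using (_×_; _,_; ∃-syntax; proj₁; proj₂)
open import Data.Rational.Base as ℚ using (ℚ; mkℚ; 0ℚ; 1ℚ; toℚᵘ; ↧ₙ_; *≤*; *<*)
import Data.Rational.Properties as ℚP
import Data.Rational.Unnormalised.Base as ℚᵘ
import Data.Rational.Unnormalised.Properties as ℚᵘP
open import Data.Sum.Base using (_⊎_; inj₁; inj₂; [_,_]′)
open import Function.Base using (_∘_; id; case_of_)
open import Function.Bundles using (_⇔_; mk⇔; Equivalence)
open import Level using (0ℓ)
open import Relation.Binary.PropositionalEquality
open import Relation.Nullary using (¬_; Dec; yes; no)
open import Relation.Nullary.Negation using (contradiction)
open import Relation.Unary using (Pred; Decidable)
open import Data.List.Membership.DecPropositional _≟_ using (_∈?_)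
open import Defs

-- Indices of stage r have O(r) bits, terms O(r²) bits, and only 2^O(r) indices may be spent. So the
-- amounts exchanged must come in sizes spaced by factors 2^O(r), with O(r) sizes in all.
-- Differences of two terms cannot supply the small ones: the summand j·2^w that keeps the sequence
-- increasing swamps the pattern. It is affine in the digits of j, so a mixed second difference over
-- two digits removes it, and a product g(x)h(z) is a pattern that survives. With r + 2 digits in x
-- and a fixed number ω + 1 in z the period T is still 2^O(r) and fits into a stage, while the sizes
-- G^i Q^k, with G = 2^q and Q = 2^r, leave no large gap because q ≤ r(ω + 1). The constants depend
-- on ε through p alone. The early terms that supply the residues depend on the given subset, but
-- not on r; so r is chosen last, larger than anything they cost.

∑ : ℕ → (ℕ → ℕ) → ℕ
∑ zero    u = 0
∑ (suc n) u = ∑ n u + u n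

-- A linear-arithmetic certificate: the hypotheses, summed up as x ≤ y, cancel in a ring identity.
by-cert : ∀ {x y l r} k → x ≤ y → l + y + k ≡ r + x → l ≤ r
by-cert {x} {y} {l} {r} k x≤y eq = +-cancelʳ-≤ y l r (begin
  l + y      ≤⟨ m≤m+n (l + y) k ⟩
  l + y + k  ≡⟨ eq ⟩
  r + x      ≤⟨ +-monoʳ-≤ r x≤y ⟩
  r + y      ∎)
  where open ≤-Reasoning

∑-mono : ∀ n {u v} → (∀ i → i < n → u i ≤ v i) → ∑ n u ≤ ∑ n v
∑-mono zero    h = z≤n
∑-mono (suc n) h = +-mono-≤ (∑-mono n λ i i<n → h i (m<n⇒m<1+n i<n)) (h n (n<1+n n))

∑-cong : ∀ n {u v} → (∀ i → i < n → u i ≡ v i) → ∑ n u ≡ ∑ n v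
∑-cong n h = ≤-antisym (∑-mono n λ i i<n → ≤-reflexive (h i i<n))
                       (∑-mono n λ i i<n → ≤-reflexive (sym (h i i<n)))

∑-+ : ∀ n u v → ∑ n (λ i → u i + v i) ≡ ∑ n u + ∑ n v
∑-+ zero    u v = refl
∑-+ (suc n) u v = trans (cong (_+ (u n + v n)) (∑-+ n u v)) (lemma (∑ n u) (∑ n v) (u n) (v n))
  where
  lemma : ∀ a b c d → a + b + (c + d) ≡ a + c + (b + d)
  lemma = solve-∀

∑-* : ∀ n c u → ∑ n (λ i → c * u i) ≡ c * ∑ n u
∑-* zero    c u = sym (*-zeroʳ c)
∑-* (suc n) c u = trans (cong (_+ c * u n) (∑-* n c u)) (sym (*-distribˡ-+ c (∑ n u) (u n)))

∑-const : ∀ n c → ∑ n (λ _ → c) ≡ n * c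
∑-const zero    c = refl
∑-const (suc n) c = trans (cong (_+ c) (∑-const n c)) (+-comm (n * c) c)

∑-split : ∀ m n u → ∑ (m + n) u ≡ ∑ m u + ∑ n (λ i → u (m + i))
∑-split m zero    u = trans (cong (λ k → ∑ k u) (+-identityʳ m)) (sym (+-identityʳ _))
∑-split m (suc n) u = begin
  ∑ (m + suc n) u                             ≡⟨ cong (λ k → ∑ k u) (+-suc m n) ⟩
  ∑ (m + n) u + u (m + n)                     ≡⟨ cong (_+ u (m + n)) (∑-split m n u) ⟩
  ∑ m u + ∑ n (λ i → u (m + i)) + u (m + n)   ≡⟨ +-assoc (∑ m u) _ _ ⟩
  ∑ m u + ∑ (suc n) (λ i → u (m + i))         ∎
  where open ≡-Reasoning

∑-monoˡ : ∀ {m n} u → m ≤ n → ∑ m u ≤ ∑ n u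
∑-monoˡ {m} u m≤n with m≤n⇒∃[o]m+o≡n m≤n
... | o , refl = ≤-trans (m≤m+n (∑ m u) _) (≤-reflexive (sym (∑-split m o u)))

∑-blocks : ∀ m n u → ∑ (m * n) u ≡ ∑ m (λ i → ∑ n (λ l → u (i * n + l)))
∑-blocks zero    n u = refl
∑-blocks (suc m) n u = begin
  ∑ (n + m * n) u                               ≡⟨ cong (λ k → ∑ k u) (+-comm n (m * n)) ⟩
  ∑ (m * n + n) u                               ≡⟨ ∑-split (m * n) n u ⟩
  ∑ (m * n) u + ∑ n (λ l → u (m * n + l))       ≡⟨ cong (_+ ∑ n (λ l → u (m * n + l))) (∑-blocks m n u) ⟩
  ∑ (suc m) (λ i → ∑ n (λ l → u (i * n + l)))   ∎
  where open ≡-Reasoning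

∑-swap : ∀ m n (u : ℕ → ℕ → ℕ) → ∑ m (λ i → ∑ n (u i)) ≡ ∑ n (λ l → ∑ m (λ i → u i l))
∑-swap zero    n u = sym (trans (∑-const n 0) (*-zeroʳ n))
∑-swap (suc m) n u = trans (cong (_+ ∑ n (u m)) (∑-swap m n u)) (sym (∑-+ n _ (u m)))

pigeonhole-< : ∀ m K u → m * K < ∑ m u → ∃[ i ] (i < m × K < u i)
pigeonhole-< (suc m) K u h with K <? u m
... | yes K<u = m , n<1+n m , K<u
... | no  K≮u with pigeonhole-< m K u (+-cancelˡ-< K (m * K) (∑ m u) (≤-trans h (≤-trans (+-monoʳ-≤ (∑ m u) (≮⇒≥ K≮u)) (≤-reflexive (+-comm _ K)))))
...   | i , i<m , q = i , m<n⇒m<1+n i<m , q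

pigeonhole-≤ : ∀ m K u → 1 ≤ m → m * K ≤ ∑ m u → ∃[ i ] (i < m × K ≤ u i)
pigeonhole-≤ m       zero    u 1≤m h = 0 , 1≤m , z≤n
pigeonhole-≤ m@(suc _) (suc K) u 1≤m h = pigeonhole-< m K u (<-≤-trans (*-monoʳ-< m (n<1+n K)) h)

-- A hit with m - 1 further hits above it, all below n, lies at least m below n.
first-hit : ∀ n m u → (∀ i → u i ≤ 1) → 1 ≤ m → m ≤ ∑ n u → ∃[ i ] (1 ≤ u i × i + m ≤ n)
first-hit zero    m u u≤1 1≤m h = contradiction (≤-trans 1≤m h) λ ()
first-hit (suc n) m u u≤1 1≤m h with m ≤? ∑ n u
... | yes q with first-hit n m u u≤1 1≤m q
...   | i , ui , i+m≤n = i , ui , m≤n⇒m≤1+n i+m≤n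
first-hit (suc n) (suc m) u u≤1 1≤m h | no q with u n in un
... | zero  = contradiction (subst (suc m ≤_) (+-identityʳ _) h) q
... | suc k with m
...   | zero   = n , subst (1 ≤_) (sym un) (s≤s z≤n) , ≤-reflexive (+-comm n 1)
...   | suc m' with first-hit n (suc m') u u≤1 (s≤s z≤n) (s≤s⁻¹ (≤-trans h (≤-trans (+-monoʳ-≤ (∑ n u) (subst (_≤ 1) un (u≤1 n))) (≤-reflexive (+-comm _ 1)))))
...     | i , ui , i+m≤n = i , ui , subst (_≤ suc n) (sym (+-suc i (suc m'))) (s≤s i+m≤n)

-- Among m + 1 hits the first and the last differ by at least m.
far-apart-hits : ∀ n m u → (∀ i → u i ≤ 1) → 1 ≤ m → suc m ≤ ∑ n u →
  ∃[ i ] ∃[ j ] (1 ≤ u i × 1 ≤ u j × i + m ≤ j × j < n)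
far-apart-hits (suc n) m u u≤1 1≤m h with suc m ≤? ∑ n u
... | yes q with far-apart-hits n m u u≤1 1≤m q
...   | i , j , ui , uj , d , j<n = i , j , ui , uj , d , m<n⇒m<1+n j<n
far-apart-hits (suc n) m u u≤1 1≤m h | no q with u n in un
... | zero  = contradiction (subst (suc m ≤_) (+-identityʳ _) h) q
... | suc k with first-hit n m u u≤1 1≤m (s≤s⁻¹ (≤-trans h (≤-trans (+-monoʳ-≤ (∑ n u) (subst (_≤ 1) un (u≤1 n))) (≤-reflexive (+-comm _ 1)))))
...   | i , ui , i+m≤n = i , n , ui , subst (1 ≤_) (sym un) (s≤s z≤n) , i+m≤n , n<1+n n

-- The search ends with the initial run on which P holds, so P need not be downward closed.
maximal : (P : ℕ → Set) → (∀ k → Dec (P k)) → P 0 → ∀ N →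
  ∃[ k ] (k ≤ N × P k × (k ≡ N ⊎ ¬ P (suc k)))
maximal P P? P0 zero    = 0 , z≤n , P0 , inj₁ refl
maximal P P? P0 (suc N) with maximal P P? P0 N
... | k , k≤N , Pk , inj₂ q    = k , m≤n⇒m≤1+n k≤N , Pk , inj₂ q
... | k , k≤N , Pk , inj₁ refl with P? (suc k)
...   | yes q = suc k , ≤-refl , q , inj₁ refl
...   | no  q = k , n≤1+n k , Pk , inj₂ q

-- Growth of powers of two

1≤2^ : ∀ n → 1 ≤ 2 ^ n
1≤2^ n = m^n>0 2 n

n<2^n : ∀ n → n < 2 ^ n
n<2^n zero    = s≤s z≤n
n<2^n (suc n) = ≤-trans (+-mono-≤ (1≤2^ n) (n<2^n n)) (≤-reflexive (cong (2 ^ n +_) (sym (+-identityʳ _))))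

2^-mono : ∀ {m n} → m ≤ n → 2 ^ m ≤ 2 ^ n
2^-mono = ^-monoʳ-≤ 2

2^-+ : ∀ m n → 2 ^ m * 2 ^ n ≡ 2 ^ (m + n)
2^-+ m n = sym (^-distribˡ-+-* 2 m n)

quadratic≤2^ : ∀ c → ∃[ r₀ ] (∀ r → r₀ ≤ r → c * (suc r * suc r) ≤ 2 ^ r)
quadratic≤2^ c = r₀ , λ r r₀≤r → subst (λ r → c * (suc r * suc r) ≤ 2 ^ r) (m+[n∸m]≡n r₀≤r) (go (r ∸ r₀))
  where
  open ≤-Reasoning
  -- With `r₀` = 3k one has (r₀ + 1)² ≤ 16·2^(2k), so the left side is at most k·2^(2k) ≤ 2^(3k);
  -- the factor 16 is that of the square.
  k = 16 * c
  r₀ = k + (k + k)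
  square-bound : suc r₀ * suc r₀ ≤ (4 * 2 ^ k) * (4 * 2 ^ k)
  square-bound = *-mono-≤ bound bound
    where
    bound : suc r₀ ≤ 4 * 2 ^ k
    bound = by-cert (suc (suc (suc k))) (*-monoʳ-≤ 4 (n<2^n k)) (lemma k (2 ^ k))
      where
      lemma : ∀ k t → suc (k + (k + k)) + 4 * t + suc (suc (suc k)) ≡ 4 * t + 4 * suc k
      lemma = solve-∀
  base : c * (suc r₀ * suc r₀) ≤ 2 ^ r₀
  base = begin
    c * (suc r₀ * suc r₀)                 ≤⟨ *-monoʳ-≤ c square-bound ⟩
    c * ((4 * 2 ^ k) * (4 * 2 ^ k))       ≡⟨ lemma c (2 ^ k) ⟩
    k * (2 ^ k * 2 ^ k)                   ≤⟨ *-monoˡ-≤ (2 ^ k * 2 ^ k) (<⇒≤ (n<2^n k)) ⟩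
    2 ^ k * (2 ^ k * 2 ^ k)               ≡⟨ cong (2 ^ k *_) (2^-+ k k) ⟩
    2 ^ k * 2 ^ (k + k)                   ≡⟨ 2^-+ k (k + k) ⟩
    2 ^ r₀                                ∎
    where
    lemma : ∀ c t → c * ((4 * t) * (4 * t)) ≡ 16 * c * (t * t)
    lemma = solve-∀
  -- (r + 2)² ≤ 2(r + 1)² holds from r = 2 on; for c = 0, where `r₀` = 0, both sides of the claim
  -- are trivial.
  step : ∀ r → c * (suc r * suc r) ≤ 2 ^ r → (c ≡ 0 ⊎ 2 ≤ r) → c * (suc (suc r) * suc (suc r)) ≤ 2 ^ suc r
  step r h (inj₁ refl) = z≤n
  step (suc (suc r)) h (inj₂ _) = ≤-trans (*-monoʳ-≤ c (by-cert (r * r + 4 * r + 2) (z≤n {0}) (quad r)))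
    (≤-trans (≤-reflexive (shuffle c (suc (suc (suc r)) * suc (suc (suc r))))) (*-monoʳ-≤ 2 h))
    where
    quad : ∀ r → suc (suc (suc (suc r))) * suc (suc (suc (suc r))) + 0 + (r * r + 4 * r + 2)
               ≡ 2 * (suc (suc (suc r)) * suc (suc (suc r))) + 0
    quad = solve-∀
    shuffle : ∀ c s → c * (2 * s) ≡ 2 * (c * s)
    shuffle = solve-∀
  step 1 h (inj₂ (s≤s ()))
  positive : ∀ c i → c ≡ 0 ⊎ 2 ≤ 16 * c + (16 * c + 16 * c) + i
  positive zero    i = inj₁ refl
  positive (suc c) i = inj₂ (≤-trans (≤-trans (s≤s (s≤s (z≤n {14}))) (m≤m*n 16 (suc c))) (≤-trans (m≤m+n _ _) (m≤m+n _ i)))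
  go : ∀ i → c * (suc (r₀ + i) * suc (r₀ + i)) ≤ 2 ^ (r₀ + i)
  go zero    = subst (λ r → c * (suc r * suc r) ≤ 2 ^ r) (sym (+-identityʳ r₀)) base
  go (suc i) = subst (λ r → c * (suc r * suc r) ≤ 2 ^ r) (sym (+-suc r₀ i)) (step (r₀ + i) (go i) (positive c i))

^-distribʳ-* : ∀ n x z → (x * z) ^ n ≡ x ^ n * z ^ n
^-distribʳ-* zero    x z = refl
^-distribʳ-* (suc n) x z = trans (cong (x * z *_) (^-distribʳ-* n x z)) (lemma x z (x ^ n) (z ^ n))
  where
  lemma : ∀ x z a b → x * z * (a * b) ≡ x * a * (z * b)
  lemma = solve-∀

-- Rational arithmetic with natural numbers, and the integer part of εn

fromℕ≡mkℚ : ∀ n → fromℕ n ≡ mkℚ (ℤ.+ n) 0 (Coprimality.sym (Coprimality.1-coprimeTo n))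
fromℕ≡mkℚ n = ℚP.normalize-coprime (Coprimality.sym (Coprimality.1-coprimeTo n))

toℚᵘ-fromℕ : ∀ n → toℚᵘ (fromℕ n) ≡ ℚᵘ.mkℚᵘ (ℤ.+ n) 0
toℚᵘ-fromℕ n = cong toℚᵘ (fromℕ≡mkℚ n)

fromℕ-mono-≤ : ∀ {m n} → m ≤ n → fromℕ m ℚ.≤ fromℕ n
fromℕ-mono-≤ {m} {n} m≤n rewrite fromℕ≡mkℚ m | fromℕ≡mkℚ n =
  *≤* (ℤP.*-monoʳ-≤-nonNeg (ℤ.+ 1) (ℤ.+≤+ m≤n))

fromℕ-cancel-≤ : ∀ {m n} → fromℕ m ℚ.≤ fromℕ n → m ≤ n
fromℕ-cancel-≤ {m} {n} h rewrite fromℕ≡mkℚ m | fromℕ≡mkℚ n =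
  ℤP.drop‿+≤+ (ℤP.*-cancelʳ-≤-pos (ℤ.+ m) (ℤ.+ n) (ℤ.+ 1) (ℚP.drop-*≤* h))

fromℕ-cancel-< : ∀ {m n} → fromℕ m ℚ.< fromℕ n → m < n
fromℕ-cancel-< {m} {n} h = ≰⇒> λ n≤m → ℚP.<-irrefl refl (ℚP.<-≤-trans h (fromℕ-mono-≤ n≤m))

fromℕ-+ : ∀ m n → fromℕ (m + n) ≡ fromℕ m ℚ.+ fromℕ n
fromℕ-+ m n rewrite fromℕ≡mkℚ m | fromℕ≡mkℚ n =
  cong (ℚ._/ 1) (sym (cong₂ ℤ._+_ (ℤP.*-identityʳ (ℤ.+ m)) (ℤP.*-identityʳ (ℤ.+ n))))

fromℕ-* : ∀ m n → fromℕ (m * n) ≡ fromℕ m ℚ.* fromℕ n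
fromℕ-* m n rewrite fromℕ≡mkℚ m | fromℕ≡mkℚ n = cong (ℚ._/ 1) (ℤP.pos-* m n)

fromℕ-nonNeg : ∀ n → ℚ.NonNegative (fromℕ n)
fromℕ-nonNeg n = ℚP.normalize-nonNeg n 1

*-fromℕ-mono : ∀ n {q r} → q ℚ.≤ r → q ℚ.* fromℕ n ℚ.≤ r ℚ.* fromℕ n
*-fromℕ-mono n = ℚP.*-monoʳ-≤-nonNeg (fromℕ n) {{fromℕ-nonNeg n}}

/-*-fromℕ : ∀ a b n → toℚᵘ ((ℤ.+ a ℚ./ suc b) ℚ.* fromℕ n) ℚᵘ.≃ ℚᵘ.mkℚᵘ (ℤ.+ a) b ℚᵘ.* ℚᵘ.mkℚᵘ (ℤ.+ n) 0
/-*-fromℕ a b n = ℚᵘP.≃-trans (ℚP.toℚᵘ-homo-* (ℤ.+ a ℚ./ suc b) (fromℕ n))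
  (ℚᵘP.*-cong (ℚP.toℚᵘ-fromℚᵘ (ℚᵘ.mkℚᵘ (ℤ.+ a) b)) (ℚᵘP.≃-reflexive (toℚᵘ-fromℕ n)))

/-*-fromℕ-≤ : ∀ a b n k → (ℤ.+ a ℚ./ suc b) ℚ.* fromℕ n ℚ.≤ fromℕ k → a * n ≤ k * suc b
/-*-fromℕ-≤ a b n k h
  with ℚᵘP.≤-respˡ-≃ (/-*-fromℕ a b n) (ℚᵘP.≤-respʳ-≃ (ℚᵘP.≃-reflexive (toℚᵘ-fromℕ k)) (ℚP.toℚᵘ-mono-≤ h))
... | ℚᵘ.*≤* q = subst₂ _≤_ (*-identityʳ (a * n)) (cong (k *_) (*-identityʳ (suc b)))
  (ℤP.drop‿+≤+ (subst₂ ℤ._≤_ (trans (cong (ℤ._* ℤ.+ 1) (sym (ℤP.pos-* a n))) (sym (ℤP.pos-* (a * n) 1))) (sym (ℤP.pos-* k (suc b * 1))) q))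

≤-/-*-fromℕ : ∀ a b n k → fromℕ k ℚ.≤ (ℤ.+ a ℚ./ suc b) ℚ.* fromℕ n → k * suc b ≤ a * n
≤-/-*-fromℕ a b n k h
  with ℚᵘP.≤-respʳ-≃ (/-*-fromℕ a b n) (ℚᵘP.≤-respˡ-≃ (ℚᵘP.≃-reflexive (toℚᵘ-fromℕ k)) (ℚP.toℚᵘ-mono-≤ h))
... | ℚᵘ.*≤* q = subst₂ _≤_ (cong (k *_) (*-identityʳ (suc b))) (*-identityʳ (a * n))
  (ℤP.drop‿+≤+ (subst₂ ℤ._≤_ (sym (ℤP.pos-* k (suc b * 1))) (trans (cong (ℤ._* ℤ.+ 1) (sym (ℤP.pos-* a n))) (sym (ℤP.pos-* (a * n) 1))) q))

/-mono-< : ∀ {a c} b → a < c → (ℤ.+ a ℚ./ suc b) ℚ.< (ℤ.+ c ℚ./ suc b)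
/-mono-< {a} {c} b a<c = ℚP.toℚᵘ-cancel-<
  (ℚᵘP.<-respˡ-≃ (ℚᵘP.≃-sym (ℚP.toℚᵘ-fromℚᵘ (ℚᵘ.mkℚᵘ (ℤ.+ a) b)))
    (ℚᵘP.<-respʳ-≃ (ℚᵘP.≃-sym (ℚP.toℚᵘ-fromℚᵘ (ℚᵘ.mkℚᵘ (ℤ.+ c) b)))
      (ℚᵘ.*<* (ℤP.*-monoʳ-<-pos (ℤ.+ suc b) (ℤ.+<+ a<c)))))

clear-denominator : ∀ q → 0ℚ ℚ.< q → ∃[ a ] (1 ≤ a × q ℚ.* fromℕ (↧ₙ q) ≡ fromℕ a)
clear-denominator q@(mkℚ (ℤ.+ zero) b c) 0<q = contradiction 0<q λ { (*<* (ℤ.+<+ ())) }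
clear-denominator q@(mkℚ ℤ.-[1+ a ] b c) 0<q = contradiction 0<q λ { (*<* ()) }
clear-denominator q@(mkℚ (ℤ.+ suc a) b c) 0<q = suc a , s≤s z≤n , ℚP.toℚᵘ-injective
  (ℚᵘP.≃-trans (ℚP.toℚᵘ-homo-* q (fromℕ (suc b)))
  (ℚᵘP.≃-trans (ℚᵘP.*-cong (ℚᵘP.≃-refl {ℚᵘ.mkℚᵘ (ℤ.+ suc a) b}) (ℚᵘP.≃-reflexive (toℚᵘ-fromℕ (suc b))))
  (ℚᵘP.≃-trans (ℚᵘ.*≡* (cong ℤ.+_ (lemma a b)))
    (ℚᵘP.≃-reflexive (sym (toℚᵘ-fromℕ (suc a)))))))
  where
  lemma : ∀ a b → suc a * suc b * 1 ≡ suc a * (suc b * 1)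
  lemma = solve-∀

-- The interface through which ε enters everything that follows. One number p serves on both sides:
-- `κ-lower` keeps κ n + 1 above n/p, `κ-upper` keeps κ n at most (1 - 1/p)n.
record Floor (ε : ℝ) : Set where
  field
    κ       : ℕ → ℕ
    κ-spec  : ∀ i n → (i ≤ κ n) ⇔ (i ≤ ε · n)
    κ-cover : ∀ {n k} → κ n < k → ε · n ≤ k
    κ-least : ∀ {n k} → ε · n ≤ k → κ n ≤ k
    κ-mono  : ∀ {m n} → m ≤ n → κ m ≤ κ n
    κ-suc   : ∀ n → κ (suc n) ≤ suc (κ n)
    κ-shift : ∀ r → ∃[ t ] (∀ n → κ (n + t) + r ≤ κ n + t)
    p       : ℕ
    κ-lower : ∀ n → n < p * suc (κ n)
    κ-upper : ∀ n → p * κ n + n ≤ p * n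

module _ (em : ExcludedMiddle 0ℓ) (ε : ℝ) (ε∈ : InUnitInterval ε) where
  open ℝ ε

  private
    U-up : ∀ {q r} → q ℚ.≤ r → U q → U r
    U-up {q} {r} q≤r Uq with ℚP._<?_ q r
    ... | yes q<r = Equivalence.from (U-rounded r) (q , q<r , Uq)
    ... | no  q≮r = subst U (ℚP.≤-antisym q≤r (ℚP.≮⇒≥ q≮r)) Uq

    L<U : ∀ {q r} → L q → U r → q ℚ.< r
    L<U {q} {r} Lq Ur = ℚP.≰⇒> λ r≤q → disjoint q (Lq , U-up r≤q Ur)

    U-pos : ∀ {q} → U q → ℚ.NonNegative q
    U-pos Uq = ℚ.nonNegative (ℚP.<⇒≤ (L<U (proj₁ ε∈) Uq))

    ≤ε-0 : ∀ n → 0 ≤ ε · n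
    ≤ε-0 n q Uq = subst (ℚ._≤ q ℚ.* fromℕ n) (trans (ℚP.*-zeroˡ (fromℕ n)) refl)
      (*-fromℕ-mono n (ℚP.<⇒≤ (L<U (proj₁ ε∈) Uq)))

    ≤ε-down : ∀ {i k} n → i ≤ k → k ≤ ε · n → i ≤ ε · n
    ≤ε-down n i≤k h q Uq = ℚP.≤-trans (fromℕ-mono-≤ i≤k) (h q Uq)

    ≤ε-up : ∀ {i m n} → m ≤ n → i ≤ ε · m → i ≤ ε · n
    ≤ε-up m≤n h q Uq = ℚP.≤-trans (h q Uq) (ℚP.*-monoˡ-≤-nonNeg q {{U-pos Uq}} (fromℕ-mono-≤ m≤n))

    ≤ε-+ : ∀ {i k m n} → i ≤ ε · m → k ≤ ε · n → (i + k) ≤ ε · (m + n)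
    ≤ε-+ {i} {k} {m} {n} h h′ q Uq = subst₂ ℚ._≤_ (sym (fromℕ-+ i k))
      (trans (sym (ℚP.*-distribˡ-+ q (fromℕ m) (fromℕ n))) (cong (q ℚ.*_) (sym (fromℕ-+ m n))))
      (ℚP.+-mono-≤ (h q Uq) (h′ q Uq))

    ≤ε⇒≤ : ∀ {k n} → k ≤ ε · n → k ≤ n
    ≤ε⇒≤ {k} {n} h = fromℕ-cancel-≤ (subst (fromℕ k ℚ.≤_) (ℚP.*-identityˡ (fromℕ n)) (h 1ℚ (proj₂ ε∈)))

    ≰ε : ∀ {k n} → ¬ (k ≤ ε · n) → ∃[ q ] (U q × q ℚ.* fromℕ n ℚ.< fromℕ k)
    ≰ε {k} {n} ¬h with em {∃[ q ] (U q × q ℚ.* fromℕ n ℚ.< fromℕ k)}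
    ... | yes q = q
    ... | no ¬q = contradiction (λ q Uq → ℚP.≮⇒≥ λ lt → ¬q (q , Uq , lt)) ¬h

    abstract
      search : ∀ n → ∃[ k ] (k ≤ n × (k ≤ ε · n) × (k ≡ n ⊎ ¬ (suc k ≤ ε · n)))
      search n = maximal (λ k → k ≤ ε · n) (λ k → em {k ≤ ε · n}) (≤ε-0 n) n

      κ : ℕ → ℕ
      κ n = proj₁ (search n)

      κ≤ε : ∀ n → κ n ≤ ε · n
      κ≤ε n = proj₁ (proj₂ (proj₂ (search n)))

      κ-max : ∀ n → ¬ (suc (κ n) ≤ ε · n)
      κ-max n = last (proj₂ (proj₂ (proj₂ (search n))))
        where
        last : ∀ {k n} → k ≡ n ⊎ ¬ (suc k ≤ ε · n) → ¬ (suc k ≤ ε · n)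
        last {k} (inj₁ refl) h = <-irrefl refl (≤ε⇒≤ {suc k} {k} h)
        last (inj₂ ¬h)     = ¬h

    spec : ∀ i n → (i ≤ κ n) ⇔ (i ≤ ε · n)
    spec i n = mk⇔ (λ i≤κ → ≤ε-down {i} {κ n} n i≤κ (κ≤ε n))
      (λ h → ≮⇒≥ λ κ<i → κ-max n (≤ε-down {suc (κ n)} {i} n κ<i h))

    mono : ∀ {m n} → m ≤ n → κ m ≤ κ n
    mono {m} {n} m≤n = Equivalence.from (spec (κ m) n) (≤ε-up {κ m} {m} {n} m≤n (κ≤ε m))

    cover : ∀ {n k} → κ n < k → ε · n ≤ k
    cover {n} {k} κ<k q Lq = case ≰ε {k} {n} (λ h → <⇒≱ κ<k (Equivalence.from (spec k n) h)) of λ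
      { (r , Ur , lt) → ℚP.≤-trans (*-fromℕ-mono n (ℚP.<⇒≤ (L<U Lq Ur))) (ℚP.<⇒≤ lt) }

    least : ∀ {n k} → ε · n ≤ k → κ n ≤ k
    least {zero}  {k} h = ≤-trans (≤ε⇒≤ {κ 0} {0} (κ≤ε 0)) z≤n
    least {suc n} {k} h = ≮⇒≥ absurd
      where
      b = 3 * suc n
      absurd : ¬ (k < κ (suc n))
      -- ε is located between two points strictly inside the interval from k/(n+1) to (k+1)/(n+1).
      -- If the smaller is below ε, it violates `h`; if the larger is above ε, it violates k < κ
      -- (n+1).
      absurd k<κ = case located (ℤ.+ (3 * k + 1) ℚ./ b) (ℤ.+ (3 * k + 2) ℚ./ b)
                              (/-mono-< (pred b) (+-monoʳ-< (3 * k) (s≤s (s≤s z≤n)))) of λ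
        { (inj₁ Lq) → <-irrefl refl (by-cert n (/-*-fromℕ-≤ (3 * k + 1) (pred b) (suc n) k (h _ Lq)) (below k n))
        ; (inj₂ Uq) → <-irrefl refl (by-cert n (≤-/-*-fromℕ (3 * k + 2) (pred b) (suc n) (suc k)
            (ℚP.≤-trans (fromℕ-mono-≤ k<κ) (κ≤ε (suc n) _ Uq))) (above k n)) }
        where
        below : ∀ k n → suc (k * (3 * suc n)) + k * (3 * suc n) + n ≡ k * (3 * suc n) + (3 * k + 1) * suc n
        below = solve-∀
        above : ∀ k n → suc (k * (3 * suc n)) + (3 * k + 2) * suc n + n ≡ k * (3 * suc n) + suc k * (3 * suc n)
        above = solve-∀

    -- Maximality of `κ n` yields some r in the upper cut with r·n < κ n + 1. The smaller x of r and
    -- q is again in the upper cut and serves for n and for t at once.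
    grow-by : ∀ {x q r} t c n → U x → x ℚ.≤ r → x ℚ.≤ q → r ℚ.* fromℕ n ℚ.< fromℕ (suc (κ n)) →
      q ℚ.* fromℕ t ℚ.≤ fromℕ c → κ (n + t) ≤ κ n + c
    grow-by {x} t c n Ux x≤r x≤q rn qt = s≤s⁻¹ (fromℕ-cancel-< (ℚP.≤-<-trans (κ≤ε (n + t) x Ux)
      (subst₂ ℚ._<_ (trans (sym (ℚP.*-distribˡ-+ x (fromℕ n) (fromℕ t))) (cong (x ℚ.*_) (sym (fromℕ-+ n t))))
        (sym (fromℕ-+ (suc (κ n)) c))
        (ℚP.+-mono-<-≤ (ℚP.≤-<-trans (*-fromℕ-mono n x≤r) rn) (ℚP.≤-trans (*-fromℕ-mono t x≤q) qt)))))

    grow : ∀ {q} t c → U q → q ℚ.* fromℕ t ℚ.≤ fromℕ c → ∀ n → κ (n + t) ≤ κ n + c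
    grow {q} t c Uq h n = case ≰ε {suc (κ n)} {n} (κ-max n) of λ
      { (r , Ur , lt) → case ℚP.≤-total q r of λ
        { (inj₁ q≤r) → grow-by t c n Uq q≤r ℚP.≤-refl lt h
        ; (inj₂ r≤q) → grow-by t c n Ur ℚP.≤-refl r≤q lt h } }

    Slope : Set
    Slope = ∃[ a ] ∃[ b ] ∃[ q ] (a < b × U q × q ℚ.* fromℕ b ≡ fromℕ a)

    slope : Slope
    slope = from (Equivalence.to (U-rounded 1ℚ) (proj₂ ε∈))
      where
      from : ∃[ q ] (q ℚ.< 1ℚ × U q) → Slope
      from (q , q<1 , Uq) = case clear-denominator q (L<U (proj₁ ε∈) Uq) of λ
        { (a , _ , eq) → a , ↧ₙ q , q , fromℕ-cancel-< (subst₂ ℚ._<_ eq (ℚP.*-identityˡ _)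
            (ℚP.*-monoˡ-<-pos (fromℕ (↧ₙ q)) {{ℚP.normalize-pos (↧ₙ q) 1}} q<1)) , Uq , eq }

    slope-multiple : ∀ {a b q} r → q ℚ.* fromℕ b ≡ fromℕ a → q ℚ.* fromℕ (b * r) ≡ fromℕ (a * r)
    slope-multiple {a} {b} {q} r eq = trans (cong (q ℚ.*_) (fromℕ-* b r))
      (trans (sym (ℚP.*-assoc q (fromℕ b) (fromℕ r))) (trans (cong (ℚ._* fromℕ r) eq) (sym (fromℕ-* a r))))

    -- As ε < a/b with a < b, moving by t = b·r raises κ by at most a·r ≤ b·r - r.
    shift : Slope → ∀ r → ∃[ t ] (∀ n → κ (n + t) + r ≤ κ n + t)
    shift (a , b , q , a<b , Uq , eq) r = b * r , λ n →
      ≤-trans (+-monoˡ-≤ r (grow (b * r) (a * r) Uq (ℚP.≤-reflexive (slope-multiple {a} {b} {q} r eq)) n))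
        (≤-trans (≤-reflexive (trans (+-assoc (κ n) (a * r) r) (cong (κ n +_) (+-comm (a * r) r))))
                 (+-monoʳ-≤ (κ n) (*-monoˡ-≤ r a<b)))

    upper : Slope → ∃[ b ] (∀ n → b * κ n + n ≤ b * n)
    upper (a , b , q , a<b , Uq , eq) = b , λ n → ≤-trans (+-monoˡ-≤ n (bound n))
      (≤-trans (≤-reflexive (+-comm (a * n) n)) (*-monoˡ-≤ n a<b))
      where
      bound : ∀ n → b * κ n ≤ a * n
      bound n = fromℕ-cancel-≤ (subst₂ ℚ._≤_ (trans (sym (fromℕ-* (κ n) b)) (cong fromℕ (*-comm (κ n) b)))
        (trans (ℚP.*-assoc q (fromℕ n) (fromℕ b)) (trans (cong (q ℚ.*_) (trans (sym (fromℕ-* n b)) (cong fromℕ (*-comm n b))))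
          (slope-multiple {a} {b} {q} n eq)))
        (*-fromℕ-mono b (κ≤ε n q Uq)))

    lower : ∃[ q ] (0ℚ ℚ.< q × L q) → ∃[ b ] (∀ n → n < b * suc (κ n))
    lower (q , 0<q , Lq) = from (clear-denominator q 0<q)
      where
      from : ∃[ a ] (1 ≤ a × q ℚ.* fromℕ (↧ₙ q) ≡ fromℕ a) → ∃[ b ] (∀ n → n < b * suc (κ n))
      -- The denominator b of q satisfies 1 ≤ εb, hence m ≤ ε·mb for all m; so n ≥ b(κ n + 1) would
      -- contradict the maximality of `κ n`.
      from (a , 1≤a , eq) = ↧ₙ q , λ n → ≰⇒> λ h → κ-max n
              (≤ε-up {suc (κ n)} {↧ₙ q * suc (κ n)} {n} h (subst (λ m → suc (κ n) ≤ ε · m) (*-comm (suc (κ n)) (↧ₙ q)) (multiples (suc (κ n)))))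
        where
        unit : 1 ≤ ε · (↧ₙ q)
        unit r Ur = ℚP.≤-trans (fromℕ-mono-≤ 1≤a) (subst (ℚ._≤ r ℚ.* fromℕ (↧ₙ q)) eq
          (*-fromℕ-mono (↧ₙ q) (ℚP.<⇒≤ (L<U Lq Ur))))
        multiples : ∀ m → m ≤ ε · (m * ↧ₙ q)
        multiples zero    = ≤ε-0 0
        multiples (suc m) = ≤ε-+ {1} {m} {↧ₙ q} {m * ↧ₙ q} unit (multiples m)

  floor : Floor ε
  floor = assemble (lower (Equivalence.to (L-rounded 0ℚ) (proj₁ ε∈))) (upper slope)
    where
    assemble : ∃[ b ] (∀ n → n < b * suc (κ n)) → ∃[ b ] (∀ n → b * κ n + n ≤ b * n) → Floor ε
    assemble (b , lo) (c , hi) = record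
      { κ = κ
      ; κ-spec = spec
      ; κ-cover = cover
      ; κ-least = least
      ; κ-mono = mono
      ; κ-suc = λ n → subst₂ _≤_ (cong κ (+-comm n 1)) (+-comm (κ n) 1)
          (grow 1 1 (proj₂ ε∈) (ℚP.≤-reflexive (ℚP.*-identityˡ _)) n)
      ; κ-shift = shift slope
      -- Both bounds survive an enlargement of p, the upper one because κ n ≤ n.
      ; p = b + c
      ; κ-lower = λ n → ≤-trans (lo n) (*-monoˡ-≤ (suc (κ n)) (m≤m+n b c))
      ; κ-upper = λ n → by-cert 0 (+-mono-≤ (*-monoʳ-≤ b (≤ε⇒≤ {κ n} {n} (κ≤ε n))) (hi n)) (lemma b c (κ n) n)
      }
      where
      lemma : ∀ b c k n → (b + c) * k + n + (b * n + c * n) + 0 ≡ (b + c) * n + (b * k + (c * k + n))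
      lemma = solve-∀

-- Initial sums, counting functions and sums over lists

S : (ℕ → ℕ) → ℕ → ℕ
S u k = ∑ k (u ∘ suc)

sum-applyUpTo : ∀ (u : ℕ → ℕ) n → sum (applyUpTo u n) ≡ ∑ n u
sum-applyUpTo u zero    = refl
sum-applyUpTo u (suc n) = trans (cong (u 0 +_) (sum-applyUpTo (u ∘ suc) n)) (sym (∑-split 1 n u))

sum-[1⋯] : ∀ (u : ℕ → ℕ) k → sum (map u [1⋯ k ]) ≡ S u k
sum-[1⋯] u k = trans (cong sum (map-applyUpTo suc u k)) (sum-applyUpTo (u ∘ suc) k)

term≤S : ∀ (u : ℕ → ℕ) {i k} → 1 ≤ i → i ≤ k → u i ≤ S u k
term≤S u {suc i} _ i<k = ≤-trans (m≤n+m (u (suc i)) (∑ i (u ∘ suc))) (∑-monoˡ (u ∘ suc) i<k)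

k≤S : ∀ (u : ℕ → ℕ) → Positive u → ∀ k → k ≤ S u k
k≤S u u⁺ k = ≤-trans (≤-reflexive (trans (sym (*-identityʳ k)) (sym (∑-const k 1))))
  (∑-mono k λ i _ → u⁺ (suc i) (s≤s z≤n))

-- A property that is inherited by smaller indices is kept by the filter on an initial segment.
length-filter-initial : ∀ {P : Pred ℕ 0ℓ} (P? : Decidable P) (u : ℕ → ℕ) → (∀ i → P (u (suc i)) → P (u i)) →
  ∀ n i → i < n → P (u i) ⇔ (i < length (filter P? (applyUpTo u n)))
length-filter-initial P? u down (suc n) i i<n with P? (u 0)
length-filter-initial P? u down (suc n) zero    _   | yes P0 = mk⇔ (λ _ → s≤s z≤n) (λ _ → P0)
length-filter-initial P? u down (suc n) (suc i) i<n | yes P0 =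
  mk⇔ (λ q → s≤s (Equivalence.to IH q)) (λ { (s≤s q) → Equivalence.from IH q })
  where IH = length-filter-initial P? (u ∘ suc) (down ∘ suc) n i (s≤s⁻¹ i<n)
length-filter-initial {P} P? u down (suc n) i i<n | no ¬P0 =
  mk⇔ (λ Pi → contradiction Pi (none i)) (λ q → contradiction (≤-trans (s≤s z≤n) q) (empty n))
  where
  none : ∀ i → ¬ P (u i)
  none zero    = ¬P0
  none (suc i) = none i ∘ down i
  empty : ∀ n → ¬ (1 ≤ length (filter P? (applyUpTo (u ∘ suc) n)))
  empty (suc n) q = none 1 (Equivalence.from (length-filter-initial P? (u ∘ suc) (down ∘ suc) (suc n) 0 (s≤s z≤n)) q)

strict⇒mono : ∀ {u} → StrictlyIncreasing u → ∀ {m n} → 1 ≤ m → m ≤ n → u m ≤ u n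
strict⇒mono inc {m} {n} 1≤m m≤n with m≤n⇒m<n∨m≡n m≤n
... | inj₁ m<n  = <⇒≤ (inc m n 1≤m m<n)
... | inj₂ refl = ≤-refl

strict⇒reflects-≤ : ∀ {u} → StrictlyIncreasing u → ∀ {m n} → 1 ≤ n → u m ≤ u n → m ≤ n
strict⇒reflects-≤ inc {m} {n} 1≤n h = ≮⇒≥ λ n<m → <⇒≱ (inc n m 1≤n n<m) h

n≤strict : ∀ {u} → StrictlyIncreasing u → ∀ n → 1 ≤ u 1 → 1 ≤ n → n ≤ u n
n≤strict inc (suc zero)    h _ = h
n≤strict inc (suc (suc n)) h _ = ≤-trans (s≤s (n≤strict inc (suc n) h (s≤s z≤n))) (inc (suc n) (2+ n) (s≤s z≤n) ≤-refl)

n≤term : ∀ A n → 1 ≤ n → n ≤ term A n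
n≤term A n = n≤strict (Sequence.increasing A) n (Sequence.positive A 1 ≤-refl)

-- A Galois connection between values and indices; all later arguments about counts go through it.
count-spec : ∀ A n i → 1 ≤ i → (term A i ≤ n) ⇔ (i ≤ ∣ A ∩[ n ]∣)
count-spec A n (suc i) _ with i <? n
... | yes i<n = length-filter-initial (λ i → term A i ≤? n) suc
        (λ i → ≤-trans (strict⇒mono (Sequence.increasing A) (s≤s z≤n) (n≤1+n (suc i)))) n i i<n
... | no  i≮n = mk⇔ (λ q → contradiction (≤-trans (n≤term A (suc i) (s≤s z≤n)) q) i≮n)
        (λ q → contradiction (≤-trans q (length≤ n)) i≮n)
  where
  length≤ : ∀ m → length (filter (λ i → term A i ≤? n) (applyUpTo suc m)) ≤ m
  length≤ m = ≤-trans (length-filter (λ i → term A i ≤? n) (applyUpTo suc m)) (≤-reflexive (length-applyUpTo suc m))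

sum-++-∷ : ∀ xs y ys → sum (xs ++ y ∷ ys) ≡ y + sum (xs ++ ys)
sum-++-∷ []       y ys = refl
sum-++-∷ (x ∷ xs) y ys = trans (cong (x +_) (sum-++-∷ xs y ys)) (lemma x y (sum (xs ++ ys)))
  where
  lemma : ∀ x y z → x + (y + z) ≡ y + (x + z)
  lemma = solve-∀

sum-mono-⊆ : ∀ {xs ys} → Unique xs → All (_∈ ys) xs → sum xs ≤ sum ys
sum-mono-⊆ [] [] = z≤n
sum-mono-⊆ {x ∷ xs} (x∉ ∷ u) (x∈ ∷ sub) with ∈-∃++ x∈
... | ys , zs , refl = ≤-trans (+-monoʳ-≤ x (sum-mono-⊆ u (All.tabulate λ {y} y∈ → other y∈)))
        (≤-reflexive (sym (sum-++-∷ ys x zs)))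
  where
  other : ∀ {y} → y ∈ xs → y ∈ ys ++ zs
  other {y} y∈ with ∈-++⁻ ys (All.lookup sub y∈)
  ... | inj₁ p           = ∈-++⁺ˡ p
  ... | inj₂ (there p)   = ∈-++⁺ʳ ys p
  ... | inj₂ (here refl) = contradiction refl (All.lookup x∉ y∈)

member≤sum : ∀ {x xs} → x ∈ xs → x ≤ sum xs
member≤sum (here refl) = m≤m+n _ _
member≤sum {xs = y ∷ xs} (there p) = ≤-trans (member≤sum p) (m≤n+m _ y)

-- The upper bound: recursive inequalities and subsequences with gaps

module Comparison {ε : ℝ} (fl : Floor ε) (f : ℕ → ℕ) (f⁺ : Positive f)
                  (n₀ : ℕ) (f-rec : ∀ n → n₀ ≤ n → f n ≡ S f (Floor.κ fl n)) where
  open Floor fl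

  f-mono : ∀ {m n} → n₀ ≤ m → m ≤ n → f m ≤ f n
  f-mono {m} {n} n₀≤m m≤n = subst₂ _≤_ (sym (f-rec m n₀≤m)) (sym (f-rec n (≤-trans n₀≤m m≤n)))
    (∑-monoˡ (f ∘ suc) (κ-mono m≤n))

  -- The comparison is with f shifted by t, since κ (n + t) + r ≤ κ n + t absorbs the r extra terms;
  -- the constant K absorbs the first t terms.
  =O-from-recursion : ∀ a r N → (∀ n → N ≤ n → a n ≤ suc (S a (κ n + r))) → a =O f
  =O-from-recursion a r N h = C , t + (n₀ + 1) , λ m m≥ → conclude m m≥
    where
    t = proj₁ (κ-shift r)
    K = suc (S a t)
    n₁ = N + (n₀ + 2 * p)
    C = ∑ n₁ (λ n → a (n + t) + K)

    2≤κ : ∀ {n} → 2 * p ≤ n → 2 ≤ κ n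
    2≤κ {n} h = ≰⇒> λ κ≤1 → <⇒≱ (κ-lower n) (≤-trans (≤-trans (*-monoʳ-≤ p (s≤s κ≤1)) (≤-reflexive (*-comm p 2))) h)

    κ<n : ∀ n → 1 ≤ n → κ n < n
    κ<n n 1≤n = ≰⇒> λ n≤κ → <⇒≱ (m<m+n (p * κ n) 1≤n) (≤-trans (κ-upper n) (*-monoʳ-≤ p n≤κ))

    early : ∀ n → n < n₁ → 1 ≤ n → a (n + t) + K ≤ C * f n
    early n n<n₁ 1≤n = ≤-trans (≤-trans (m≤n+m _ (∑ n u)) (∑-monoˡ u n<n₁)) (m≤m*n C (f n) {{>-nonZero (f⁺ n 1≤n)}})
      where u = λ n → a (n + t) + K

    late : ∀ n → n₁ ≤ n → (∀ {i} → i < n → 1 ≤ i → a (i + t) + K ≤ C * f i) → a (n + t) + K ≤ C * f n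
    late n n₁≤n IH = begin
      a (n + t) + K                                   ≤⟨ +-monoˡ-≤ K (h (n + t) (≤-trans N≤n (m≤m+n n t))) ⟩
      suc (S a (κ (n + t) + r)) + K                   ≤⟨ +-monoˡ-≤ K (s≤s (∑-monoˡ (a ∘ suc) (≤-trans (proj₂ (κ-shift r) n) (≤-reflexive (+-comm (κ n) t))))) ⟩
      suc (S a (t + κ n)) + K                         ≡⟨ cong (λ s → suc s + K) (∑-split t (κ n) (a ∘ suc)) ⟩
      K + T + K                                       ≡⟨ lemma K T ⟩
      -- Two copies of K have to be absorbed. Every summand of the induction hypothesis carries a K
      -- of its own, and there are κ n ≥ 2 of them.
      T + 2 * K                                       ≤⟨ +-monoʳ-≤ T (*-monoˡ-≤ K (2≤κ (≤-trans (m≤n+m (2 * p) n₀) (≤-trans (m≤n+m _ N) n₁≤n)))) ⟩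
      T + κ n * K                                     ≡⟨ cong (T +_) (sym (∑-const (κ n) K)) ⟩
      T + ∑ (κ n) (λ _ → K)                           ≡⟨ sym (∑-+ (κ n) _ _) ⟩
      ∑ (κ n) (λ i → a (suc (t + i)) + K)             ≤⟨ ∑-mono (κ n) (λ i i<κ → subst (λ m → a m + K ≤ C * f (suc i)) (cong suc (+-comm i t))
                                                            (IH (<-≤-trans (s≤s i<κ) (κ<n n 1≤n)) (s≤s z≤n))) ⟩
      ∑ (κ n) (λ i → C * f (suc i))                   ≡⟨ ∑-* (κ n) C (f ∘ suc) ⟩
      C * S f (κ n)                                   ≡⟨ cong (C *_) (sym (f-rec n (≤-trans (m≤m+n n₀ _) (≤-trans (m≤n+m _ N) n₁≤n)))) ⟩
      C * f n                                         ∎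
      where
      open ≤-Reasoning
      T = ∑ (κ n) (λ i → a (suc (t + i)))
      N≤n = ≤-trans (m≤m+n N _) n₁≤n
      1≤p : 1 ≤ p
      1≤p = n≢0⇒n>0 λ p≡0 → contradiction (subst (λ p → 0 < p * suc (κ 0)) p≡0 (κ-lower 0)) λ ()
      1≤n : 1 ≤ n
      1≤n = ≤-trans (≤-trans 1≤p (m≤m+n p _)) (≤-trans (m≤n+m (2 * p) n₀) (≤-trans (m≤n+m _ N) n₁≤n))
      lemma : ∀ K T → K + T + K ≡ T + 2 * K
      lemma = solve-∀

    claim : ∀ n → 1 ≤ n → a (n + t) + K ≤ C * f n
    claim = <-rec (λ n → 1 ≤ n → a (n + t) + K ≤ C * f n) λ n IH 1≤n → case n <? n₁ of λ
      { (yes n<n₁) → early n n<n₁ 1≤n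
      ; (no  n≮n₁) → late n (≮⇒≥ n≮n₁) IH }

    conclude : ∀ m → t + (n₀ + 1) ≤ m → a m ≤ C * f m
    conclude m m≥ with m≤n⇒∃[o]m+o≡n m≥
    ... | o , refl = ≤-trans (≤-trans (≤-trans (≤-reflexive (cong a (lemma t n₀ o))) (m≤m+n _ K))
            (claim (n₀ + 1 + o) (≤-trans (m≤n+m 1 n₀) (m≤m+n (n₀ + 1) o))))
            (*-monoʳ-≤ C (f-mono (≤-trans (m≤m+n n₀ 1) (m≤m+n (n₀ + 1) o)) (≤-trans (m≤n+m (n₀ + 1 + o) t) (≤-reflexive (sym (+-assoc t (n₀ + 1) o))))))
      where
      lemma : ∀ t n o → t + (n + 1) + o ≡ n + 1 + o + t
      lemma = solve-∀

-- If infinitely often a n exceeds the sum of the first κ n + r terms, whatever r, then one can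
-- repeatedly skip the indices between κ n + (previous jump) and n and stay above density ε.
module Gaps {ε : ℝ} (fl : Floor ε) (A : Sequence)
  (jump : ∀ r N → ∃[ n ] (N ≤ n × suc (S (term A) (Floor.κ fl n + r)) < term A n)) where
  open Floor fl
  private
    a = term A
    inc = Sequence.increasing A

  resume : ℕ → ℕ
  resume zero    = 1
  resume (suc k) = proj₁ (jump (resume k) (suc (resume k)))

  -- The run from `resume k` to `stop k` has κ (resume (k + 1)) + 1 members, so it alone provides
  -- the density needed until the next run begins.
  stop : ℕ → ℕ
  stop k = κ (resume (suc k)) + resume k

  resume-inc : ∀ k → resume k < resume (suc k)
  resume-inc k = proj₁ (proj₂ (jump (resume k) (suc (resume k))))

  a-jump : ∀ k → suc (S a (stop k)) < a (resume (suc k))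
  a-jump k = proj₂ (proj₂ (jump (resume k) (suc (resume k))))

  resume-mono : ∀ {k l} → k ≤ l → resume k ≤ resume l
  resume-mono {zero}  {zero}  _ = ≤-refl
  resume-mono {k} {suc l} k≤l with m≤n⇒m<n∨m≡n k≤l
  ... | inj₁ k<1+l = ≤-trans (resume-mono (s≤s⁻¹ k<1+l)) (<⇒≤ (resume-inc l))
  ... | inj₂ refl  = ≤-refl

  k<resume : ∀ k → k < resume k
  k<resume zero    = s≤s z≤n
  k<resume (suc k) = ≤-trans (s≤s (k<resume k)) (resume-inc k)

  stop-mono : ∀ {k l} → k ≤ l → stop k ≤ stop l
  stop-mono k≤l = +-mono-≤ (κ-mono (resume-mono (s≤s k≤l))) (resume-mono k≤l)

  stop<resume : ∀ k → stop k < resume (suc k)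
  stop<resume k = ≰⇒> λ h → <⇒≱ (a-jump k) (≤-trans (term≤S a (≤-trans (s≤s z≤n) (k<resume (suc k))) h) (n≤1+n _))

  -- (k , x) : the current index x lies in the k-th kept run.
  advance : ∀ k x → Dec (x < stop k) → ℕ × ℕ
  advance k x (yes _) = k , suc x
  advance k x (no  _) = suc k , resume (suc k)

  next : ℕ × ℕ → ℕ × ℕ
  next (k , x) = advance k x (x <? stop k)

  state : ℕ → ℕ × ℕ
  state zero    = 0 , 1
  state (suc l) = next (state l)

  -- Here l is the number of indices kept before x; the last inequality says that l is at least κ
  -- (resume k) + (x - resume k).
  Inv : ℕ → ℕ × ℕ → Set
  Inv l (k , x) = resume k ≤ x × x ≤ stop k × κ (resume k) + suc x ≤ suc l + resume k

  κ1≡0 : κ 1 ≡ 0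
  κ1≡0 with κ 1 in eq
  ... | zero  = refl
  ... | suc m = contradiction (subst (λ m → p * m + 1 ≤ p * 1) eq (κ-upper 1))
                  (<⇒≱ (≤-trans (s≤s (*-monoʳ-≤ p (s≤s (z≤n {m})))) (≤-reflexive (+-comm 1 _))))

  inv : ∀ l → Inv l (state l)
  inv zero = ≤-refl , m≤n+m 1 _ , ≤-reflexive (cong (_+ 2) κ1≡0)
  inv (suc l) with state l | inv l
  ... | k , x | lo , hi , h with x <? stop k
  ...   | yes x<s = m≤n⇒m≤1+n lo , x<s , ≤-trans (≤-reflexive (+-suc (κ (resume k)) (suc x))) (s≤s h)
  ...   | no  x≮s = ≤-refl , m≤n+m _ _ , ≤-trans (≤-reflexive (+-suc κ′ (resume (suc k)))) (s≤s (+-monoˡ-≤ (resume (suc k)) κ′≤))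
    where
    κ′ = κ (resume (suc k))
    κ′≤ : κ′ ≤ suc l
    κ′≤ = by-cert (suc (κ (resume k))) (+-mono-≤ h (≮⇒≥ x≮s)) (lemma (κ (resume k)) κ′ x (resume k) l)
      where
      lemma : ∀ a b x r l → b + (suc l + r + x) + suc a ≡ suc l + (a + suc x + (b + r))
      lemma = solve-∀

  κ-lipschitz : ∀ n d → κ (n + d) ≤ κ n + d
  κ-lipschitz n zero    = ≤-reflexive (trans (cong κ (+-identityʳ n)) (sym (+-identityʳ _)))
  κ-lipschitz n (suc d) = ≤-trans (≤-reflexive (cong κ (+-suc n d)))
    (≤-trans (κ-suc (n + d)) (≤-trans (s≤s (κ-lipschitz n d)) (≤-reflexive (sym (+-suc (κ n) d)))))

  index : ℕ → ℕ
  index l = proj₂ (state l)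

  index-inc : ∀ l → index l < index (suc l)
  index-inc l with state l | inv l
  ... | k , x | lo , hi , h with x <? stop k
  ...   | yes x<s = ≤-refl
  ...   | no  x≮s = ≤-trans (s≤s hi) (stop<resume k)

  -- Inside a run κ grows by at most one per index, as does the count. Inside a gap κ j is at most κ
  -- at the end of the gap, which the run just completed has paid for.
  κ<index : ∀ l j → j < index (suc l) → κ j < suc l
  κ<index l j j< with state l | inv l
  ... | k , x | lo , hi , h with x <? stop k
  ...   | yes x<s = s≤s (≤-trans (κ-mono (s≤s⁻¹ j<)) κx≤)
    where
    κx≤ : κ x ≤ l
    κx≤ with m≤n⇒∃[o]m+o≡n lo
    ... | d , refl = ≤-trans (κ-lipschitz (resume k) d) (by-cert 0 h (lemma (κ (resume k)) d (resume k) l))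
      where
      lemma : ∀ a d r l → a + d + (suc l + r) + 0 ≡ l + (a + suc (r + d))
      lemma = solve-∀
  ...   | no  x≮s = s≤s (≤-trans (κ-mono (<⇒≤ j<)) (by-cert (κ (resume k)) (+-mono-≤ h (≮⇒≥ x≮s)) (lemma (κ (resume k)) (κ (resume (suc k))) x (resume k) l)))
    where
    lemma : ∀ a b x r l → b + (suc l + r + x) + a ≡ l + (a + suc x + (b + r))
    lemma = solve-∀

  φ : ℕ → ℕ
  φ l = index (pred l)

  index-mono : ∀ {l m} → l < m → index l < index m
  index-mono {l} {suc m} (s≤s l≤m) with m≤n⇒m<n∨m≡n l≤m
  ... | inj₁ l<m  = <-trans (index-mono l<m) (index-inc m)
  ... | inj₂ refl = index-inc l

  1≤index : ∀ l → 1 ≤ index l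
  1≤index l with state l | inv l
  ... | k , x | lo , _ = ≤-trans (≤-trans (s≤s z≤n) (k<resume k)) lo

  φ⁺ : Positive φ
  φ⁺ l _ = 1≤index (pred l)

  φ-inc : StrictlyIncreasing φ
  φ-inc (suc m) (suc n) _ (s≤s m<n) = index-mono m<n

  B : Sequence
  B = record
    { term = a ∘ φ
    ; positive = λ l 1≤l → Sequence.positive A (φ l) (φ⁺ l 1≤l)
    ; increasing = λ m n 1≤m m<n → inc (φ m) (φ n) (φ⁺ m 1≤m) (φ-inc m n 1≤m m<n) }

  B-dense : Eventually (λ n → ε · ∣ A ∩[ n ]∣ ≤ ∣ B ∩[ n ]∣)
  B-dense = term B 1 , λ n b₁≤n → κ-cover {∣ A ∩[ n ]∣} {∣ B ∩[ n ]∣} (dense n _ refl (Equivalence.to (count-spec B n 1 ≤-refl) b₁≤n))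
    where
    dense : ∀ n c → ∣ B ∩[ n ]∣ ≡ c → 1 ≤ c → κ ∣ A ∩[ n ]∣ < c
    dense n (suc l) eq _ = κ<index l ∣ A ∩[ n ]∣ (≰⇒> λ h → 1+n≰n (subst (suc (suc l) ≤_) eq
      (Equivalence.to (count-spec B n (suc (suc l)) (s≤s z≤n))
        (Equivalence.from (count-spec A n (index (suc l)) (1≤index (suc l))) h))))

  -- The number 1 + S a (stop N) is missed: all kept terms up to `stop N` together fall short of it,
  -- and each later one exceeds it.
  B-incomplete : ¬ Complete B
  B-incomplete (N , h) with h (suc (S a (stop N))) (≤-trans (≤-trans (<⇒≤ (k<resume N)) (m≤n+m (resume N) _))
                                   (≤-trans (k≤S a (Sequence.positive A) (stop N)) (n≤1+n _)))
  ... | xs , unique , xs∈B , eq = 1+n≰n (≤-trans (≤-reflexive eq) (≤-trans (sum-mono-⊆ unique (All.tabulate small))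
          (≤-reflexive (sum-[1⋯] a (stop N)))))
    where
    index-side : ∀ l → index l ≤ stop N ⊎ resume (suc N) ≤ index l
    index-side l with state l | inv l
    ... | k , x | lo , hi , _ with k ≤? N
    ...   | yes k≤N = inj₁ (≤-trans hi (stop-mono k≤N))
    ...   | no  k≰N = inj₂ (≤-trans (resume-mono (≰⇒> k≰N)) lo)

    small : ∀ {x} → x ∈ xs → x ∈ map a [1⋯ stop N ]
    small {x} x∈ with All.lookup xs∈B x∈
    ... | i , _ , refl with index-side (pred i) | 1≤index (pred i)
    ...   | inj₁ ≤stop | 1≤ = ∈-map⁺ a (subst (_∈ [1⋯ stop N ]) (suc-pred (φ i) {{>-nonZero 1≤}})
              (∈-applyUpTo⁺ suc (subst (_≤ stop N) (sym (suc-pred (φ i) {{>-nonZero 1≤}})) ≤stop)))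
    ...   | inj₂ ≥resume | _ = contradiction (≤-trans (strict⇒mono inc (≤-trans (s≤s z≤n) (k<resume (suc N))) ≥resume)
              (≤-trans (member≤sum x∈) (≤-reflexive (sym eq)))) (<⇒≱ (a-jump N))

  not-ε-complete : ¬ (ε -Complete A)
  not-ε-complete complete = B-incomplete (complete B (φ , φ⁺ , φ-inc , λ _ _ → refl) B-dense)

module _ (em : ExcludedMiddle 0ℓ) {ε : ℝ} (fl : Floor ε) where
  open Floor fl

  RecursionBound : (ℕ → ℕ) → Set
  RecursionBound a = ∃[ r ] ∃[ N ] (∀ n → N ≤ n → a n ≤ suc (S a (κ n + r)))

  jumps : ∀ a → ¬ RecursionBound a → ∀ r N → ∃[ n ] (N ≤ n × suc (S a (κ n + r)) < a n)
  jumps a ¬bound r N with em {∃[ n ] (N ≤ n × suc (S a (κ n + r)) < a n)}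
  ... | yes j = j
  ... | no ¬j = contradiction (r , N , λ n N≤n → ≮⇒≥ λ lt → ¬j (n , N≤n , lt)) ¬bound

  complete⇒recursion-bound : ∀ A → ε -Complete A → RecursionBound (term A)
  complete⇒recursion-bound A complete = case em {RecursionBound (term A)} of λ
    { (yes bound) → bound
    ; (no ¬bound) → ⊥-elim (Gaps.not-ε-complete fl A (jumps (term A) ¬bound) complete) }

-- Digits

[q*n+x]/n≡q : ∀ q {x} n .{{_ : NonZero n}} → x < n → (q * n + x) / n ≡ q
[q*n+x]/n≡q q {x} n x<n = trans (+-distrib-/-∣ˡ x (divides q refl))
  (trans (cong₂ _+_ (m*n/n≡m q n) (m<n⇒m/n≡0 x<n)) (+-identityʳ q))

[q*n+x]%n≡x : ∀ q {x} n .{{_ : NonZero n}} → x < n → (q * n + x) % n ≡ x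
[q*n+x]%n≡x q {x} n x<n = trans (cong (_% n) (+-comm (q * n) x)) (trans ([m+kn]%n≡m%n x q n) (m<n⇒m%n≡m x<n))

-- The first v base-Y digits of x, reread in base G.
spread : (Y : ℕ) .{{_ : NonZero Y}} → ℕ → ℕ → ℕ → ℕ
spread Y G zero    x = 0
spread Y G (suc v) x = x % Y + G * spread Y G v (x / Y)

-- (q·Y + x)·Y^i + l has x as its i-th digit, and q and l hold the other digits; rereading replaces
-- the place value Y^i of x by G^i.
spread-digit : ∀ Y .{{_ : NonZero Y}} G v i q l → i < v → l < Y ^ i →
  ∃[ R ] (∀ x → x < Y → spread Y G v ((q * Y + x) * Y ^ i + l) ≡ R + x * G ^ i)
spread-digit Y G (suc v) zero    q l i<v (s≤s z≤n) = G * spread Y G v q , λ x x<Y →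
  trans (cong (spread Y G (suc v)) (trans (+-identityʳ _) (*-identityʳ (q * Y + x))))
  (trans (cong₂ _+_ ([q*n+x]%n≡x q Y x<Y) (cong (λ z → G * spread Y G v z) ([q*n+x]/n≡q q Y x<Y)))
  (trans (+-comm x _) (cong (G * spread Y G v q +_) (sym (*-identityʳ x)))))
spread-digit Y G (suc v) (suc i) q l (s≤s i<v) l<
  with spread-digit Y G v i q (l / Y) i<v (m<n*o⇒m/o<n (subst (l <_) (*-comm Y (Y ^ i)) l<))
... | R , eq = l % Y + G * R , λ x x<Y →
  trans (cong (spread Y G (suc v)) (number x))
  (trans (cong₂ _+_ ([q*n+x]%n≡x (rest x) Y (m%n<n l Y)) (cong (λ z → G * spread Y G v z) ([q*n+x]/n≡q (rest x) Y (m%n<n l Y))))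
  (trans (cong (λ z → l % Y + G * z) (eq x x<Y)) (value (l % Y) G R x (G ^ i))))
  where
  rest : ℕ → ℕ
  rest x = (q * Y + x) * Y ^ i + l / Y
  number : ∀ x → (q * Y + x) * Y ^ suc i + l ≡ rest x * Y + l % Y
  number x = trans (cong ((q * Y + x) * Y ^ suc i +_) (m≡m%n+[m/n]*n l Y)) (shuffle (q * Y + x) Y (Y ^ i) (l % Y) (l / Y))
    where
    shuffle : ∀ a y z m d → a * (y * z) + (m + d * y) ≡ (a * z + d) * y + m
    shuffle = solve-∀
  value : ∀ m G R x g → m + G * (R + x * g) ≡ m + G * R + x * (G * g)
  value = solve-∀

spread-≤ : ∀ Y .{{_ : NonZero Y}} G .{{_ : NonZero G}} v x → spread Y G (suc v) x ≤ Y * suc v * G ^ v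
spread-≤ Y G zero x = ≤-trans (≤-reflexive (trans (cong (x % Y +_) (*-zeroʳ G)) (+-identityʳ _)))
  (≤-trans (<⇒≤ (m%n<n x Y)) (≤-reflexive (lemma Y)))
  where
  lemma : ∀ Y → Y ≡ Y * 1 * 1
  lemma = solve-∀
spread-≤ Y G (suc v) x = ≤-trans (+-mono-≤ (≤-trans (<⇒≤ (m%n<n x Y)) (m≤m*n Y (G ^ suc v) {{m^n≢0 G (suc v)}}))
  (*-monoʳ-≤ G (spread-≤ Y G v (x / Y)))) (≤-reflexive (lemma Y G v (G ^ v)))
  where
  lemma : ∀ Y G v g → Y * (G * g) + G * (Y * suc v * g) ≡ Y * suc (suc v) * (G * g)
  lemma = solve-∀

-- Averaging over all digits but the i-th: first over those above it, collected in q, then over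
-- those below it, collected in l.
dense-line : ∀ Y K v i w → 1 ≤ Y → i < v → Y ^ v * K ≤ ∑ (Y ^ v) w →
  ∃[ q ] ∃[ l ] (l < Y ^ i × (∀ x → x < Y → (q * Y + x) * Y ^ i + l < Y ^ v) ×
    Y * K ≤ ∑ Y (λ x → w ((q * Y + x) * Y ^ i + l)))
dense-line Y K v i w 1≤Y i<v h with m≤n⇒∃[o]m+o≡n i<v
... | u , refl = main
  where
  instance _ = >-nonZero 1≤Y
  eq : Y ^ (suc i + u) ≡ (Y ^ u * Y) * Y ^ i
  eq = trans (^-distribˡ-+-* Y (suc i) u) (lemma Y (Y ^ i) (Y ^ u))
    where
    lemma : ∀ y a b → y * a * b ≡ b * y * a
    lemma = solve-∀
  F : ℕ → ℕ → ℕ → ℕ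
  F q l x = w ((q * Y + x) * Y ^ i + l)
  sums : ∑ (Y ^ (suc i + u)) w ≡ ∑ (Y ^ u) (λ q → ∑ (Y ^ i) (λ l → ∑ Y (F q l)))
  sums = trans (cong (λ n → ∑ n w) eq) (trans (∑-blocks (Y ^ u * Y) (Y ^ i) w)
    (trans (∑-blocks (Y ^ u) Y _) (∑-cong (Y ^ u) λ q _ → ∑-swap Y (Y ^ i) λ x l → F q l x)))
  main : ∃[ q ] ∃[ l ] (l < Y ^ i × (∀ x → x < Y → (q * Y + x) * Y ^ i + l < Y ^ (suc i + u)) × Y * K ≤ ∑ Y (F q l))
  main with pigeonhole-≤ (Y ^ u) (Y ^ i * (Y * K)) _ (m^n>0 Y u)
        (≤-trans (≤-reflexive (trans (lemma (Y ^ u) (Y ^ i) Y K) (cong (_* K) (sym eq)))) (≤-trans h (≤-reflexive sums)))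
    where
    lemma : ∀ b a y k → b * (a * (y * k)) ≡ b * y * a * k
    lemma = solve-∀
  ... | q , q< , h₁ with pigeonhole-≤ (Y ^ i) (Y * K) _ (m^n>0 Y i) h₁
  ...   | l , l< , h₂ = q , l , l< , in-range , h₂
    where
    in-range : ∀ x → x < Y → (q * Y + x) * Y ^ i + l < Y ^ (suc i + u)
    in-range x x<Y = begin-strict
      (q * Y + x) * Y ^ i + l     <⟨ +-monoʳ-< _ l< ⟩
      (q * Y + x) * Y ^ i + Y ^ i ≡⟨ +-comm _ (Y ^ i) ⟩
      suc (q * Y + x) * Y ^ i     ≤⟨ *-monoˡ-≤ (Y ^ i) (≤-trans (+-monoʳ-< (q * Y) x<Y) (≤-reflexive (+-comm (q * Y) Y))) ⟩
      suc q * Y * Y ^ i           ≤⟨ *-monoˡ-≤ (Y ^ i) (*-monoˡ-≤ Y q<) ⟩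
      Y ^ u * Y * Y ^ i           ≡⟨ sym eq ⟩
      Y ^ (suc i + u)             ∎
      where open ≤-Reasoning

-- Rectangles

-- A set of k points has at least k - 1 pairs.
∑≤1+pairs : ∀ n c → (∀ i → c i ≤ 1) → ∑ n c ≤ 1 + ∑ n (λ v → ∑ v (λ u → c u * c v))
∑≤1+pairs zero    c c≤1 = z≤n
∑≤1+pairs (suc n) c c≤1 with c n in eq | ∑≤1+pairs n c c≤1
... | zero  | IH = ≤-trans (≤-reflexive (+-identityʳ _)) (≤-trans IH (s≤s (m≤m+n _ _)))
... | suc k | IH with ∑ n c in eq′
...   | zero  = ≤-trans (≤-trans (≤-reflexive (sym eq)) (c≤1 n)) (s≤s z≤n)
...   | suc m = ≤-trans (+-mono-≤ IH (≤-trans (≤-trans (≤-reflexive (sym eq)) (c≤1 n)) last)) ≤-refl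
  where
  last : 1 ≤ ∑ n (λ u → c u * suc k)
  last = ≤-trans (≤-trans (s≤s z≤n) (≤-reflexive (sym eq′))) (∑-mono n λ i _ → m≤m*n (c i) (suc k))

product≥1 : ∀ {m n} → 1 ≤ m * n → 1 ≤ m × 1 ≤ n
product≥1 {suc m} {suc n} _ = s≤s z≤n , s≤s z≤n
product≥1 {suc m} {zero}  h = contradiction (≤-trans h (≤-reflexive (*-zeroʳ (suc m)))) λ ()

product≤1 : ∀ {m n} → m ≤ 1 → n ≤ 1 → m * n ≤ 1
product≤1 = *-mono-≤

-- The counting argument for four-cycles in bipartite graphs: each row with k hits contains at least
-- k - 1 pairs of columns, so there are more than n² incidences of rows with pairs, and some pair
-- occurs in two rows.
rectangle : ∀ m n (χ : ℕ → ℕ → ℕ) → (∀ x u → χ x u ≤ 1) → m + n * n < ∑ m (λ x → ∑ n (χ x)) →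
  ∃[ x ] ∃[ x′ ] ∃[ u ] ∃[ u′ ] (x < x′ × x′ < m × u < u′ × u′ < n ×
    1 ≤ χ x u × 1 ≤ χ x u′ × 1 ≤ χ x′ u × 1 ≤ χ x′ u′)
rectangle m n χ χ≤1 h with pigeonhole-< n n _ many
  where
  open ≤-Reasoning
  many : n * n < ∑ n (λ v → ∑ v (λ u → ∑ m (λ x → χ x u * χ x v)))
  many = +-cancelˡ-< m _ _ (begin-strict
    m + n * n                                                     <⟨ h ⟩
    ∑ m (λ x → ∑ n (χ x))                                         ≤⟨ ∑-mono m (λ x _ → ∑≤1+pairs n (χ x) (χ≤1 x)) ⟩
    ∑ m (λ x → 1 + ∑ n (λ v → ∑ v (λ u → χ x u * χ x v)))         ≡⟨ ∑-+ m _ _ ⟩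
    ∑ m (λ _ → 1) + ∑ m (λ x → ∑ n (λ v → ∑ v (λ u → χ x u * χ x v))) ≡⟨ cong₂ _+_ (trans (∑-const m 1) (*-identityʳ m)) (∑-swap m n _) ⟩
    m + ∑ n (λ v → ∑ m (λ x → ∑ v (λ u → χ x u * χ x v)))         ≡⟨ cong (m +_) (∑-cong n λ v _ → ∑-swap m v _) ⟩
    m + ∑ n (λ v → ∑ v (λ u → ∑ m (λ x → χ x u * χ x v)))         ∎)
... | v , v<n , h₁ with pigeonhole-< v 1 _ (≤-<-trans (≤-reflexive (*-identityʳ v)) (<-trans v<n h₁))
...   | u , u<v , h₂ with far-apart-hits m 1 _ (λ x → product≤1 (χ≤1 x u) (χ≤1 x v)) ≤-refl h₂
...     | x , x′ , hx , hx′ , x+1≤x′ , x′<m with product≥1 {χ x u} hx | product≥1 {χ x′ u} hx′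
...       | xu , xv | xu′ , xv′ =
  x , x′ , u , v , ≤-trans (≤-reflexive (+-comm 1 x)) x+1≤x′ , x′<m , u<v , v<n , xu , xv , xu′ , xv′

-- Avoiding finitely many indices

avoid : List ℕ → (ℕ → ℕ) → ℕ → ℕ
avoid D χ j with j ∈? D
... | yes _ = 0
... | no  _ = χ j

avoid≤ : ∀ D χ j → avoid D χ j ≤ χ j
avoid≤ D χ j with j ∈? D
... | yes _ = z≤n
... | no  _ = ≤-refl

avoid-hit : ∀ D χ {j} → 1 ≤ avoid D χ j → 1 ≤ χ j × j ∉ D
avoid-hit D χ {j} h with j ∈? D
... | no j∉D = h , j∉D

occurrences : List ℕ → ℕ → ℕ
occurrences []      j = 0
occurrences (x ∷ D) j with x ≟ j
... | yes _ = suc (occurrences D j)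
... | no  _ = occurrences D j

∈⇒occurs : ∀ {D j} → j ∈ D → 1 ≤ occurrences D j
∈⇒occurs {x ∷ D} {j} (here refl) with j ≟ j
... | yes _  = s≤s z≤n
... | no j≢j = contradiction refl j≢j
∈⇒occurs {x ∷ D} {j} (there p) with x ≟ j
... | yes _ = s≤s z≤n
... | no  _ = ∈⇒occurs p

-- Weighted by b, so that it serves both for cardinalities and for sums of terms.
∑-occurrences : ∀ D (b : ℕ → ℕ) o n → ∑ n (λ t → occurrences D (o + t) * b (o + t)) ≤ sum (map b D)
∑-occurrences []      b o n = ≤-reflexive (trans (∑-const n 0) (*-zeroʳ n))
∑-occurrences (x ∷ D) b o n = ≤-trans (∑-mono n pointwise)
  (≤-trans (≤-reflexive (∑-+ n single _)) (+-mono-≤ (single-≤ n) (∑-occurrences D b o n)))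
  where
  single : ℕ → ℕ
  single t with x ≟ o + t
  ... | yes _ = b x
  ... | no  _ = 0
  pointwise : ∀ t → t < n → occurrences (x ∷ D) (o + t) * b (o + t) ≤ single t + occurrences D (o + t) * b (o + t)
  pointwise t _ with x ≟ o + t
  ... | yes refl = ≤-refl
  ... | no  _    = ≤-refl
  zeros : ∀ n → o + n ≤ x → ∑ n single ≡ 0
  zeros zero    _ = refl
  zeros (suc n) h with x ≟ o + n
  ... | yes refl = contradiction h (<⇒≱ (≤-reflexive (sym (+-suc o n))))
  ... | no  _    = trans (+-identityʳ _) (zeros n (≤-trans (+-monoʳ-≤ o (n≤1+n n)) h))
  single-≤ : ∀ n → ∑ n single ≤ b x
  single-≤ zero    = z≤n
  single-≤ (suc n) with x ≟ o + n
  ... | yes refl = ≤-reflexive (cong (_+ b x) (zeros n ≤-refl))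
  ... | no  _    = ≤-trans (≤-reflexive (+-identityʳ _)) (single-≤ n)

∑-avoid : ∀ D χ (b : ℕ → ℕ) → (∀ j → χ j ≤ 1) → ∀ o n →
  ∑ n (λ t → χ (o + t) * b (o + t)) ≤ ∑ n (λ t → avoid D χ (o + t) * b (o + t)) + sum (map b D)
∑-avoid D χ b χ≤1 o n = ≤-trans (∑-mono n λ t _ → pointwise (o + t))
  (≤-trans (≤-reflexive (∑-+ n _ _)) (+-monoʳ-≤ _ (∑-occurrences D b o n)))
  where
  pointwise : ∀ j → χ j * b j ≤ avoid D χ j * b j + occurrences D j * b j
  pointwise j with j ∈? D
  ... | yes j∈D = *-monoˡ-≤ (b j) (≤-trans (χ≤1 j) (∈⇒occurs j∈D))
  ... | no  _   = m≤m+n _ _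

sum-map-const : ∀ c (D : List ℕ) → sum (map (λ _ → c) D) ≡ length D * c
sum-map-const c []      = refl
sum-map-const c (x ∷ D) = cong (c +_) (sum-map-const c D)

∑-avoid-count : ∀ D χ → (∀ j → χ j ≤ 1) → ∀ o n →
  ∑ n (λ t → χ (o + t)) ≤ ∑ n (λ t → avoid D χ (o + t)) + length D
∑-avoid-count D χ χ≤1 o n = subst₂ _≤_ (∑-cong n λ t _ → *-identityʳ _)
  (cong₂ _+_ (∑-cong n λ t _ → *-identityʳ _) (trans (sum-map-const 1 D) (*-identityʳ _)))
  (∑-avoid D χ (λ _ → 1) χ≤1 o n)

-- Read `Q c D` as: class c still offers something outside D. If every class had a list of length at
-- most β that defeats it, the concatenation of these R lists would defeat all classes at once.
uniform-choice : ExcludedMiddle 0ℓ → ∀ β (Q : ℕ → List ℕ → Set) → (∀ c D E → Q c (D ++ E) → Q c D × Q c E) →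
  ∀ R → (∀ D → length D ≤ R * β → ∃[ c ] (c < R × Q c D)) → ∃[ c ] (c < R × (∀ D → length D ≤ β → Q c D))
uniform-choice em β Q split zero h with h [] z≤n
... | c , () , _
uniform-choice em β Q split (suc R) h with em {∃[ E ] (length E ≤ β × ¬ Q R E)}
... | no ¬E = R , n<1+n R , λ D D≤β → case em {Q R D} of λ
        { (yes q) → q
        ; (no ¬q) → contradiction (D , D≤β , ¬q) ¬E }
... | yes (E , E≤β , ¬q) with uniform-choice em β Q split R smaller
  where
  smaller : ∀ D → length D ≤ R * β → ∃[ c ] (c < R × Q c D)
  smaller D D≤ with h (D ++ E) (≤-trans (≤-reflexive (length-++ D)) (≤-trans (+-mono-≤ D≤ E≤β) (≤-reflexive (+-comm (R * β) β))))
  ... | c , c<1+R , q with m≤n⇒m<n∨m≡n (s≤s⁻¹ c<1+R)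
  ...   | inj₁ c<R  = c , c<R , proj₁ (split c D E q)
  ...   | inj₂ refl = contradiction (proj₂ (split c D E q)) ¬q
...   | c , c<R , q = c , m<n⇒m<1+n c<R , q

-- Subset sums of an index set

module SubsetSums (a : ℕ → ℕ) where

  weight : List ℕ → ℕ
  weight xs = sum (map a xs)

  weight-++ : ∀ xs ys → weight (xs ++ ys) ≡ weight xs + weight ys
  weight-++ []       ys = refl
  weight-++ (x ∷ xs) ys = trans (cong (a x +_) (weight-++ xs ys)) (sym (+-assoc (a x) _ _))

  Rep : List ℕ → ℕ → Set
  Rep D m = ∃[ xs ] (Unique xs × All (_∈ D) xs × m ≡ weight xs)

  Cover : List ℕ → ℕ → ℕ → Set
  Cover D x I = ∀ t → t < I → Rep D (x + t)

  record Fresh (Ok : ℕ → Set) (D P : List ℕ) : Set where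
    constructor fresh
    field
      unique   : Unique P
      admitted : All Ok P
      avoids   : All (_∉ D) P

  -- P and N must avoid D but not each other, since a representation uses only one of them. A box
  -- has four corners, whence the bound 4.
  record Swap (Ok : ℕ → Set) (D : List ℕ) (d : ℕ) : Set where
    constructor swap
    field
      P N     : List ℕ
      P-fresh : Fresh Ok D P
      N-fresh : Fresh Ok D N
      size    : length (P ++ N) ≤ 4
      gap     : weight P ≡ weight N + d

  Rep-++ : ∀ {Ok D P E m} → Fresh Ok D P → (∀ {j} → j ∈ D → j ∈ E) → (∀ {j} → j ∈ P → j ∈ E) →
    Rep D m → Rep E (m + weight P)
  Rep-++ {P = P} F D⊆ P⊆ (xs , u , xs⊆D , refl) = xs ++ P ,
    UniqueP.++⁺ u (Fresh.unique F) (λ (p , q) → All.lookup (Fresh.avoids F) q (All.lookup xs⊆D p)) ,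
    AllP.++⁺ (All.map D⊆ xs⊆D) (All.tabulate P⊆) , sym (weight-++ xs P)

  -- Adjoining N translates the covered interval, adjoining P translates it by d more; for d ≤ I the
  -- two translates leave no gap.
  extend : ∀ {Ok D x I d} → Cover D x I → (s : Swap Ok D d) → d ≤ I →
    Cover ((Swap.P s ++ Swap.N s) ++ D) (x + weight (Swap.N s)) (I + d)
  extend {D = D} {x} {I} {d} cover (swap P N FP FN _ gap) d≤I t t< with t <? I
  ... | yes t<I = subst (Rep _) (shuffle x t (weight N))
          (Rep-++ FN (∈-++⁺ʳ (P ++ N)) (λ p → ∈-++⁺ˡ (∈-++⁺ʳ P p)) (cover t t<I))
    where
    shuffle : ∀ x t w → x + t + w ≡ x + w + t
    shuffle = solve-∀
  ... | no  t≮I = subst (Rep _) (trans (cong (x + (t ∸ d) +_) gap) (trans (shuffle x (t ∸ d) (weight N) d) (cong (x + weight N +_) (m∸n+n≡m d≤t))))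
          (Rep-++ FP (∈-++⁺ʳ (P ++ N)) (λ p → ∈-++⁺ˡ (∈-++⁺ˡ p)) (cover (t ∸ d) (+-cancelʳ-< d _ _ (subst (_< I + d) (sym (m∸n+n≡m d≤t)) t<))))
    where
    d≤t = ≤-trans d≤I (≮⇒≥ t≮I)
    shuffle : ∀ x t w d → x + t + (w + d) ≡ x + w + (t + d)
    shuffle = solve-∀

  Cover-resp : ∀ {D D′ x I I′} → (∀ {j} → j ∈ D → j ∈ D′) → I′ ≤ I → Cover D x I → Cover D′ x I′
  Cover-resp D⊆ I′≤I cover t t< with cover t (≤-trans t< I′≤I)
  ... | xs , u , sub , eq = xs , u , All.map D⊆ sub , eq

  ∈-swap : ∀ {Ok D d j} (s : Swap Ok D d) → j ∈ (Swap.P s ++ Swap.N s) ++ D → j ∈ D ⊎ Ok j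
  ∈-swap {D = D} s j∈ with ∈-++⁻ (Swap.P s ++ Swap.N s) j∈
  ... | inj₂ q = inj₁ q
  ... | inj₁ q with ∈-++⁻ (Swap.P s) q
  ...   | inj₁ r = inj₂ (All.lookup (Fresh.admitted (Swap.P-fresh s)) r)
  ...   | inj₂ r = inj₂ (All.lookup (Fresh.admitted (Swap.N-fresh s)) r)

  length-swap : ∀ {Ok D d} (s : Swap Ok D d) → length ((Swap.P s ++ Swap.N s) ++ D) ≤ 4 + length D
  length-swap {D = D} s = ≤-trans (≤-reflexive (length-++ (Swap.P s ++ Swap.N s))) (+-monoˡ-≤ (length D) (Swap.size s))

  record Grown (Ok : ℕ → Set) (D : List ℕ) (n : ℕ) (Target : ℕ → Set) : Set where
    constructor grown
    field
      D′     : List ℕ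
      x′ I′  : ℕ
      cover  : Cover D′ x′ I′
      small  : length D′ ≤ length D + n
      origin : ∀ {j} → j ∈ D′ → j ∈ D ⊎ Ok j
      target : Target I′

  module Engine (Ok : ℕ → Set) (ρ X β I₀ : ℕ)
    (supply : ∀ D I → length D ≤ β → I₀ ≤ I → I < X → ∃[ d ] (d ≤ I × I ≤ ρ * d × Swap Ok D d)) where

    -- Each exchange adds some d ≥ I/ρ, so k of them multiply the length by at least 1 + k/ρ, unless
    -- X is reached before.
    steps : ∀ k {D x I} → I₀ ≤ I → Cover D x I → length D + k * 4 ≤ β →
      Grown Ok D (k * 4) (λ I′ → I ≤ I′ × (X ≤ I′ ⊎ I * (ρ + k) ≤ ρ * I′))
    steps zero {D} {x} {I} I₀≤I cover D≤ = grown D x I cover (m≤m+n _ _) inj₁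
      (≤-refl , inj₂ (≤-reflexive (trans (cong (I *_) (+-identityʳ ρ)) (*-comm I ρ))))
    steps (suc k) {D} {x} {I} I₀≤I cover D≤ with steps k I₀≤I cover (≤-trans (+-monoʳ-≤ (length D) (m≤n+m (k * 4) 4)) D≤)
    ... | grown D′ x′ I′ cover′ small origin (I≤I′ , inj₁ X≤I′) =
            grown D′ x′ I′ cover′ (≤-trans small (+-monoʳ-≤ (length D) (m≤n+m (k * 4) 4))) origin (I≤I′ , inj₁ X≤I′)
    ... | grown D′ x′ I′ cover′ small origin (I≤I′ , inj₂ h) with X ≤? I′
    ...   | yes X≤I′ = grown D′ x′ I′ cover′ (≤-trans small (+-monoʳ-≤ (length D) (m≤n+m (k * 4) 4))) origin (I≤I′ , inj₁ X≤I′)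
    ...   | no  X≰I′ with supply D′ I′ (≤-trans small (≤-trans (+-monoʳ-≤ (length D) (m≤n+m (k * 4) 4)) D≤)) (≤-trans I₀≤I I≤I′) (≰⇒> X≰I′)
    ...     | d , d≤I′ , I′≤ρd , s = grown _ _ _ (extend cover′ s d≤I′)
              (≤-trans (length-swap s) (≤-trans (+-monoʳ-≤ 4 small) (≤-reflexive (shuffle (length D) (k * 4)))))
              (λ j∈ → [ origin , inj₂ ]′ (∈-swap s j∈))
              (≤-trans I≤I′ (m≤m+n I′ d) , inj₂ (by-cert 0 (+-mono-≤ h (+-mono-≤ I≤I′ I′≤ρd)) (identity I I′ ρ k d)))
      where
      shuffle : ∀ l m → 4 + (l + m) ≡ l + (4 + m)
      shuffle = solve-∀
      identity : ∀ I I′ ρ k d → I * (ρ + suc k) + (ρ * I′ + (I′ + ρ * d)) + 0 ≡ ρ * (I′ + d) + (I * (ρ + k) + (I + I′))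
      identity = solve-∀

    -- Every ρ exchanges double the length, at the price of at most 4ρ indices.
    reach : .{{_ : NonZero ρ}} → ∀ L {D x I} → I₀ ≤ I → Cover D x I → length D + L * (ρ * 4) ≤ β → X ≤ 2 ^ L * I →
      Grown Ok D (L * (ρ * 4)) (X ≤_)
    reach zero    {D} {x} {I} I₀≤I cover D≤ X≤ = grown D x I cover (m≤m+n _ _) inj₁ (≤-trans X≤ (≤-reflexive (+-identityʳ I)))
    reach (suc L) {D} {x} {I} I₀≤I cover D≤ X≤ with steps ρ I₀≤I cover (≤-trans (+-monoʳ-≤ (length D) (m≤m+n _ _)) D≤)
    ... | grown D′ x′ I′ cover′ small origin (I≤I′ , inj₁ X≤I′) =
            grown D′ x′ I′ cover′ (≤-trans small (+-monoʳ-≤ (length D) (m≤m+n _ _))) origin X≤I′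
    ... | grown D′ x′ I′ cover′ small origin (I≤I′ , inj₂ h)
      with reach L (≤-trans I₀≤I I≤I′) cover′ (≤-trans (+-monoˡ-≤ _ small) (≤-trans (≤-reflexive (+-assoc (length D) _ _)) D≤))
             (≤-trans X≤ (≤-trans (≤-reflexive (shuffle (2 ^ L) I)) (*-monoʳ-≤ (2 ^ L) doubled)))
      where
      doubled : I * 2 ≤ I′
      doubled = *-cancelˡ-≤ ρ (≤-trans (≤-reflexive (identity ρ I)) h)
        where
        identity : ∀ ρ I → ρ * (I * 2) ≡ I * (ρ + ρ)
        identity = solve-∀
      shuffle : ∀ t I → 2 * t * I ≡ t * (I * 2)
      shuffle = solve-∀
    ...   | grown D″ x″ I″ cover″ small′ origin′ X≤ =
            grown D″ x″ I″ cover″ (≤-trans small′ (≤-trans (+-monoˡ-≤ _ small) (≤-reflexive (+-assoc (length D) _ _))))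
              (λ j∈ → [ origin , inj₂ ]′ (origin′ j∈)) X≤

  -- Adding the remaining members of χ one at a time: each is at most the length reached so far.
  module Finish (χ : ℕ → ℕ) (D : List ℕ) (D⊆ : ∀ {j} → j ∈ D → 1 ≤ χ j) (x L : ℕ) (start : Cover D x L)
    (grows : ∀ J → 1 ≤ χ J → J ∉ D → a J ≤ L + ∑ J (λ j → avoid D χ j * a j)) (χ≤1 : ∀ j → χ j ≤ 1) where

    reached : ℕ → ℕ
    reached J = L + ∑ J (λ j → avoid D χ j * a j)

    record Reach (J : ℕ) : Set where
      field
        used   : List ℕ
        bound  : ∀ {j} → j ∈ used → j ∈ D ⊎ j < J
        member : ∀ {j} → j ∈ used → 1 ≤ χ j
        cover  : Cover used x (reached J)

    level : ∀ J → Reach J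
    level zero    = record { used = D ; bound = inj₁ ; member = D⊆ ; cover = Cover-resp id (≤-reflexive (+-identityʳ L)) start }
    level (suc J) with avoid D χ J in eq
    ... | zero = record
            { used = used ; member = member
            ; bound = λ j∈ → case bound j∈ of λ { (inj₁ q) → inj₁ q ; (inj₂ q) → inj₂ (m<n⇒m<1+n q) }
            ; cover = Cover-resp id (≤-reflexive (trans (cong (λ m → L + (∑ J (λ j → avoid D χ j * a j) + m * a J)) eq) (cong (L +_) (+-identityʳ _)))) cover }
      where open Reach (level J)
    ... | suc m with avoid-hit D χ {J} (≤-trans (s≤s (z≤n {m})) (≤-reflexive (sym eq)))
    ...   | 1≤χ , J∉D = record
            { used = J ∷ used
            ; bound = λ { (here refl) → inj₂ ≤-refl ; (there j∈) → case bound j∈ of λ { (inj₁ q) → inj₁ q ; (inj₂ q) → inj₂ (m<n⇒m<1+n q) } }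
            ; member = λ { (here refl) → 1≤χ ; (there j∈) → member j∈ }
            ; cover = λ t t< → subst (λ x → Rep (J ∷ used) (x + t)) (+-identityʳ x)
                (Cover-resp id length≡ (extend {Ok = λ _ → 1 ≤ 1} cover single (grows J 1≤χ J∉D)) t t<) }
      where
      open Reach (level J)
      J∉ : J ∉ used
      J∉ J∈ with bound J∈
      ... | inj₁ q = J∉D q
      ... | inj₂ q = <-irrefl refl q
      single : Swap (λ _ → 1 ≤ 1) used (a J)
      single = swap (J ∷ []) [] (fresh ([] ∷ []) (≤-refl ∷ []) (J∉ ∷ [])) (fresh [] [] []) (s≤s z≤n) (+-identityʳ (a J))
      m≡0 : suc m ≡ 1
      m≡0 = ≤-antisym (≤-trans (≤-reflexive (sym eq)) (≤-trans (avoid≤ D χ J) (χ≤1 J))) (s≤s z≤n)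
      length≡ : reached (suc J) ≤ reached J + a J
      length≡ = ≤-reflexive (trans (cong (λ m → L + (∑ J (λ j → avoid D χ j * a j) + m * a J)) (trans eq m≡0))
        (trans (cong (λ m → L + (∑ J (λ j → avoid D χ j * a j) + m)) (+-identityʳ (a J))) (sym (+-assoc L _ _))))

    represents : ∀ t J → t < reached J → ∃[ xs ] (Unique xs × All (λ j → 1 ≤ χ j) xs × x + t ≡ weight xs)
    represents t J t< with Reach.cover (level J) t t<
    ... | xs , u , xs⊆ , eq = xs , u , All.map (Reach.member (level J)) xs⊆ , eq

-- Course-of-values recursion, stages and the layout of a term

module CourseOfValues (body : (ℕ → ℕ) → ℕ → ℕ)
  (local : ∀ u v j → (∀ i → i < j → u i ≡ v i) → body u j ≡ body v j) where

  private
    -- The first argument is fuel: `iterate n` is final at all arguments below n.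
    iterate : ℕ → ℕ → ℕ
    iterate zero    j = 0
    iterate (suc n) j = body (iterate n) j

    stable : ∀ m n {j} → j < m → j < n → iterate m j ≡ iterate n j
    stable (suc m) (suc n) {j} (s≤s j≤m) (s≤s j≤n) =
      local (iterate m) (iterate n) j λ i i<j → stable m n (≤-trans i<j j≤m) (≤-trans i<j j≤n)

  fix : ℕ → ℕ
  fix j = iterate (suc j) j

  fix-unfold : ∀ j → fix j ≡ body fix j
  fix-unfold j = local (iterate j) fix j λ i i<j → stable j (suc i) i<j ≤-refl

2^-cancel-< : ∀ {m n} → 2 ^ m < 2 ^ n → m < n
2^-cancel-< {m} {n} h = ≰⇒> λ n≤m → <⇒≱ h (2^-mono n≤m)

2^-cancel-≤ : ∀ {m n} → 2 ^ m ≤ 2 ^ n → m ≤ n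
2^-cancel-≤ {m} {n} h = ≮⇒≥ λ n<m → <⇒≱ (^-monoʳ-< 2 (s≤s (s≤s z≤n)) n<m) h

module Stages (A : ℕ) (1≤A : 1 ≤ A) where

  private
    -- `suc (pred j)` is the maximum of j and 1, so that r = 0 is admissible even for j = 0.
    search : ∀ j → ∃[ r ] (r ≤ j × 2 ^ (A * r) ≤ suc (pred j) × (r ≡ j ⊎ ¬ (2 ^ (A * suc r) ≤ suc (pred j))))
    search j = maximal (λ r → 2 ^ (A * r) ≤ suc (pred j)) (λ r → 2 ^ (A * r) ≤? suc (pred j))
      (subst (λ k → 2 ^ k ≤ suc (pred j)) (sym (*-zeroʳ A)) (s≤s z≤n)) j

  abstract
    stage : ℕ → ℕ
    stage j = proj₁ (search j)

    stage-lower : ∀ j → 1 ≤ j → 2 ^ (A * stage j) ≤ j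
    stage-lower (suc j) _ = proj₁ (proj₂ (proj₂ (search (suc j))))

    stage-upper : ∀ j → j < 2 ^ (A * suc (stage j))
    stage-upper zero    = 1≤2^ (A * suc (stage 0))
    stage-upper (suc j) with search (suc j)
    ... | r , _ , _ , inj₂ ¬h   = ≰⇒> ¬h
    ... | r , _ , _ , inj₁ refl = <-trans (n<1+n _) (<-≤-trans (n<2^n _) (2^-mono (m≤n*m (suc (suc j)) A {{>-nonZero 1≤A}})))

    stage-zero : stage 0 ≤ 0
    stage-zero = proj₁ (proj₂ (search 0))

  stage-≤ : ∀ {r j} → j < 2 ^ (A * suc r) → 1 ≤ j → stage j ≤ r
  stage-≤ {r} {j} j< 1≤j = s≤s⁻¹ (*-cancelˡ-< A _ _ (2^-cancel-< (≤-<-trans (stage-lower j 1≤j) j<)))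

  ≤-stage : ∀ {r j} → 2 ^ (A * r) ≤ j → r ≤ stage j
  ≤-stage {r} {j} h = s≤s⁻¹ (*-cancelˡ-< A _ _ (2^-cancel-< (≤-<-trans h (stage-upper j))))

  stage-mono : ∀ {i j} → 1 ≤ i → i ≤ j → stage i ≤ stage j
  stage-mono {i} {j} 1≤i i≤j = ≤-stage (≤-trans (stage-lower i 1≤i) i≤j)

-- In stage r a term is 1 + Uα, where α stays just below the target σ ≈ s/U.  The target is rounded
-- to m·2^e with m of 2r+1 bits; the remaining 2^e is filled by j·2^w, which makes α increasing in j,
-- and by a pattern below 2^w whose second differences have all sizes.

module Layout (A U ω y y′ : ℕ) .{{_ : NonZero U}} where

  Y₁ Y₂ : ℕ
  Y₁ = 2 ^ y′
  Y₂ = 2 ^ y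

  2^≢0 : ∀ n → NonZero (2 ^ n)
  2^≢0 n = m^n≢0 2 n

  instance
    Y₁≢0 : NonZero Y₁
    Y₁≢0 = 2^≢0 y′
    Y₂≢0 : NonZero Y₂
    Y₂≢0 = 2^≢0 y

  low : ℕ
  low = Y₂ ^ suc ω

  instance
    low≢0 : NonZero low
    low≢0 = m^n≢0 Y₂ (suc ω)

  high : ℕ → ℕ
  high r = Y₁ ^ suc (suc r)

  T : ℕ → ℕ
  T r = high r * low

  T≢0 : ∀ r → NonZero (T r)
  T≢0 r = m*n≢0 (high r) low {{m^n≢0 Y₁ (suc (suc r))}}

  offset : ℕ → ℕ → ℕ
  offset r j = (j % T r) {{T≢0 r}}

  θU≢0 : ∀ r → NonZero (2 ^ r * U)
  θU≢0 r = m*n≢0 (2 ^ r) U {{2^≢0 r}}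

  -- The bits of the pattern beside those of G^(r+1): y′ and r + 2 for the factor Y₁·(r + 2), y and
  -- ω + 1 for Y₂·(ω + 1), and rω for (2^r)^ω.
  overhead : ℕ → ℕ
  overhead r = y′ + suc (suc r) + (y + suc ω) + r * ω

  -- A loss of 3/θ, θ = 2^r, leaves a margin of 1/θ for rounding on either side of the losses 2/θ
  -- and 4/θ.
  σ : ℕ → ℕ → ℕ
  σ r s = (((2 ^ r ∸ 3) * s) / (2 ^ r * U)) {{θU≢0 r}}

  private
    -- The maximum with 2^(2r) makes e = 0 admissible for every z.
    search : ∀ r z → ∃[ e ] (e ≤ z × 2 ^ (e + 2 * r) ≤ z ⊔ 2 ^ (2 * r) × (e ≡ z ⊎ ¬ (2 ^ (suc e + 2 * r) ≤ z ⊔ 2 ^ (2 * r))))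
    search r z = maximal (λ e → 2 ^ (e + 2 * r) ≤ z ⊔ 2 ^ (2 * r)) (λ e → 2 ^ (e + 2 * r) ≤? z ⊔ 2 ^ (2 * r)) (m≤n⊔m z (2 ^ (2 * r))) z

  abstract
    expo : ℕ → ℕ → ℕ
    expo r z = proj₁ (search r z)

    expo-lower : ∀ r z → 2 ^ (2 * r) ≤ z → 2 ^ (expo r z + 2 * r) ≤ z
    expo-lower r z h = subst (2 ^ (expo r z + 2 * r) ≤_) (m≥n⇒m⊔n≡m h) (proj₁ (proj₂ (proj₂ (search r z))))

    expo-upper : ∀ r z → z < 2 ^ (suc (expo r z) + 2 * r)
    expo-upper r z with search r z
    ... | e , _ , _ , inj₁ refl = <-≤-trans (n<2^n e) (2^-mono (≤-trans (n≤1+n e) (m≤m+n (suc e) (2 * r))))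
    ... | e , _ , _ , inj₂ ¬h   = ≤-<-trans (m≤m⊔n z (2 ^ (2 * r))) (≰⇒> ¬h)

  expo-mono : ∀ r {z z′} → 2 ^ (2 * r) ≤ z → z ≤ z′ → expo r z ≤ expo r z′
  expo-mono r {z} {z′} h z≤z′ = s≤s⁻¹ (+-cancelʳ-< (2 * r) _ _ (2^-cancel-< (≤-<-trans (≤-trans (expo-lower r z h) z≤z′) (expo-upper r z′))))

  mant : ℕ → ℕ → ℕ
  mant r z = (z / 2 ^ expo r z) {{2^≢0 (expo r z)}}

  -- Indices of stage r are below 2^(A(r+1)), so with this w the multiples j·2^w stay below 2^e.
  unit : ℕ → ℕ → ℕ
  unit r e = e ∸ A * suc r

  -- With G = 2^q the power G^(r+1) fills w up to the overhead and a remainder of at most r bits.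
  base : ℕ → ℕ → ℕ
  base r w = (w ∸ overhead r) / suc r

  pattern-at : ℕ → ℕ → ℕ → ℕ
  pattern-at r q t = spread Y₁ (2 ^ q) (suc (suc r)) (t / low) * spread Y₂ (2 ^ r) (suc ω) (t % low)

  value : ℕ → ℕ → ℕ → ℕ → ℕ
  value r j e m = m * 2 ^ e + j * 2 ^ unit r e + pattern-at r (base r (unit r e)) (offset r j)

  α : ℕ → ℕ → ℕ → ℕ
  α r j s = value r j (expo r (σ r s)) (mant r (σ r s))

  σ-mono : ∀ r {s s′} → s ≤ s′ → σ r s ≤ σ r s′
  σ-mono r s≤s′ = /-monoˡ-≤ (2 ^ r * U) {{θU≢0 r}} (*-monoʳ-≤ (2 ^ r ∸ 3) s≤s′)

  σ-upper : ∀ r s → 2 ^ r * U * σ r s ≤ (2 ^ r ∸ 3) * s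
  σ-upper r s = ≤-trans (≤-reflexive (*-comm (2 ^ r * U) _)) (m/n*n≤m _ (2 ^ r * U) {{θU≢0 r}})

  Uσ≤ : ∀ r s → U * σ r s ≤ s
  Uσ≤ r s = *-cancelˡ-≤ (2 ^ r) {{2^≢0 r}} (≤-trans (≤-reflexive (sym (*-assoc (2 ^ r) U _))) (≤-trans (σ-upper r s) (*-monoˡ-≤ s (m∸n≤m (2 ^ r) 3))))

  σ-lower : ∀ r s → (2 ^ r ∸ 3) * s < 2 ^ r * U * suc (σ r s)
  σ-lower r s = subst₂ _<_ (sym (m≡m%n+[m/n]*n ((2 ^ r ∸ 3) * s) n {{n≢0}})) (*-comm (suc (σ r s)) n)
    (+-monoˡ-< (σ r s * n) (m%n<n ((2 ^ r ∸ 3) * s) n {{n≢0}}))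
    where
    n = 2 ^ r * U
    n≢0 = θU≢0 r

  8≤2^ : ∀ {r} → 3 ≤ r → 8 ≤ 2 ^ r
  8≤2^ = 2^-mono {3}

  2^∸3 : ∀ {r} → 3 ≤ r → 2 ^ r ∸ 3 + 3 ≡ 2 ^ r
  2^∸3 3≤r = m∸n+n≡m (≤-trans (s≤s (s≤s (s≤s (z≤n {5})))) (8≤2^ 3≤r))

  σ-big : ∀ r s J → 3 ≤ r → 2 * (U * J) ≤ s → J ≤ σ r s
  σ-big r s J 3≤r h = s≤s⁻¹ (*-cancelˡ-< (2 * (2 ^ r * U)) J _ (begin-strict
    2 * (2 ^ r * U) * J                ≡⟨ shuffle (2 ^ r) U J ⟩
    2 ^ r * (2 * (U * J))              ≤⟨ *-monoʳ-≤ (2 ^ r) h ⟩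
    2 ^ r * s                          ≤⟨ *-monoˡ-≤ s half ⟩
    2 * (2 ^ r ∸ 3) * s                ≡⟨ *-assoc 2 (2 ^ r ∸ 3) s ⟩
    2 * ((2 ^ r ∸ 3) * s)              <⟨ *-monoʳ-< 2 (σ-lower r s) ⟩
    2 * (2 ^ r * U * suc (σ r s))      ≡⟨ sym (*-assoc 2 (2 ^ r * U) _) ⟩
    2 * (2 ^ r * U) * suc (σ r s)      ∎))
    where
    open ≤-Reasoning
    shuffle : ∀ t U J → 2 * (t * U) * J ≡ t * (2 * (U * J))
    shuffle = solve-∀
    half : 2 ^ r ≤ 2 * (2 ^ r ∸ 3)
    half = by-cert 2 (+-mono-≤ (8≤2^ 3≤r) (≤-reflexive (cong (2 *_) (sym (2^∸3 3≤r))))) (identity (2 ^ r) (2 ^ r ∸ 3))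
      where
      identity : ∀ t u → t + (t + 2 * (u + 3)) + 2 ≡ 2 * u + (8 + 2 * t)
      identity = solve-∀

  pattern-< : ∀ r w t → overhead r ≤ w → pattern-at r (base r w) t < 2 ^ w
  pattern-< r w t h = begin-strict
    spread Y₁ G (suc (suc r)) hi * spread Y₂ (2 ^ r) (suc ω) lo
      ≤⟨ *-mono-≤ (spread-≤ Y₁ G {{2^≢0 q}} (suc r) hi) (spread-≤ Y₂ (2 ^ r) {{2^≢0 r}} ω lo) ⟩
    Y₁ * suc (suc r) * G ^ suc r * (Y₂ * suc ω * (2 ^ r) ^ ω)
      ≡⟨ cong₂ (λ g h → Y₁ * suc (suc r) * g * (Y₂ * suc ω * h)) (^-*-assoc 2 q (suc r)) (^-*-assoc 2 r ω) ⟩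
    Y₁ * suc (suc r) * 2 ^ (q * suc r) * (Y₂ * suc ω * 2 ^ (r * ω))
      ≡⟨ gather Y₁ (suc (suc r)) (2 ^ (q * suc r)) Y₂ (suc ω) (2 ^ (r * ω)) ⟩
    suc (suc r) * (Y₁ * (suc ω * (Y₂ * (2 ^ (r * ω) * 2 ^ (q * suc r)))))
      ≤⟨ *-monoʳ-≤ (suc (suc r)) (*-monoʳ-≤ Y₁ (*-monoˡ-≤ _ (<⇒≤ (n<2^n (suc ω))))) ⟩
    suc (suc r) * X
      <⟨ *-monoˡ-< X (n<2^n (suc (suc r))) ⟩
    2 ^ suc (suc r) * X
      ≡⟨ cong (2 ^ suc (suc r) *_) X≡ ⟩
    2 ^ suc (suc r) * 2 ^ (y′ + (suc ω + (y + (r * ω + q * suc r))))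
      ≡⟨ 2^-+ (suc (suc r)) _ ⟩
    2 ^ (suc (suc r) + (y′ + (suc ω + (y + (r * ω + q * suc r)))))
      ≤⟨ 2^-mono (≤-trans (≤-reflexive (exponents y′ r y ω (q * suc r))) (≤-trans (+-monoʳ-≤ (overhead r) (m/n*n≤m _ (suc r))) (≤-reflexive (m+[n∸m]≡n h)))) ⟩
    2 ^ w ∎
    where
    open ≤-Reasoning
    q = base r w
    G = 2 ^ q
    hi = t / low
    lo = t % low
    X = Y₁ * (2 ^ suc ω * (Y₂ * (2 ^ (r * ω) * 2 ^ (q * suc r))))
    instance
      X≢0 : NonZero X
      X≢0 = m*n≢0 Y₁ _ {{2^≢0 y′}} {{m*n≢0 (2 ^ suc ω) _ {{2^≢0 (suc ω)}} {{m*n≢0 Y₂ _ {{2^≢0 y}} {{m*n≢0 (2 ^ (r * ω)) _ {{2^≢0 (r * ω)}} {{2^≢0 (q * suc r)}}}}}}}}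
    X≡ : X ≡ 2 ^ (y′ + (suc ω + (y + (r * ω + q * suc r))))
    X≡ = trans (cong (λ z → Y₁ * (2 ^ suc ω * (Y₂ * z))) (2^-+ (r * ω) (q * suc r)))
      (trans (cong (λ z → Y₁ * (2 ^ suc ω * z)) (2^-+ y (r * ω + q * suc r)))
      (trans (cong (Y₁ *_) (2^-+ (suc ω) _)) (2^-+ y′ _)))
    gather : ∀ a b c d e f → a * b * c * (d * e * f) ≡ b * (a * (e * (d * (f * c))))
    gather = solve-∀
    exponents : ∀ y′ r y ω x → suc (suc r) + (y′ + (suc ω + (y + (r * ω + x)))) ≡ y′ + suc (suc r) + (y + suc ω) + r * ω + x
    exponents = solve-∀

  overhead≤unit : ∀ r {e} → A * suc r + overhead r ≤ e → overhead r ≤ unit r e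
  overhead≤unit r room = ≤-trans (≤-reflexive (sym (m+n∸m≡n (A * suc r) (overhead r)))) (∸-monoˡ-≤ (A * suc r) room)

  2^-unit : ∀ r {e} → A * suc r + overhead r ≤ e → 2 ^ (A * suc r) * 2 ^ unit r e ≡ 2 ^ e
  2^-unit r {e} room = trans (2^-+ (A * suc r) (unit r e)) (cong (2 ^_) (m+[n∸m]≡n {A * suc r} (≤-trans (m≤m+n (A * suc r) (overhead r)) room)))

  value-< : ∀ r j e m → A * suc r + overhead r ≤ e → value r j e m < m * 2 ^ e + suc j * 2 ^ unit r e
  value-< r j e m room = ≤-trans (+-monoʳ-< (m * 2 ^ e + j * 2 ^ unit r e) (pattern-< r (unit r e) (offset r j) (overhead≤unit r room)))
    (≤-reflexive (shuffle (m * 2 ^ e) j (2 ^ unit r e)))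
    where
    shuffle : ∀ b j w → b + j * w + w ≡ b + suc j * w
    shuffle = solve-∀

  value-<-block : ∀ r j e m → A * suc r + overhead r ≤ e → j < 2 ^ (A * suc r) → value r j e m < m * 2 ^ e + 2 ^ e
  value-<-block r j e m room j< = <-≤-trans (value-< r j e m room)
    (+-monoʳ-≤ (m * 2 ^ e) (≤-trans (*-monoˡ-≤ (2 ^ unit r e) j<) (≤-reflexive (2^-unit r room))))

  module Bounds (r j s : ℕ) (3≤r : 3 ≤ r) (j< : j < 2 ^ (A * suc r))
    (room : A * suc r + overhead r ≤ expo r (σ r s)) (σ-large : 2 ^ (2 * r) ≤ σ r s) where

    private
      e = expo r (σ r s)
      m = mant r (σ r s)
      w = unit r e
      θ = 2 ^ r

    α-next : α r j s < m * 2 ^ e + suc j * 2 ^ w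
    α-next = value-< r j e m room

    α-upper : α r j s < m * 2 ^ e + 2 ^ e
    α-upper = value-<-block r j e m room j<

    α-lower : m * 2 ^ e ≤ α r j s
    α-lower = ≤-trans (m≤m+n _ _) (m≤m+n _ _)

    mant-lower : m * 2 ^ e ≤ σ r s
    mant-lower = m/n*n≤m (σ r s) (2 ^ e) {{2^≢0 e}}

    mant-upper : σ r s < m * 2 ^ e + 2 ^ e
    mant-upper = ≤-trans (≤-reflexive (cong suc (m≡m%n+[m/n]*n (σ r s) (2 ^ e) {{2^≢0 e}}))) (≤-trans (+-monoˡ-≤ (m * 2 ^ e) (m%n<n (σ r s) (2 ^ e) {{2^≢0 e}})) (≤-reflexive (+-comm (2 ^ e) _)))

    -- The mantissa is at least 2^(2r) ≥ 2θ, so a rounding unit is at most 1/2θ of the target.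
    2θU2^e≤s : 2 * θ * U * 2 ^ e ≤ s
    2θU2^e≤s = begin
      2 * θ * U * 2 ^ e      ≡⟨ shuffle θ U (2 ^ e) ⟩
      U * (2 ^ e * (2 * θ))  ≡⟨ cong (U *_) (2^-+ e (suc r)) ⟩
      U * 2 ^ (e + suc r)    ≤⟨ *-monoʳ-≤ U (2^-mono (+-monoʳ-≤ e (≤-trans (+-monoˡ-≤ r (≤-trans (s≤s z≤n) 3≤r)) (≤-reflexive (cong (r +_) (sym (+-identityʳ r))))))) ⟩
      U * 2 ^ (e + 2 * r)    ≤⟨ *-monoʳ-≤ U (expo-lower r (σ r s) σ-large) ⟩
      U * σ r s              ≤⟨ Uσ≤ r s ⟩
      s                      ∎
      where
      open ≤-Reasoning
      shuffle : ∀ θ U t → 2 * θ * U * t ≡ U * (t * (2 * θ))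
      shuffle = solve-∀

    term-upper : 2 * θ * suc (U * α r j s) + 5 * s ≤ 2 * θ * s
    term-upper = begin
      2 * θ * suc (U * α r j s) + 5 * s    ≤⟨ +-monoˡ-≤ (5 * s) (*-monoʳ-≤ (2 * θ) a≤) ⟩
      2 * θ * (U * (σ r s + 2 ^ e)) + 5 * s ≡⟨ expand θ U (σ r s) (2 ^ e) (5 * s) ⟩
      2 * (θ * U * σ r s) + 2 * θ * U * 2 ^ e + 5 * s ≤⟨ +-monoˡ-≤ (5 * s) (+-mono-≤ (*-monoʳ-≤ 2 (σ-upper r s)) 2θU2^e≤s) ⟩
      2 * ((θ ∸ 3) * s) + s + 5 * s        ≡⟨ collect (θ ∸ 3) s ⟩
      2 * (θ ∸ 3 + 3) * s                  ≡⟨ cong (λ t → 2 * t * s) (2^∸3 3≤r) ⟩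
      2 * θ * s                            ∎
      where
      open ≤-Reasoning
      a≤ : suc (U * α r j s) ≤ U * (σ r s + 2 ^ e)
      a≤ = ≤-trans (+-monoˡ-≤ (U * α r j s) (>-nonZero⁻¹ U))
        (≤-trans (≤-reflexive (sym (*-suc U (α r j s)))) (*-monoʳ-≤ U (≤-trans α-upper (+-monoˡ-≤ (2 ^ e) mant-lower))))
      expand : ∀ θ U z t x → 2 * θ * (U * (z + t)) + x ≡ 2 * (θ * U * z) + 2 * θ * U * t + x
      expand = solve-∀
      collect : ∀ u s → 2 * (u * s) + s + 5 * s ≡ 2 * (u + 3) * s
      collect = solve-∀

    term-lower : θ * s ≤ θ * suc (U * α r j s) + 4 * s
    term-lower = begin
      θ * s                                    ≡⟨ cong (_* s) (sym (2^∸3 3≤r)) ⟩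
      (θ ∸ 3 + 3) * s                          ≡⟨ *-distribʳ-+ s (θ ∸ 3) 3 ⟩
      (θ ∸ 3) * s + 3 * s                      ≤⟨ +-monoˡ-≤ (3 * s) (<⇒≤ (σ-lower r s)) ⟩
      θ * U * suc (σ r s) + 3 * s              ≤⟨ +-monoˡ-≤ (3 * s) (*-monoʳ-≤ (θ * U) (≤-trans mant-upper (+-monoˡ-≤ (2 ^ e) α-lower))) ⟩
      θ * U * (α r j s + 2 ^ e) + 3 * s        ≡⟨ expand θ U (α r j s) (2 ^ e) (3 * s) ⟩
      θ * (U * α r j s) + θ * U * 2 ^ e + 3 * s ≤⟨ +-monoˡ-≤ (3 * s) (+-mono-≤ (*-monoʳ-≤ θ (n≤1+n _)) (≤-trans (*-monoˡ-≤ (2 ^ e) (*-monoˡ-≤ U (m≤m+n θ (θ + 0)))) 2θU2^e≤s)) ⟩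
      θ * suc (U * α r j s) + s + 3 * s        ≡⟨ collect (θ * suc (U * α r j s)) s ⟩
      θ * suc (U * α r j s) + 4 * s            ∎
      where
      open ≤-Reasoning
      expand : ∀ θ U a t x → θ * U * (a + t) + x ≡ θ * (U * a) + θ * U * t + x
      expand = solve-∀
      collect : ∀ a s → a + s + 3 * s ≡ a + 4 * s
      collect = solve-∀

  mant-< : ∀ r {z} → mant r z < 2 ^ suc (2 * r)
  mant-< r {z} = m<n*o⇒m/o<n {{2^≢0 (expo r z)}} (<-≤-trans (expo-upper r z) (≤-reflexive (trans (cong (2 ^_) (lemma (expo r z) (2 * r))) (sym (2^-+ (suc (2 * r)) (expo r z))))))
    where
    lemma : ∀ e x → suc e + x ≡ suc x + e
    lemma = solve-∀

  mant-≥ : ∀ r {z} → 2 ^ (2 * r) ≤ z → 2 ^ (2 * r) ≤ mant r z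
  mant-≥ r {z} h = ≤-trans (≤-reflexive (sym (m*n/n≡m (2 ^ (2 * r)) (2 ^ e) {{2^≢0 e}})))
    (/-monoˡ-≤ (2 ^ e) {{2^≢0 e}} (≤-trans (≤-reflexive (trans (2^-+ (2 * r) e) (cong (2 ^_) (+-comm (2 * r) e)))) (expo-lower r z h)))
    where e = expo r z

  -- Mantissas range over [Q, 2Q) with Q = 2^(2r), so this numbers the rounded targets consecutively
  -- in increasing order. Its rise over a stage bounds the number of changes of the high-order part.
  key : ℕ → ℕ → ℕ
  key r z = expo r z * 2 ^ (2 * r) + mant r z

  -- A rounded target that changes at all gains a full unit 2^e, which exceeds all lower-order parts
  -- of a term together.
  float-step : ∀ r {z z′} → 2 ^ (2 * r) ≤ z → z ≤ z′ →
    (expo r z ≡ expo r z′ × mant r z ≡ mant r z′) ⊎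
    (key r z < key r z′ × mant r z * 2 ^ expo r z + 2 ^ expo r z ≤ mant r z′ * 2 ^ expo r z′)
  float-step r {z} {z′} h z≤z′ with m≤n⇒m<n∨m≡n (expo-mono r h z≤z′)
  ... | inj₁ e<e′ = inj₂ (key< , jump)
    where
    open ≤-Reasoning
    e = expo r z
    e′ = expo r z′
    Q = 2 ^ (2 * r)
    key< : key r z < key r z′
    key< = begin-strict
      e * Q + mant r z     <⟨ +-monoʳ-< (e * Q) (mant-< r) ⟩
      e * Q + 2 * Q        ≡⟨ shuffle e Q ⟩
      suc e * Q + Q        ≤⟨ +-mono-≤ (*-monoˡ-≤ Q e<e′) (mant-≥ r (≤-trans h z≤z′)) ⟩
      e′ * Q + mant r z′   ∎
      where
      shuffle : ∀ e Q → e * Q + 2 * Q ≡ suc e * Q + Q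
      shuffle = solve-∀
    jump : mant r z * 2 ^ e + 2 ^ e ≤ mant r z′ * 2 ^ e′
    jump = begin
      mant r z * 2 ^ e + 2 ^ e   ≡⟨ +-comm _ (2 ^ e) ⟩
      suc (mant r z) * 2 ^ e     ≤⟨ *-monoˡ-≤ (2 ^ e) (mant-< r) ⟩
      2 * Q * 2 ^ e              ≡⟨ shuffle Q (2 ^ e) ⟩
      Q * 2 ^ suc e              ≤⟨ *-mono-≤ (mant-≥ r (≤-trans h z≤z′)) (2^-mono e<e′) ⟩
      mant r z′ * 2 ^ e′         ∎
      where
      shuffle : ∀ Q t → 2 * Q * t ≡ Q * (2 * t)
      shuffle = solve-∀
  ... | inj₂ e≡e′ with m≤n⇒m<n∨m≡n mant≤
    where
    mant≤ : mant r z ≤ mant r z′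
    mant≤ = subst (λ e → mant r z ≤ (z′ / 2 ^ e) {{2^≢0 e}}) e≡e′ (/-monoˡ-≤ (2 ^ expo r z) {{2^≢0 (expo r z)}} z≤z′)
  ...   | inj₂ m≡m′ = inj₁ (e≡e′ , m≡m′)
  ...   | inj₁ m<m′ = inj₂ (subst (λ e → key r z < e * 2 ^ (2 * r) + mant r z′) e≡e′ (+-monoʳ-< (expo r z * 2 ^ (2 * r)) m<m′) ,
            subst (λ e → mant r z * 2 ^ expo r z + 2 ^ expo r z ≤ mant r z′ * 2 ^ e) e≡e′
              (≤-trans (≤-reflexive (+-comm _ (2 ^ expo r z))) (*-monoˡ-≤ (2 ^ expo r z) m<m′)))

  key-≤ : ∀ r z → key r z ≤ (expo r z + 2) * 2 ^ (2 * r)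
  key-≤ r z = ≤-trans (+-monoʳ-≤ (expo r z * 2 ^ (2 * r)) (<⇒≤ (mant-< r))) (≤-reflexive (sym (*-distribʳ-+ (2 ^ (2 * r)) (expo r z) 2)))

-- The relative loss of a is at least 5/2θ, that of a′ at most 4/θ′ ≤ 2/θ.
cross-stage-< : ∀ {θ θ′ a a′ s s′} → 2 ≤ θ → 2 * θ ≤ θ′ → 1 ≤ s → s ≤ s′ → a′ ≤ s′ →
  2 * θ * a + 5 * s ≤ 2 * θ * s → θ′ * s′ ≤ θ′ * a′ + 4 * s′ → a < a′
cross-stage-< {θ} {θ′} {a} {a′} {s} {s′} 2≤θ θ≤ 1≤s s≤s′ a′≤s′ up lo
  with m≤n⇒∃[o]m+o≡n a′≤s′ | m≤n⇒∃[o]m+o≡n s≤s′ | m≤n⇒∃[o]m+o≡n 2≤θ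
... | d , refl | x , eq | y , refl = *-cancelˡ-< (2 * (2 + y)) a a′ (by-cert 0
        (+-mono-≤ up (+-mono-≤ (≤-trans (*-monoˡ-≤ d θ≤) 4d) (+-mono-≤ 1≤s (+-mono-≤ (z≤n {2 * y * x})
          (≤-reflexive (cong (2 * (2 + y) *_) eq)))))) identity)
  where
  4d : θ′ * d ≤ 4 * (a′ + d)
  4d = +-cancelˡ-≤ (θ′ * a′) _ _ (≤-trans (≤-reflexive (sym (*-distribˡ-+ θ′ a′ d))) lo)
  identity : suc (2 * (2 + y) * a) + (2 * (2 + y) * s + (4 * (a′ + d) + (s + (2 * y * x + 2 * (2 + y) * (a′ + d))))) + 0
    ≡ 2 * (2 + y) * a′ + (2 * (2 + y) * a + 5 * s + (2 * (2 + y) * d + (1 + (0 + 2 * (2 + y) * (s + x)))))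
  identity = trans (cong (λ z → suc (2 * (2 + y) * a) + (2 * (2 + y) * s + (4 * z + (s + (2 * y * x + 2 * (2 + y) * (a′ + d))))) + 0) (sym eq))
    (ring y a s a′ d x)
    where
    ring : ∀ y a s a′ d x → suc (2 * (2 + y) * a) + (2 * (2 + y) * s + (4 * (s + x) + (s + (2 * y * x + 2 * (2 + y) * (a′ + d))))) + 0
      ≡ 2 * (2 + y) * a′ + (2 * (2 + y) * a + 5 * s + (2 * (2 + y) * d + (1 + (0 + 2 * (2 + y) * (s + x)))))
    ring = solve-∀

-- The index map j ↦ κ (j - 1) and the definition of the sequence

module FloorFacts {ε : ℝ} (fl : Floor ε) where
  open Floor fl

  1≤p : 1 ≤ p
  1≤p = n≢0⇒n>0 λ p≡0 → contradiction (subst (λ p → 0 < p * suc (κ 0)) p≡0 (κ-lower 0)) λ ()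

  κ≤ : ∀ n → κ n ≤ n
  κ≤ n = *-cancelˡ-≤ p {{>-nonZero 1≤p}} (≤-trans (m≤m+n _ n) (κ-upper n))

  κpred< : ∀ {j} → 1 ≤ j → κ (pred j) < j
  κpred< {suc j} _ = s≤s (κ≤ j)

  ≤pκpred : ∀ j → j ≤ p * suc (κ (pred j))
  ≤pκpred zero    = z≤n
  ≤pκpred (suc j) = κ-lower j

  κ-exceeds : ∀ {c n} → p * suc c ≤ n → c < κ n
  κ-exceeds {c} {n} h = s≤s⁻¹ (*-cancelˡ-< p (suc c) (suc (κ n)) (≤-<-trans h (κ-lower n)))

  κpred-contracts : ∀ j → suc p * κ (pred j) ≤ p * j
  κpred-contracts j = by-cert 0 (+-mono-≤ (κ-upper (pred j)) (+-mono-≤ (κ≤ (pred j)) (*-monoʳ-≤ p (pred[n]≤n {j})))) (lemma p (κ (pred j)) (pred j) j)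
    where
    lemma : ∀ p k n j → suc p * k + (p * n + (n + p * j)) + 0 ≡ p * j + (p * k + n + (k + p * n))
    lemma = solve-∀

  -- `j * p ^ m ≤ suc p ^ m * c` bounds the depth of j: by the contraction, m applications of j ↦ κ
  -- (j - 1) lead down to at most c. One application uses up one unit of depth.
  κpred-power : ∀ j m {c} → j * p ^ suc m ≤ suc p ^ suc m * c → κ (pred j) * p ^ m ≤ suc p ^ m * c
  κpred-power j m {c} h = *-cancelˡ-≤ (suc p) (begin
    suc p * (k * p ^ m)      ≡⟨ sym (*-assoc (suc p) k (p ^ m)) ⟩
    suc p * k * p ^ m        ≤⟨ *-monoˡ-≤ (p ^ m) (κpred-contracts j) ⟩
    p * j * p ^ m            ≡⟨ shuffle p j (p ^ m) ⟩
    j * (p * p ^ m)          ≤⟨ h ⟩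
    suc p * suc p ^ m * c    ≡⟨ *-assoc (suc p) (suc p ^ m) c ⟩
    suc p * (suc p ^ m * c)  ∎)
    where
    open ≤-Reasoning
    k = κ (pred j)
    shuffle : ∀ p j x → p * j * x ≡ j * (p * x)
    shuffle = solve-∀

  -- Half of the k = κ (j-1) terms have index at least k/2, and j ≤ 4p(k/2).
  power-sum-lower : ∀ (u : ℕ → ℕ) c ν j → 2 * (4 * p) ^ suc ν ≤ j → (∀ i → i < j → c * i ^ ν ≤ u i) →
    2 * (c * j ^ ν) ≤ S u (κ (pred j))
  power-sum-lower u c ν j big h = begin
    2 * (c * j ^ ν)         ≡⟨ swap-2 c (j ^ ν) ⟩
    c * (2 * j ^ ν)         ≤⟨ *-monoʳ-≤ c 2j^ν≤ ⟩
    c * (k′ * k′ ^ ν)       ≡⟨ swap-c c k′ (k′ ^ ν) ⟩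
    k′ * (c * k′ ^ ν)       ≡⟨ sym (∑-const k′ _) ⟩
    ∑ k′ (λ _ → c * k′ ^ ν) ≤⟨ ∑-mono k′ (λ i i<k′ → ≤-trans (*-monoʳ-≤ c (^-monoˡ-≤ ν (≤-trans (m≤m+n k′ i) (n≤1+n _)))) (h _ (in-range i i<k′))) ⟩
    ∑ k′ (λ i → u (suc (k′ + i))) ≤⟨ m≤n+m _ (∑ k′ (u ∘ suc)) ⟩
    ∑ k′ (u ∘ suc) + ∑ k′ (λ i → u (suc (k′ + i))) ≡⟨ sym (∑-split k′ k′ (u ∘ suc)) ⟩
    ∑ (k′ + k′) (u ∘ suc)   ≤⟨ ∑-monoˡ (u ∘ suc) 2k′≤k ⟩
    S u k                   ∎
    where
    open ≤-Reasoning
    k = κ (pred j)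
    k′ = k / 2
    swap-2 : ∀ c x → 2 * (c * x) ≡ c * (2 * x)
    swap-2 = solve-∀
    swap-c : ∀ c k x → c * (k * x) ≡ k * (c * x)
    swap-c = solve-∀
    2k′≤k : k′ + k′ ≤ k
    2k′≤k = ≤-trans (≤-reflexive (twice k′)) (m/n*n≤m k 2)
      where
      twice : ∀ k → k + k ≡ k * 2
      twice = solve-∀
    k≤ : k ≤ suc (k′ * 2)
    k≤ = ≤-trans (≤-reflexive (m≡m%n+[m/n]*n k 2)) (+-monoˡ-≤ (k′ * 2) (s≤s⁻¹ (m%n<n k 2)))
    4p≢0 : NonZero (4 * p)
    4p≢0 = m*n≢0 4 p {{_}} {{>-nonZero 1≤p}}
    j≥ : 2 * (4 * p) ≤ j
    j≥ = ≤-trans (*-monoʳ-≤ 2 (m≤m*n (4 * p) ((4 * p) ^ ν) {{m^n≢0 (4 * p) ν {{4p≢0}}}})) big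
    1≤j : 1 ≤ j
    1≤j = ≤-trans (≤-trans 1≤p (≤-trans (m≤n*m p 4) (m≤n*m (4 * p) 2))) j≥
    in-range : ∀ i → i < k′ → suc (k′ + i) < j
    in-range i i<k′ = ≤-<-trans (≤-trans (+-monoʳ-< k′ i<k′) 2k′≤k) (κpred< 1≤j)
    1≤k′ : 1 ≤ k′
    1≤k′ = ≰⇒> λ k′≤0 → <⇒≱ (<-≤-trans (*-monoˡ-< p {{>-nonZero 1≤p}} (s≤s (s≤s (s≤s (z≤n {5}))))) (≤-trans (≤-reflexive (*-assoc 2 4 p)) j≥))
      (≤-trans (≤pκpred j) (≤-trans (*-monoʳ-≤ p (s≤s (≤-trans k≤ (s≤s (*-monoˡ-≤ 2 k′≤0))))) (≤-reflexive (*-comm p 2))))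
    j≤ : j ≤ 4 * p * k′
    j≤ = ≤-trans (≤pκpred j) (≤-trans (*-monoʳ-≤ p (≤-trans (s≤s k≤) (≤-trans (+-monoˡ-≤ (k′ * 2) (*-monoˡ-≤ 2 1≤k′)) (≤-reflexive (four k′))))) (≤-reflexive (shuffle p k′)))
      where
      four : ∀ k → k * 2 + k * 2 ≡ 4 * k
      four = solve-∀
      shuffle : ∀ p k → p * (4 * k) ≡ 4 * p * k
      shuffle = solve-∀
    2j^ν≤ : 2 * j ^ ν ≤ k′ ^ suc ν
    2j^ν≤ = *-cancelˡ-≤ ((4 * p) ^ suc ν) {{m^n≢0 (4 * p) (suc ν) {{4p≢0}}}} (begin
      (4 * p) ^ suc ν * (2 * j ^ ν)     ≡⟨ shuffle ((4 * p) ^ suc ν) (j ^ ν) ⟩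
      2 * (4 * p) ^ suc ν * j ^ ν       ≤⟨ *-monoˡ-≤ (j ^ ν) big ⟩
      j ^ suc ν                         ≤⟨ ^-monoˡ-≤ (suc ν) j≤ ⟩
      (4 * p * k′) ^ suc ν              ≡⟨ ^-distribʳ-* (suc ν) (4 * p) k′ ⟩
      (4 * p) ^ suc ν * k′ ^ suc ν      ∎)
      where
      shuffle : ∀ x z → x * (2 * z) ≡ 2 * x * z
      shuffle = solve-∀

-- `h-μ` says that a target of size 2^(Arμ) has room for the mantissa and the whole layout. `h-p` is
-- the threshold of `power-sum-lower`, `h-θ` makes θ exceed the square of the recursion depth, and
-- `h-a₀` serves to bound the first late term.
record Constants (p : ℕ) : Set where
  field
    A U μ ω y y′ r₀ : ℕ
    1≤A  : 1 ≤ A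
    2≤U  : 2 ≤ U
    3≤r₀ : 3 ≤ r₀
    1≤μ  : 1 ≤ μ
    h-μ  : ∀ r → r₀ ≤ r → 2 * r + (A * suc r + (y′ + suc (suc r) + (y + suc ω) + r * ω)) ≤ A * r * μ
    h-p  : 2 * (4 * p) ^ suc μ ≤ 2 ^ (A * r₀)
    h-θ  : ∀ r → r₀ ≤ r → 4 * (suc (p * (A * suc r)) * suc (p * (A * suc r))) ≤ 2 ^ r
    h-a₀ : 2 ^ (A * r₀) * suc (U * (2 ^ (A * r₀)) ^ μ) ≤ 2 ^ (r₀ * r₀)

module Construction {ε : ℝ} (fl : Floor ε) (constants : Constants (Floor.p fl)) where
  open Floor fl
  open FloorFacts fl
  open Constants constants
  U≢0 : NonZero U
  U≢0 = >-nonZero (≤-trans (s≤s z≤n) 2≤U)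
  open Layout A U ω y y′ {{U≢0}} public
  open Stages A 1≤A public

  private
    -- The powers j^μ of the early stages start the recursion with sums so large that the targets
    -- have enough bits for the layout.
    entry : ∀ j → ℕ → Dec (stage j < r₀) → ℕ
    entry j s (yes _) = suc (U * j ^ μ)
    entry j s (no  _) = suc (U * α (stage j) j s)

    body : (ℕ → ℕ) → ℕ → ℕ
    body u j = entry j (S u (κ (pred j))) (stage j <? r₀)

    local : ∀ u v j → (∀ i → i < j → u i ≡ v i) → body u j ≡ body v j
    local u v zero    h = cong (λ s → entry 0 s (stage 0 <? r₀)) (∑-cong (κ 0) λ i i< → contradiction (≤-trans i< (κ≤ 0)) λ ())
    local u v (suc j) h = cong (λ s → entry (suc j) s (stage (suc j) <? r₀)) (∑-cong (κ j) λ i i< → h (suc i) (≤-trans (s≤s i<) (s≤s (κ≤ j))))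

    module Rec = CourseOfValues body local

  abstract
    a : ℕ → ℕ
    a = Rec.fix

    a-unfold : ∀ j → a j ≡ body a j
    a-unfold = Rec.fix-unfold

  -- For large j a subset of density ε has at least κ (j - 1) indices below j, so its terms before
  -- the j-th place sum to at least `s j`. This is why a term must not exceed it.
  s : ℕ → ℕ
  s j = S a (κ (pred j))

  a-early : ∀ {j} → stage j < r₀ → a j ≡ suc (U * j ^ μ)
  a-early {j} h = trans (a-unfold j) (early (stage j <? r₀))
    where
    early : (d : Dec (stage j < r₀)) → entry j (s j) d ≡ suc (U * j ^ μ)
    early (yes _) = refl
    early (no ¬h) = contradiction h ¬h

  a-late : ∀ {j} → r₀ ≤ stage j → a j ≡ suc (U * α (stage j) j (s j))
  a-late {j} h = trans (a-unfold j) (late (stage j <? r₀))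
    where
    late : (d : Dec (stage j < r₀)) → entry j (s j) d ≡ suc (U * α (stage j) j (s j))
    late (yes h′) = contradiction h (<⇒≱ h′)
    late (no _)   = refl

  s-mono : ∀ {i j} → i ≤ j → s i ≤ s j
  s-mono i≤j = ∑-monoˡ (a ∘ suc) (κ-mono (pred-mono-≤ i≤j))

  late⇒1≤ : ∀ {j} → r₀ ≤ stage j → 1 ≤ j
  late⇒1≤ {zero}  h = contradiction (≤-trans (≤-trans 3≤r₀ h) stage-zero) λ ()
  late⇒1≤ {suc j} h = s≤s z≤n

  late⇒≥ : ∀ {j} → r₀ ≤ stage j → 2 ^ (A * r₀) ≤ j
  late⇒≥ {j} h = ≤-trans (2^-mono (*-monoʳ-≤ A h)) (stage-lower j (late⇒1≤ h))

  module Room {r z : ℕ} (r₀≤r : r₀ ≤ r) (big : 2 * (U * 2 ^ (A * r * μ)) ≤ z) where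
    3≤r : 3 ≤ r
    3≤r = ≤-trans 3≤r₀ r₀≤r

    σ≥ : 2 ^ (A * r * μ) ≤ σ r z
    σ≥ = σ-big r z _ 3≤r big

    σ-large : 2 ^ (2 * r) ≤ σ r z
    σ-large = ≤-trans (2^-mono (≤-trans (m≤m+n (2 * r) _) (h-μ r r₀≤r))) σ≥

    room : A * suc r + overhead r ≤ expo r (σ r z)
    room = +-cancelˡ-≤ (2 * r) _ _ (≤-trans (h-μ r r₀≤r) (≤-trans (s≤s⁻¹ (2^-cancel-< (≤-<-trans σ≥ (expo-upper r (σ r z))))) (≤-reflexive (+-comm (expo r (σ r z)) (2 * r)))))

  private
    power≥ : ∀ {j} → r₀ ≤ stage j → 2 ^ (A * stage j * μ) ≤ j ^ μ
    power≥ {j} h = ≤-trans (≤-reflexive (sym (^-*-assoc 2 (A * stage j) μ))) (^-monoˡ-≤ μ (stage-lower j (late⇒1≤ h)))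

    big′ : ∀ {j} → r₀ ≤ stage j → 2 * (U * j ^ μ) ≤ s j → 2 * (U * 2 ^ (A * stage j * μ)) ≤ s j
    big′ h q = ≤-trans (*-monoʳ-≤ 2 (*-monoʳ-≤ U (power≥ h))) q

    halve : ∀ {θ a s} → 8 ≤ θ → θ * s ≤ θ * a + 4 * s → s ≤ 2 * a
    halve {θ} {a} {s} 8≤θ h with m≤n⇒∃[o]m+o≡n 8≤θ
    ... | o , refl = *-cancelˡ-≤ (8 + o) (by-cert (o * s) (+-mono-≤ h h) (identity o a s))
      where
      identity : ∀ o a s → (8 + o) * s + ((8 + o) * a + 4 * s + ((8 + o) * a + 4 * s)) + o * s ≡ (8 + o) * (2 * a) + ((8 + o) * s + (8 + o) * s)
      identity = solve-∀

  -- The growth propagates by induction: a sum of κ (j - 1) powers has order j^(μ+1), which from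
  -- stage r₀ on is at least 2j^μ, and a late term is at least half of its sum.
  a-power : ∀ j → U * j ^ μ ≤ a j
  s-power : ∀ j → r₀ ≤ stage j → (∀ {i} → i < j → U * i ^ μ ≤ a i) → 2 * (U * j ^ μ) ≤ s j
  s-power j h IH = power-sum-lower a U μ j (≤-trans h-p (late⇒≥ h)) (λ i i<j → IH i<j)

  a-power = <-rec _ λ j IH → case r₀ ≤? stage j of λ
    { (no ¬h) → ≤-trans (n≤1+n _) (≤-reflexive (sym (a-early (≰⇒> ¬h))))
    ; (yes h) → let open Room {stage j} {s j} h (big′ h (s-power j h IH))
                    open Bounds (stage j) j (s j) 3≤r (stage-upper j) room σ-large
                in *-cancelˡ-≤ 2 (≤-trans (s-power j h IH) (subst (λ a → s j ≤ 2 * a) (sym (a-late h)) (halve (8≤2^ 3≤r) term-lower))) }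

  s-large : ∀ {j} → r₀ ≤ stage j → 2 * (U * 2 ^ (A * stage j * μ)) ≤ s j
  s-large {j} h = big′ h (s-power j h λ {i} _ → a-power i)

  late-upper : ∀ {j} → r₀ ≤ stage j → 2 * 2 ^ stage j * a j + 5 * s j ≤ 2 * 2 ^ stage j * s j
  late-upper {j} h = subst (λ a → 2 * 2 ^ stage j * a + 5 * s j ≤ 2 * 2 ^ stage j * s j) (sym (a-late h)) term-upper
    where
    open Room {stage j} {s j} h (s-large h)
    open Bounds (stage j) j (s j) 3≤r (stage-upper j) room σ-large

  late-lower : ∀ {j} → r₀ ≤ stage j → 2 ^ stage j * s j ≤ 2 ^ stage j * a j + 4 * s j
  late-lower {j} h = subst (λ a → 2 ^ stage j * s j ≤ 2 ^ stage j * a + 4 * s j) (sym (a-late h)) term-lower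
    where
    open Room {stage j} {s j} h (s-large h)
    open Bounds (stage j) j (s j) 3≤r (stage-upper j) room σ-large

  a≤s : ∀ {j} → r₀ ≤ stage j → a j ≤ s j
  a≤s {j} h = *-cancelˡ-≤ (2 * 2 ^ stage j) {{m*n≢0 2 (2 ^ stage j) {{_}} {{2^≢0 (stage j)}}}} (≤-trans (m≤m+n _ _) (late-upper h))

  s≤2a : ∀ {j} → r₀ ≤ stage j → s j ≤ 2 * a j
  s≤2a h = halve (8≤2^ (≤-trans 3≤r₀ h)) (late-lower h)

  1≤s : ∀ {j} → r₀ ≤ stage j → 1 ≤ s j
  1≤s {j} h = ≤-trans (≤-trans (m^n>0 2 (A * stage j * μ)) (≤-trans (m≤n*m _ U {{U≢0}}) (m≤n*m _ 2))) (s-large h)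

  α-mono : ∀ {i j} → r₀ ≤ stage i → i < j → α (stage i) i (s i) < α (stage i) j (s j)
  α-mono {i} {j} h i<j = [ same , apart ]′ (float-step r {σ r (s i)} {σ r (s j)} σ-large (σ-mono r (s-mono (<⇒≤ i<j))))
    where
    open Room {stage i} {s i} h (s-large h)
    open Bounds (stage i) i (s i) 3≤r (stage-upper i) room σ-large
    r = stage i
    e = expo r (σ r (s i))
    m = mant r (σ r (s i))
    e′ = expo r (σ r (s j))
    m′ = mant r (σ r (s j))
    apart : key r (σ r (s i)) < key r (σ r (s j)) × m * 2 ^ e + 2 ^ e ≤ m′ * 2 ^ e′ → α r i (s i) < α r j (s j)
    apart (_ , jump) = <-≤-trans α-upper (≤-trans jump (≤-trans (m≤m+n _ _) (m≤m+n _ _)))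
    same : e ≡ e′ × m ≡ m′ → α r i (s i) < α r j (s j)
    same (e≡ , m≡) = <-≤-trans α-next (≤-trans (+-monoʳ-≤ (m * 2 ^ e) (*-monoˡ-≤ (2 ^ unit r e) i<j))
      (≤-trans (≤-reflexive (cong₂ (λ m e → m * 2 ^ e + j * 2 ^ unit r e) m≡ e≡)) (m≤m+n _ _)))

  a-inc : StrictlyIncreasing a
  a-inc i j 1≤i i<j with r₀ ≤? stage i | r₀ ≤? stage j
  ... | no ¬hi | no ¬hj = subst₂ _<_ (sym (a-early (≰⇒> ¬hi))) (sym (a-early (≰⇒> ¬hj)))
          (s≤s (*-monoʳ-< U {{U≢0}} (^-monoˡ-< μ {{>-nonZero 1≤μ}} i<j)))
  ... | yes hi | no ¬hj = contradiction (≤-trans hi (stage-mono 1≤i (<⇒≤ i<j))) ¬hj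
  ... | no ¬hi | yes hj = subst (_< a j) (sym (a-early (≰⇒> ¬hi))) (≤-trans bound (a-power j))
    where
    -- `a-power` gives the late term without its summand 1, so U ≥ 2 has to make up for the summand
    -- 1 of the early term.
    bound : suc (suc (U * i ^ μ)) ≤ U * j ^ μ
    bound = ≤-trans (+-monoˡ-≤ (U * i ^ μ) 2≤U) (≤-trans (≤-reflexive (sym (*-suc U (i ^ μ)))) (*-monoʳ-≤ U (^-monoˡ-< μ {{>-nonZero 1≤μ}} i<j)))
  ... | yes hi | yes hj with m≤n⇒m<n∨m≡n (stage-mono 1≤i (<⇒≤ i<j))
  ...   | inj₂ eq = subst₂ _<_ (sym (a-late hi)) (sym (trans (a-late hj) (cong (λ r → suc (U * α r j (s j))) (sym eq))))
            (s≤s (*-monoʳ-< U {{U≢0}} (α-mono hi i<j)))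
  ...   | inj₁ lt = cross-stage-< {2 ^ stage i} {2 ^ stage j} {s = s i} {s j} (≤-trans (s≤s (s≤s (z≤n {6}))) (8≤2^ (≤-trans 3≤r₀ hi))) (2^-mono lt)
            (1≤s hi) (s-mono (<⇒≤ i<j)) (a≤s hj) (late-upper hi) (late-lower hj)

  a-pos : Positive a
  a-pos j 1≤j = ≤-trans (≤-trans (m^n>0 j {{>-nonZero 1≤j}} μ) (m≤n*m (j ^ μ) U {{U≢0}})) (a-power j)

  sequence : Sequence
  sequence = record { term = a ; positive = a-pos ; increasing = a-inc }

  a-mono : ∀ {i j} → 1 ≤ i → i ≤ j → a i ≤ a j
  a-mono = strict⇒mono a-inc

  j₀ : ℕ
  j₀ = 2 ^ (A * r₀)

  ≥j₀⇒late : ∀ {j} → j₀ ≤ j → r₀ ≤ stage j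
  ≥j₀⇒late = ≤-stage

-- Growth of the sequence

bernoulli : ∀ p n → (p + n) * p ^ n ≤ p * suc p ^ n
bernoulli p zero    = ≤-reflexive (cong (_* 1) (+-identityʳ p))
bernoulli p (suc n) = begin
  (p + suc n) * (p * p ^ n)         ≤⟨ by-cert (n * p ^ n) (z≤n {0}) (lemma p n (p ^ n)) ⟩
  suc p * ((p + n) * p ^ n)         ≤⟨ *-monoʳ-≤ (suc p) (bernoulli p n) ⟩
  suc p * (p * suc p ^ n)           ≡⟨ shuffle (suc p) p (suc p ^ n) ⟩
  p * suc p ^ suc n                 ∎
  where
  open ≤-Reasoning
  lemma : ∀ p n x → (p + suc n) * (p * x) + 0 + n * x ≡ suc p * ((p + n) * x) + 0
  lemma = solve-∀
  shuffle : ∀ a b c → a * (b * c) ≡ b * (a * c)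
  shuffle = solve-∀

-- (1 + 1/p)^p ≥ 2 by Bernoulli's inequality. Consequently an index up to 2^n has depth at most pn.
doubling : ∀ p → 1 ≤ p → ∀ n → 2 ^ n * p ^ (p * n) ≤ suc p ^ (p * n)
doubling p 1≤p n = begin
  2 ^ n * p ^ (p * n)    ≡⟨ cong (2 ^ n *_) (sym (^-*-assoc p p n)) ⟩
  2 ^ n * (p ^ p) ^ n    ≡⟨ sym (^-distribʳ-* n 2 (p ^ p)) ⟩
  (2 * p ^ p) ^ n        ≤⟨ ^-monoˡ-≤ n once ⟩
  (suc p ^ p) ^ n        ≡⟨ ^-*-assoc (suc p) p n ⟩
  suc p ^ (p * n)        ∎
  where
  open ≤-Reasoning
  once : 2 * p ^ p ≤ suc p ^ p
  once = *-cancelˡ-≤ p {{>-nonZero 1≤p}} (≤-trans (≤-reflexive (shuffle p (p ^ p))) (bernoulli p p))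
    where
    shuffle : ∀ p x → p * (2 * x) ≡ (p + p) * x
    shuffle = solve-∀

module Growth {ε : ℝ} (fl : Floor ε) (constants : Constants (Floor.p fl)) where
  open Floor fl
  open FloorFacts fl
  open Constants constants
  open Construction fl constants public

  1≤j₀ : 1 ≤ j₀
  1≤j₀ = 1≤2^ (A * r₀)

  -- Induction on the depth: a late term is at most a sum of fewer than J terms whose depth is
  -- smaller by one.
  a-growth : ∀ m {J j} → 1 ≤ J → j ≤ J → 1 ≤ j → j * p ^ m ≤ suc p ^ m * j₀ → a j ≤ J ^ m * a j₀
  a-growth m {J} {j} 1≤J j≤J 1≤j h with j ≤? j₀
  ... | yes j≤j₀ = ≤-trans (a-mono 1≤j j≤j₀) (m≤n*m (a j₀) (J ^ m) {{m^n≢0 J m {{>-nonZero 1≤J}}}})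
  a-growth zero    {J} {j} 1≤J j≤J 1≤j h | no j≰j₀ = contradiction (subst₂ _≤_ (*-identityʳ j) (+-identityʳ j₀) h) j≰j₀
  a-growth (suc m) {J} {j} 1≤J j≤J 1≤j h | no j≰j₀ = begin
    a j                    ≤⟨ a≤s (≥j₀⇒late (<⇒≤ (≰⇒> j≰j₀))) ⟩
    S a k                  ≤⟨ ∑-mono k (λ i i<k → a-growth m 1≤J (≤-trans (≤-trans i<k k≤j) j≤J) (s≤s z≤n)
                                (≤-trans (*-monoˡ-≤ (p ^ m) i<k) (κpred-power j m h))) ⟩
    ∑ k (λ _ → J ^ m * a j₀) ≡⟨ ∑-const k _ ⟩
    k * (J ^ m * a j₀)     ≤⟨ *-monoˡ-≤ _ (≤-trans k≤j j≤J) ⟩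
    J * (J ^ m * a j₀)     ≡⟨ sym (*-assoc J (J ^ m) (a j₀)) ⟩
    J ^ suc m * a j₀       ∎
    where
    open ≤-Reasoning
    k = κ (pred j)
    k≤j : k ≤ j
    k≤j = <⇒≤ (κpred< 1≤j)

  a-j₀ : a j₀ ≤ 2 ^ (r₀ * r₀)
  a-j₀ = begin
    a j₀                                        ≤⟨ a≤s (≥j₀⇒late ≤-refl) ⟩
    S a (κ (pred j₀))                           ≤⟨ ∑-mono (κ (pred j₀)) (λ i i< → early (suc i) (≤-<-trans i< (κpred< 1≤j₀))) ⟩
    ∑ (κ (pred j₀)) (λ _ → suc (U * j₀ ^ μ))    ≡⟨ ∑-const (κ (pred j₀)) _ ⟩
    κ (pred j₀) * suc (U * j₀ ^ μ)              ≤⟨ *-monoˡ-≤ _ (<⇒≤ (κpred< 1≤j₀)) ⟩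
    j₀ * suc (U * j₀ ^ μ)                       ≤⟨ h-a₀ ⟩
    2 ^ (r₀ * r₀)                               ∎
    where
    open ≤-Reasoning
    early : ∀ i → i < j₀ → a i ≤ suc (U * j₀ ^ μ)
    early i i<j₀ = ≤-trans (≤-reflexive (a-early (≰⇒> λ h → <⇒≱ i<j₀ (late⇒≥ h)))) (s≤s (*-monoʳ-≤ U (^-monoˡ-≤ μ (<⇒≤ i<j₀))))

  -- Depth pA(r + 1) with a factor 2^(A(r+1)) per level, and r² for `a j₀`. The result is quadratic
  -- in r, which O(r) levels of ratio 2^r can exhaust.
  bits : ℕ → ℕ
  bits r = A * suc r * (p * (A * suc r)) + r * r

  a-bits : ∀ {r j} → r₀ ≤ r → 1 ≤ j → j ≤ 2 ^ (A * suc r) → a j ≤ 2 ^ bits r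
  a-bits {r} {j} r₀≤r 1≤j j≤ = begin
    a j                              ≤⟨ a-growth (p * n) (1≤2^ n) j≤ 1≤j (≤-trans (*-monoˡ-≤ (p ^ (p * n)) j≤) (≤-trans (doubling p 1≤p n) (m≤m*n _ j₀ {{>-nonZero 1≤j₀}}))) ⟩
    (2 ^ n) ^ (p * n) * a j₀         ≤⟨ *-mono-≤ (≤-reflexive (^-*-assoc 2 n (p * n))) (≤-trans a-j₀ (2^-mono (*-mono-≤ r₀≤r r₀≤r))) ⟩
    2 ^ (n * (p * n)) * 2 ^ (r * r)  ≡⟨ 2^-+ (n * (p * n)) (r * r) ⟩
    2 ^ bits r                       ∎
    where
    open ≤-Reasoning
    n = A * suc r

  s-bits : ∀ {r j} → r₀ ≤ r → j₀ ≤ j → j ≤ 2 ^ (A * suc r) → s j ≤ 2 ^ suc (bits r)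
  s-bits r₀≤r j₀≤j j≤ = ≤-trans (s≤2a (≥j₀⇒late j₀≤j)) (*-monoʳ-≤ 2 (a-bits r₀≤r (≤-trans 1≤j₀ j₀≤j) j≤))

  -- The strict inequality says that m units of depth are not enough for j, while pA(stage j + 1)
  -- units are; so `h-θ` bounds (m + 2)².
  slope-stage : ∀ {m j} → r₀ ≤ stage j → suc p ^ m * j₀ < j * p ^ m → 4 * (suc (suc m) * suc (suc m)) ≤ 2 ^ stage j
  slope-stage {m} {j} h lt = ≤-trans (*-monoʳ-≤ 4 (*-mono-≤ m≤ m≤)) (h-θ (stage j) h)
    where
    n = A * suc (stage j)
    m< : m < p * n
    m< = ≰⇒> λ pn≤m → case m≤n⇒∃[o]m+o≡n pn≤m of λ { (o , refl) → <⇒≱ lt (begin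
      j * p ^ (p * n + o)                ≡⟨ cong (j *_) (^-distribˡ-+-* p (p * n) o) ⟩
      j * (p ^ (p * n) * p ^ o)          ≤⟨ *-mono-≤ (<⇒≤ (stage-upper j)) (*-monoʳ-≤ (p ^ (p * n)) (^-monoˡ-≤ o (n≤1+n p))) ⟩
      2 ^ n * (p ^ (p * n) * suc p ^ o)  ≡⟨ sym (*-assoc (2 ^ n) _ _) ⟩
      2 ^ n * p ^ (p * n) * suc p ^ o    ≤⟨ *-monoˡ-≤ (suc p ^ o) (doubling p 1≤p n) ⟩
      suc p ^ (p * n) * suc p ^ o        ≡⟨ sym (^-distribˡ-+-* (suc p) (p * n) o) ⟩
      suc p ^ (p * n + o)                ≤⟨ m≤m*n _ j₀ {{>-nonZero 1≤j₀}} ⟩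
      suc p ^ (p * n + o) * j₀           ∎) }
      where open ≤-Reasoning
    m≤ : suc (suc m) ≤ suc (p * n)
    m≤ = s≤s m<

-- The loss factor 1 - 4/θ is at least (m+1)(m+3)/(m+2)², so the losses telescope.
square-loss : ∀ m {θ a s} → 4 * (suc (suc m) * suc (suc m)) ≤ θ → a ≤ s → θ * s ≤ θ * a + 4 * s →
  suc m * suc (suc (suc m)) * s ≤ suc (suc m) * suc (suc m) * a
square-loss m {θ} {a} {s} h a≤s lower with m≤n⇒∃[o]m+o≡n a≤s
... | d , refl = by-cert 0 Md≤s (identity m a d)
  where
  4d : θ * d ≤ 4 * (a + d)
  4d = +-cancelˡ-≤ (θ * a) _ _ (≤-trans (≤-reflexive (sym (*-distribˡ-+ θ a d))) lower)
  Md≤s : suc (suc m) * suc (suc m) * d ≤ a + d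
  Md≤s = *-cancelˡ-≤ 4 (≤-trans (≤-reflexive (sym (*-assoc 4 (suc (suc m) * suc (suc m)) d))) (≤-trans (*-monoˡ-≤ d h) 4d))
  identity : ∀ m a d → suc m * suc (suc (suc m)) * (a + d) + (a + d) + 0 ≡ suc (suc m) * suc (suc m) * a + suc (suc m) * suc (suc m) * d
  identity = solve-∀

-- Comparison of the sequence with f

module Theta {ε : ℝ} (fl : Floor ε) (constants : Constants (Floor.p fl)) (f : ℕ → ℕ) (f⁺ : Positive f)
             (n₀ : ℕ) (f-rec : ∀ n → n₀ ≤ n → f n ≡ S f (Floor.κ fl n)) where
  open Floor fl
  open FloorFacts fl
  open Constants constants
  open Growth fl constants
  open Comparison fl f f⁺ n₀ f-rec

  a=O[f] : a =O f
  a=O[f] = =O-from-recursion a 0 j₀ λ n j₀≤n → ≤-trans (a≤s (≥j₀⇒late j₀≤n))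
    (≤-trans (∑-monoˡ (a ∘ suc) (≤-trans (κ-mono (pred[n]≤n {n})) (m≤m+n (κ n) 0))) (n≤1+n _))

  private
    t₁ = proj₁ (κ-shift 2)
    t = pred t₁

    -- Of the surplus 2 in the shift one unit is lost to `pred`; the other allows the extra summand
    -- in `f≤`.
    κ-step : ∀ {j} → 1 ≤ j → suc (κ (j + t)) ≤ κ (pred j) + t
    κ-step {suc j} _ = s≤s⁻¹ (≤-trans (≤-reflexive (trans (+-comm 2 (κ (suc j + t))) (cong (λ n → κ n + 2) (sym shift))))
      (≤-trans (proj₂ (κ-shift 2) j) (≤-reflexive (trans (cong (κ j +_) (sym t₁≡)) (+-suc (κ j) t)))))
      where
      t₁≡ : suc t ≡ t₁
      t₁≡ = suc-pred t₁ {{>-nonZero (≤-trans (s≤s z≤n) (+-cancelˡ-≤ (κ 0) 2 t₁ (≤-trans (+-monoˡ-≤ 2 (κ-mono z≤n)) (proj₂ (κ-shift 2) 0))))}}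
      shift : j + t₁ ≡ suc j + t
      shift = trans (cong (j +_) (sym t₁≡)) (+-suc j t)

    J₁ = suc j₀ + p * suc (n₀ + p * suc t)
    C = 2 * ∑ J₁ (λ j → f (j + t))

    -- The factor (m+1)/(m+2) stays below 1 for every depth m. From m to m + 1 it grows by
    -- (m+2)²/((m+1)(m+3)), just what `square-loss` costs.
    Claim : ℕ → ℕ → Set
    Claim m j = f (j + t) * suc (suc m) ≤ C * suc m * a j

    early : ∀ m {j} → j < J₁ → 1 ≤ j → Claim m j
    early m {j} j<J₁ 1≤j = begin
      f (j + t) * suc (suc m)       ≤⟨ *-mono-≤ (≤-trans (m≤n+m _ (∑ j u)) (∑-monoˡ u j<J₁)) (+-mono-≤ (s≤s z≤n) ≤-refl) ⟩
      ∑ J₁ u * (suc m + suc m)      ≡⟨ shuffle (∑ J₁ u) (suc m) ⟩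
      C * suc m                     ≤⟨ m≤m*n _ (a j) {{>-nonZero (a-pos j 1≤j)}} ⟩
      C * suc m * a j               ∎
      where
      open ≤-Reasoning
      u = λ j → f (j + t)
      shuffle : ∀ x m → x * (m + m) ≡ 2 * x * m
      shuffle = solve-∀

    weaken : ∀ m {j} → Claim m j → Claim (suc m) j
    weaken m {j} h = *-cancelˡ-≤ (suc (suc m)) (begin
      suc (suc m) * (f (j + t) * suc (suc (suc m)))      ≡⟨ shuffle (suc (suc m)) (f (j + t)) (suc (suc (suc m))) ⟩
      suc (suc (suc m)) * (f (j + t) * suc (suc m))      ≤⟨ *-monoʳ-≤ (suc (suc (suc m))) h ⟩
      suc (suc (suc m)) * (C * suc m * a j)              ≤⟨ by-cert (C * a j) (z≤n {0}) (identity m C (a j)) ⟩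
      suc (suc m) * (C * suc (suc m) * a j)              ∎)
      where
      open ≤-Reasoning
      shuffle : ∀ x y z → x * (y * z) ≡ z * (y * x)
      shuffle = solve-∀
      identity : ∀ m C a → suc (suc (suc m)) * (C * suc m * a) + 0 + C * a ≡ suc (suc m) * (C * suc (suc m) * a) + 0
      identity = solve-∀

    late : ∀ m {j} → J₁ ≤ j → (∀ i → i < κ (pred j) → Claim m (suc i)) → suc p ^ m * j₀ < j * p ^ m → Claim (suc m) j
    late m {j} J₁≤j IH lt = *-cancelˡ-≤ (suc (suc m)) (begin
      M * (f (j + t) * suc M)        ≡⟨ shuffle M (f (j + t)) (suc M) ⟩
      suc M * (f (j + t) * M)        ≤⟨ *-monoʳ-≤ (suc M) (≤-trans (*-monoˡ-≤ M f≤) (≤-trans (≤-reflexive (trans (*-comm (∑ k u) M) (sym (∑-* k M u)))) (∑-mono k λ i i<k → ≤-trans (≤-reflexive (*-comm M (u i))) (IH i i<k)))) ⟩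
      suc M * ∑ k (λ i → C * suc m * a (suc i))  ≡⟨ cong (suc M *_) (∑-* k (C * suc m) (a ∘ suc)) ⟩
      suc M * (C * suc m * s j)      ≡⟨ regroup M C (suc m) (s j) ⟩
      C * (suc m * suc M * s j)      ≤⟨ *-monoʳ-≤ C (square-loss m (slope-stage {m} late-j lt) (a≤s late-j) (late-lower late-j)) ⟩
      C * (M * M * a j)              ≡⟨ regroup′ C M (a j) ⟩
      M * (C * M * a j)              ∎)
      where
      open ≤-Reasoning
      M = suc (suc m)
      k = κ (pred j)
      u : ℕ → ℕ
      u i = f (suc i + t)
      j₀≤j : j₀ ≤ j
      j₀≤j = ≤-trans (≤-trans (n≤1+n j₀) (m≤m+n (suc j₀) _)) J₁≤j
      1≤j = ≤-trans 1≤j₀ j₀≤j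
      late-j = ≥j₀⇒late j₀≤j
      shuffle : ∀ x y z → x * (y * z) ≡ z * (y * x)
      shuffle = solve-∀
      regroup : ∀ M C n s → suc M * (C * n * s) ≡ C * (n * suc M * s)
      regroup = solve-∀
      regroup′ : ∀ C M a → C * (M * M * a) ≡ M * (C * M * a)
      regroup′ = solve-∀
      -- The recurrence at `n₂` gives f n₂ = S f (κ n₂) ≥ S f t, so this one additional term pays
      -- for the first t terms, which the shifted sum omits.
      n₂ = suc (κ (j + t))
      n₀+≤κ : n₀ + p * suc t ≤ κ (j + t)
      n₀+≤κ = <⇒≤ (κ-exceeds (≤-trans (m≤n+m _ (suc j₀)) (≤-trans J₁≤j (m≤m+n j t))))
      t≤κn₂ : t ≤ κ n₂
      t≤κn₂ = <⇒≤ (κ-exceeds (≤-trans (m≤n+m _ n₀) (≤-trans n₀+≤κ (n≤1+n _))))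
      f≤ : f (j + t) ≤ ∑ k (λ i → f (suc i + t))
      f≤ = +-cancelʳ-≤ (S f t) _ _ (begin
        f (j + t) + S f t                     ≡⟨ cong (_+ S f t) (f-rec (j + t) (≤-trans (≤-trans (m≤m+n n₀ _) n₀+≤κ) (κ≤ (j + t)))) ⟩
        S f (κ (j + t)) + S f t               ≤⟨ +-monoʳ-≤ (S f (κ (j + t))) (≤-trans (∑-monoˡ (f ∘ suc) t≤κn₂) (≤-reflexive (sym (f-rec n₂ (≤-trans (≤-trans (m≤m+n n₀ _) n₀+≤κ) (n≤1+n _)))))) ⟩
        S f n₂                                ≤⟨ ∑-monoˡ (f ∘ suc) (≤-trans (κ-step 1≤j) (≤-reflexive (+-comm k t))) ⟩
        S f (t + k)                           ≡⟨ ∑-split t k (f ∘ suc) ⟩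
        S f t + ∑ k (λ i → f (suc (t + i)))   ≡⟨ +-comm (S f t) _ ⟩
        ∑ k (λ i → f (suc (t + i))) + S f t   ≡⟨ cong (_+ S f t) (∑-cong k λ i _ → cong (f ∘ suc) (+-comm t i)) ⟩
        ∑ k (λ i → f (suc i + t)) + S f t     ∎)

    claim : ∀ m j → 1 ≤ j → j * p ^ m ≤ suc p ^ m * j₀ → Claim m j
    claim m j 1≤j h with j <? J₁
    ... | yes j<J₁ = early m j<J₁ 1≤j
    claim zero    j 1≤j h | no j≮J₁ = contradiction (≤-trans (≤-trans (m≤m+n (suc j₀) _) (≮⇒≥ j≮J₁)) (subst₂ _≤_ (*-identityʳ j) (+-identityʳ j₀) h)) 1+n≰n
    claim (suc m) j 1≤j h | no j≮J₁ = case j * p ^ m ≤? suc p ^ m * j₀ of λ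
      { (yes h′) → weaken m {j} (claim m j 1≤j h′)
      ; (no ¬h′) → late m {j} (≮⇒≥ j≮J₁) (λ i i<k → claim m (suc i) (s≤s z≤n) (≤-trans (*-monoˡ-≤ (p ^ m) i<k) (κpred-power j m h))) (≰⇒> ¬h′) }
  f=O[a] : f =O a
  f=O[a] = C , suc n₀ , λ j h → *-cancelʳ-≤ _ _ (suc (p * n j)) (begin
    f j * suc (p * n j)                  ≤⟨ *-mono-≤ (f-mono (≤-trans (n≤1+n n₀) h) (m≤m+n j t)) (n≤1+n _) ⟩
    f (j + t) * suc (suc (p * n j))      ≤⟨ claim (p * n j) j (≤-trans (s≤s z≤n) h) (≤-trans (*-monoˡ-≤ (p ^ (p * n j)) (<⇒≤ (stage-upper j))) (≤-trans (doubling p 1≤p (n j)) (m≤m*n _ j₀ {{>-nonZero 1≤j₀}}))) ⟩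
    C * suc (p * n j) * a j              ≡⟨ shuffle C (suc (p * n j)) (a j) ⟩
    C * a j * suc (p * n j)              ∎)
    where
    open ≤-Reasoning
    n : ℕ → ℕ
    n j = A * suc (stage j)
    shuffle : ∀ x y z → x * y * z ≡ x * z * y
    shuffle = solve-∀

  a=Θ[f] : a =Θ f
  a=Θ[f] = a=O[f] , f=O[a]

-- Exchanges inside a window

module Sizes (p y y′ ω A r : ℕ) (A≡ : A ≡ y′ + 20) (p+4≤y : p + 4 ≤ y) (y≤y′ : y ≤ y′)
  (K≤r : 3 * y′ + y * suc ω + y + ω + A + p + 10 ≤ r) where

  private
    A≤ : A ≤ y′ + 20
    A≤ = ≤-reflexive A≡

    A≥ : y′ + 20 ≤ A
    A≥ = ≤-reflexive (sym A≡)

  -- All sizes are exponents of 2. To leading order T has y′r, a window (y′ + 14)r, β has (y′ +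
  -- 12)r, ρ has (y′ + 9)r and a stage (y′ + 20)r. The last leaves room for the 2^(3r) values of
  -- `key`; the lower-order constants are at most r.
  window-fits : 14 * r + (y′ * suc (suc r) + y * suc ω) ≤ A * r
  window-fits = by-cert (A + p + 5 * r + y + y′ + ω + 10) (+-mono-≤ (*-monoˡ-≤ r A≥) (K≤r)) (identity p y y′ ω A r)
    where
    identity : ∀ p y y′ ω A r → 14 * r + (y′ * suc (suc r) + y * suc ω) + ((A * r) + ((r))) + (A + p + 5 * r + y + y′ + ω + 10) ≡ A * r + (((y′ + 20) * r) + ((3 * y′ + y * suc ω + y + ω + A + p + 10)))
    identity = solve-∀

  few-keys : p + 2 + (14 * r + (y′ * suc (suc r) + y * suc ω)) + (r + 2 * r) ≤ A * suc r
  few-keys = by-cert (2 * A + 2 * r + y + y′ + ω + 8) (+-mono-≤ (*-monoˡ-≤ r A≥) (K≤r)) (identity p y y′ ω A r)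
    where
    identity : ∀ p y y′ ω A r → p + 2 + (14 * r + (y′ * suc (suc r) + y * suc ω)) + (r + 2 * r) + ((A * r) + ((r))) + (2 * A + 2 * r + y + y′ + ω + 8) ≡ A * suc r + (((y′ + 20) * r) + ((3 * y′ + y * suc ω + y + ω + A + p + 10)))
    identity = solve-∀

  box-size : y′ + y + r ≤ (y′ + 9) * r
  box-size = by-cert (r * y′ + y * ω + A + p + 7 * r + y + 2 * y′ + ω + 10) (K≤r) (identity p y y′ ω A r)
    where
    identity : ∀ p y y′ ω A r → y′ + y + r + ((r)) + (r * y′ + y * ω + A + p + 7 * r + y + 2 * y′ + ω + 10) ≡ (y′ + 9) * r + ((3 * y′ + y * suc ω + y + ω + A + p + 10))
    identity = solve-∀

  top-size : (y′ * suc (suc r) + y * suc ω) + (suc (p + 3) + (y′ + y + ω + 3 + 2 * r)) ≤ (y′ + 9) * r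
  top-size = by-cert (A + 6 * r + 3) (K≤r) (identity p y y′ ω A r)
    where
    identity : ∀ p y y′ ω A r → (y′ * suc (suc r) + y * suc ω) + (suc (p + 3) + (y′ + y + ω + 3 + 2 * r)) + ((r)) + (A + 6 * r + 3) ≡ (y′ + 9) * r + ((3 * y′ + y * suc ω + y + ω + A + p + 10))
    identity = solve-∀

  pair-size : suc (suc (p + 3)) ≤ (y′ + 9) * r
  pair-size = by-cert (r * y′ + y * ω + A + 8 * r + 2 * y + 3 * y′ + ω + 5) (K≤r) (identity p y y′ ω A r)
    where
    identity : ∀ p y y′ ω A r → suc (suc (p + 3)) + ((r)) + (r * y′ + y * ω + A + 8 * r + 2 * y + 3 * y′ + ω + 5) ≡ (y′ + 9) * r + ((3 * y′ + y * suc ω + y + ω + A + p + 10))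
    identity = solve-∀

  end-size : ∀ z′ → suc (p + 3) + z′ ≡ 14 * r → suc (2 * r) + A * suc r ≤ (y′ + 9) * r + (z′ + (y′ * suc (suc r) + y * suc ω))
  end-size z′ z≡ = bound
    where
    bound : suc (2 * r) + A * suc r ≤ (y′ + 9) * r + (z′ + (y′ * suc (suc r) + y * suc ω))
    bound = by-cert (r * y′ + 2 * y * ω + 3 * y + 5 * y′ + ω + 5) (+-mono-≤ (≤-reflexive (sym z≡)) (+-mono-≤ (*-monoˡ-≤ (suc r) A≤) (+-mono-≤ (K≤r) (A≥)))) (identity p y y′ ω A r z′)
      where
      identity : ∀ p y y′ ω A r z′ → suc (2 * r) + A * suc r + ((suc (p + 3) + z′) + (((y′ + 20) * suc r) + ((r) + ((A))))) + (r * y′ + 2 * y * ω + 3 * y + 5 * y′ + ω + 5) ≡ (y′ + 9) * r + (z′ + (y′ * suc (suc r) + y * suc ω)) + ((14 * r) + ((A * suc r) + ((3 * y′ + y * suc ω + y + ω + A + p + 10) + ((y′ + 20)))))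
      identity = solve-∀

  dense-size : p + 3 + (y′ + 12) * r ≤ 14 * r + (y′ * suc (suc r) + y * suc ω)
  dense-size = by-cert (2 * y * ω + A + r + 3 * y + 5 * y′ + ω + 7) (K≤r) (identity p y y′ ω A r)
    where
    identity : ∀ p y y′ ω A r → p + 3 + (y′ + 12) * r + ((r)) + (2 * y * ω + A + r + 3 * y + 5 * y′ + ω + 7) ≡ 14 * r + (y′ * suc (suc r) + y * suc ω) + ((3 * y′ + y * suc ω + y + ω + A + p + 10))
    identity = solve-∀

  budget-size : (y′ + 10) * r + 3 ≤ (y′ + 12) * r
  budget-size = by-cert (y * ω + A + p + r + 2 * y + 3 * y′ + ω + 7) (K≤r) (identity p y y′ ω A r)
    where
    identity : ∀ p y y′ ω A r → (y′ + 10) * r + 3 + ((r)) + (y * ω + A + p + r + 2 * y + 3 * y′ + ω + 7) ≡ (y′ + 12) * r + ((3 * y′ + y * suc ω + y + ω + A + p + 10))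
    identity = solve-∀

  near-size : p + 2 + (suc r + (y′ + 12) * r) ≤ 14 * r + (y′ * suc (suc r) + y * suc ω)
  near-size = by-cert (2 * y * ω + A + 3 * y + 5 * y′ + ω + 7) (K≤r) (identity p y y′ ω A r)
    where
    identity : ∀ p y y′ ω A r → p + 2 + (suc r + (y′ + 12) * r) + ((r)) + (2 * y * ω + A + 3 * y + 5 * y′ + ω + 7) ≡ 14 * r + (y′ * suc (suc r) + y * suc ω) + ((3 * y′ + y * suc ω + y + ω + A + p + 10))
    identity = solve-∀

  far-size : ∀ R → suc (suc r) ≤ R → p + (R + (y′ + 12) * r) + 2 ≤ A * R
  far-size R r<R = bound
    where
    bound : p + (R + (y′ + 12) * r) + 2 ≤ A * R
    bound = by-cert (y * ω + A + 6 * R + 2 * y + 5 * y′ + ω + 34) (+-mono-≤ (*-monoˡ-≤ R A≥) (+-mono-≤ (*-monoʳ-≤ (y′ + 12) r<R) (+-mono-≤ (K≤r) (r<R)))) (identity p y y′ ω A r R)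
      where
      identity : ∀ p y y′ ω A r R → p + (R + (y′ + 12) * r) + 2 + ((A * R) + (((y′ + 12) * R) + ((r) + ((R))))) + (y * ω + A + 6 * R + 2 * y + 5 * y′ + ω + 34) ≡ A * R + (((y′ + 20) * R) + (((y′ + 12) * suc (suc r)) + ((3 * y′ + y * suc ω + y + ω + A + p + 10) + ((suc (suc r))))))
      identity = solve-∀

  farther-size : ∀ R → suc (suc r) ≤ R → p + A * suc r + 2 ≤ A * R
  farther-size R r<R = bound
    where
    bound : p + A * suc r + 2 ≤ A * R
    bound = by-cert (22) (+-mono-≤ (*-monoʳ-≤ A r<R) (+-mono-≤ (A≥) (+-mono-≤ (p+4≤y) (y≤y′)))) (identity p y y′ ω A r R)
      where
      identity : ∀ p y y′ ω A r R → p + A * suc r + 2 + ((A * R) + ((A) + ((y) + ((y′))))) + (22) ≡ A * R + ((A * suc (suc r)) + ((y′ + 20) + ((p + 4) + ((y)))))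
      identity = solve-∀

  8p≤2^A : 8 * p ≤ 2 ^ A
  8p≤2^A = ≤-trans (*-monoʳ-≤ 8 (<⇒≤ (n<2^n p))) (≤-trans (≤-reflexive (2^-+ 3 p)) (2^-mono {3 + p} {A} (by-cert 21 (+-mono-≤ A≥ (+-mono-≤ p+4≤y y≤y′)) (identity p y y′ A))))
    where
    identity : ∀ p y y′ A → 3 + p + (A + (y + y′)) + 21 ≡ A + (y′ + 20 + (p + 4 + y))
    identity = solve-∀

  4p≤ : 4 * p ≤ 2 ^ (p + 2)
  4p≤ = ≤-trans (*-monoʳ-≤ 4 (<⇒≤ (n<2^n p))) (≤-reflexive (trans (2^-+ 2 p) (cong (2 ^_) (+-comm 2 p))))

-- The two diagonals agree on everything that has no mixed term in x and u, in particular on the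
-- affine index; only the product of the two spreads has one.
box-identity : ∀ U M W c k₁ k₂ R R′ g h x dx u du →
  let v = λ x u → suc (U * (M + (c + x * k₁ + u * k₂) * W + (R + x * g) * (R′ + u * h))) in
  v x u + (v (x + dx) (u + du) + 0) ≡ v x (u + du) + (v (x + dx) u + 0) + U * (dx * du * (g * h))
box-identity = solve-∀

module Windows {ε : ℝ} (fl : Floor ε) (constants : Constants (Floor.p fl)) where
  open Constants constants
  open Construction fl constants

  module Window (χ : ℕ → ℕ) (χ≤1 : ∀ j → χ j ≤ 1) (ê : ℕ) (y≡ : y ≡ suc ê) (y′≡ : y′ ≡ suc (y + y)) (r e m W₀ z : ℕ)
    (shape : ∀ t → t < 2 ^ z * T r → a (W₀ * T r + t) ≡ suc (U * value r (W₀ * T r + t) e m)) where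

    open SubsetSums a

    o w q : ℕ
    o = W₀ * T r
    w = unit r e
    q = base r w

    Ok : ℕ → Set
    Ok j = 1 ≤ χ j × o ≤ j × j < o + 2 ^ z * T r

    Dense : List ℕ → Set
    Dense D = 2 ^ z * T r ≤ ∑ (2 ^ z * T r) (λ t → 2 ^ ê * avoid D χ (o + t))

    private
      instance
        T≢0′ : NonZero (T r)
        T≢0′ = T≢0 r

    1≤T : 1 ≤ T r
    1≤T = >-nonZero⁻¹ (T r)

    admit : ∀ {D t} → t < 2 ^ z * T r → 1 ≤ avoid D χ (o + t) → Ok (o + t) × o + t ∉ D
    admit {D} {t} t< h with avoid-hit D χ h
    ... | hit , ∉D = (hit , m≤m+n o t , +-monoʳ-< o t<) , ∉D

    block-< : ∀ {b t} → b < 2 ^ z → t < T r → b * T r + t < 2 ^ z * T r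
    block-< {b} {t} b< t< = <-≤-trans (+-monoʳ-< (b * T r) t<) (≤-trans (≤-reflexive (+-comm (b * T r) (T r))) (*-monoˡ-≤ (T r) b<))

    cell-< : ∀ {hi lo} → hi < high r → lo < low → hi * low + lo < T r
    cell-< {hi} {lo} hi< lo< = <-≤-trans (+-monoʳ-< (hi * low) lo<) (≤-trans (≤-reflexive (+-comm (hi * low) low)) (*-monoˡ-≤ low hi<))

    offset-block : ∀ b {t} → t < T r → offset r (o + (b * T r + t)) ≡ t
    offset-block b {t} t< = trans (cong (offset r) (shuffle W₀ b (T r) t)) ([q*n+x]%n≡x (W₀ + b) (T r) t<)
      where
      shuffle : ∀ W b T t → W * T + (b * T + t) ≡ (W + b) * T + t
      shuffle = solve-∀

    a-block : ∀ {b t} → b < 2 ^ z → t < T r →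
      a (o + (b * T r + t)) ≡ suc (U * (m * 2 ^ e + (o + (b * T r + t)) * 2 ^ w + pattern-at r q t))
    a-block {b} {t} b< t< = trans (shape (b * T r + t) (block-< b< t<))
      (cong (λ t′ → suc (U * (m * 2 ^ e + (o + (b * T r + t)) * 2 ^ w + pattern-at r q t′))) (offset-block b t<))

    pattern-cell : ∀ hi {lo} → lo < low → pattern-at r q (hi * low + lo) ≡ spread Y₁ (2 ^ q) (suc (suc r)) hi * spread Y₂ (2 ^ r) (suc ω) lo
    pattern-cell hi {lo} lo< = cong₂ (λ h l → spread Y₁ (2 ^ q) (suc (suc r)) h * spread Y₂ (2 ^ r) (suc ω) l)
      ([q*n+x]/n≡q hi low lo<) ([q*n+x]%n≡x hi low lo<)

    Y₂≡ : Y₂ ≡ 2 * 2 ^ ê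
    Y₂≡ = cong (2 ^_) y≡

    Y₁≡ : Y₁ ≡ 2 * (Y₂ * Y₂)
    Y₁≡ = trans (cong (2 ^_) y′≡) (cong (2 *_) (sym (2^-+ y y)))

    record Box (D : List ℕ) (i i′ : ℕ) : Set where
      field
        c    : ℕ
        1≤c  : 1 ≤ c
        c≤   : c ≤ Y₁ * Y₂
        swp  : Swap Ok D (U * (c * 2 ^ (q * i + r * i′)))

    module _ (D : List ℕ) (dense : Dense D) (i i′ : ℕ) (i< : i < suc (suc r)) (i′< : i′ < suc ω) where
      private
        u : ℕ → ℕ
        u t = 2 ^ ê * avoid D χ (o + t)

        block : ∃[ b ] (b < 2 ^ z × T r ≤ ∑ (T r) (λ t → u (b * T r + t)))
        block = pigeonhole-≤ (2 ^ z) (T r) _ (1≤2^ z) (≤-trans dense (≤-reflexive (∑-blocks (2 ^ z) (T r) u)))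

        b = proj₁ block
        b< = proj₁ (proj₂ block)

        line₁ = dense-line Y₁ low (suc (suc r)) i (λ hi → ∑ low (λ lo → u (b * T r + (hi * low + lo)))) (1≤2^ y′) i<
          (≤-trans (proj₂ (proj₂ block)) (≤-reflexive (∑-blocks (high r) low (λ t → u (b * T r + t)))))

        q₁ = proj₁ line₁
        l₁ = proj₁ (proj₂ line₁)
        l₁< = proj₁ (proj₂ (proj₂ line₁))

        hi : ℕ → ℕ
        hi x = (q₁ * Y₁ + x) * Y₁ ^ i + l₁

        hi< : ∀ x → x < Y₁ → hi x < high r
        hi< = proj₁ (proj₂ (proj₂ (proj₂ line₁)))

        line₂ = dense-line Y₂ Y₁ (suc ω) i′ (λ lo → ∑ Y₁ (λ x → u (b * T r + (hi x * low + lo)))) (1≤2^ y) i′<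
          (≤-trans (≤-reflexive (*-comm low Y₁)) (≤-trans (proj₂ (proj₂ (proj₂ (proj₂ line₁))))
            (≤-reflexive (∑-swap Y₁ low (λ x lo → u (b * T r + (hi x * low + lo)))))))

        q₂ = proj₁ line₂
        l₂ = proj₁ (proj₂ line₂)
        l₂< = proj₁ (proj₂ (proj₂ line₂))

        lo : ℕ → ℕ
        lo v = (q₂ * Y₂ + v) * Y₂ ^ i′ + l₂

        lo< : ∀ v → v < Y₂ → lo v < low
        lo< = proj₁ (proj₂ (proj₂ (proj₂ line₂)))

        τ : ℕ → ℕ → ℕ
        τ x v = b * T r + (hi x * low + lo v)

        χ′ : ℕ → ℕ → ℕ
        χ′ x v = avoid D χ (o + τ x v)

        -- Density 2^(-ê) = 2/Y₂ leaves at least 2Y₁ points in the Y₁ by Y₂ grid, and Y₁ = 2Y₂²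
        -- makes this more than `rectangle` asks for. Hence the relations between ê, y and y′.
        many : Y₁ + Y₂ * Y₂ < ∑ Y₁ (λ x → ∑ Y₂ (χ′ x))
        many = *-cancelˡ-< (2 ^ ê) _ _ (begin-strict
          2 ^ ê * (Y₁ + Y₂ * Y₂)                         <⟨ *-monoʳ-< (2 ^ ê) {{2^≢0 ê}} small ⟩
          2 ^ ê * (2 * Y₁)                               ≡⟨ shuffle (2 ^ ê) Y₁ ⟩
          2 * 2 ^ ê * Y₁                                 ≡⟨ cong (_* Y₁) (sym Y₂≡) ⟩
          Y₂ * Y₁                                        ≤⟨ proj₂ (proj₂ (proj₂ (proj₂ line₂))) ⟩
          ∑ Y₂ (λ v → ∑ Y₁ (λ x → u (τ x v)))            ≡⟨ ∑-swap Y₂ Y₁ (λ v x → u (τ x v)) ⟩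
          ∑ Y₁ (λ x → ∑ Y₂ (λ v → u (τ x v)))            ≡⟨ ∑-cong Y₁ (λ x _ → ∑-* Y₂ (2 ^ ê) (χ′ x)) ⟩
          ∑ Y₁ (λ x → 2 ^ ê * ∑ Y₂ (χ′ x))               ≡⟨ ∑-* Y₁ (2 ^ ê) _ ⟩
          2 ^ ê * ∑ Y₁ (λ x → ∑ Y₂ (χ′ x))               ∎)
          where
          open ≤-Reasoning
          shuffle : ∀ E Y → E * (2 * Y) ≡ 2 * E * Y
          shuffle = solve-∀
          small : Y₁ + Y₂ * Y₂ < 2 * Y₁
          small = +-monoʳ-< Y₁ (subst (λ Y → Y₂ * Y₂ < Y + 0) (sym Y₁≡) (≤-trans (m<m+n (Y₂ * Y₂) (≤-trans (>-nonZero⁻¹ (Y₂ * Y₂) {{m*n≢0 Y₂ Y₂}}) (m≤m+n _ 0))) (≤-reflexive (sym (+-identityʳ _)))))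

        digit₁ = spread-digit Y₁ (2 ^ q) (suc (suc r)) i q₁ l₁ i< l₁<
        digit₂ = spread-digit Y₂ (2 ^ r) (suc ω) i′ q₂ l₂ i′< l₂<
        R₁ = proj₁ digit₁
        R₂ = proj₁ digit₂
        g₁ = (2 ^ q) ^ i
        g₂ = (2 ^ r) ^ i′

        c₀ k₁ k₂ : ℕ
        c₀ = o + b * T r + (q₁ * Y₁ * Y₁ ^ i + l₁) * low + (q₂ * Y₂ * Y₂ ^ i′ + l₂)
        k₁ = Y₁ ^ i * low
        k₂ = Y₂ ^ i′

        linear : ∀ x v → o + τ x v ≡ c₀ + x * k₁ + v * k₂
        linear x v = ring o (b * T r) (q₁ * Y₁) x (Y₁ ^ i) l₁ low (q₂ * Y₂) v (Y₂ ^ i′) l₂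
          where
          ring : ∀ o b q x y l w q′ v y′ l′ → o + (b + (((q + x) * y + l) * w + ((q′ + v) * y′ + l′)))
            ≡ o + b + (q * y + l) * w + (q′ * y′ + l′) + x * (y * w) + v * y′
          ring = solve-∀

        term-at : ∀ x v → x < Y₁ → v < Y₂ →
          a (o + τ x v) ≡ suc (U * (m * 2 ^ e + (c₀ + x * k₁ + v * k₂) * 2 ^ w + (R₁ + x * g₁) * (R₂ + v * g₂)))
        term-at x v x< v< = trans (a-block b< (cell-< (hi< x x<) (lo< v v<)))
          (cong₂ (λ j P → suc (U * (m * 2 ^ e + j * 2 ^ w + P))) (linear x v)
            (trans (pattern-cell (hi x) (lo< v v<)) (cong₂ _*_ (proj₂ digit₁ x x<) (proj₂ digit₂ v v<))))

        distinct : ∀ {x x′ v v′} → x < Y₁ → x′ < Y₁ → v < Y₂ → v′ < Y₂ → x < x′ → o + τ x v ≢ o + τ x′ v′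
        distinct {x} {x′} {v} {v′} x< x′< v< v′< x<x′ eq = <⇒≢ hi-inc (trans (sym (hi-of x v x< v<)) (trans (cong (λ j → offset r j / low) eq) (hi-of x′ v′ x′< v′<)))
          where
          hi-inc : hi x < hi x′
          hi-inc = +-monoˡ-< l₁ (*-monoˡ-< (Y₁ ^ i) {{m^n≢0 Y₁ i}} (+-monoʳ-< (q₁ * Y₁) x<x′))
          hi-of : ∀ x v → x < Y₁ → v < Y₂ → offset r (o + τ x v) / low ≡ hi x
          hi-of x v x< v< = trans (cong (_/ low) (offset-block b (cell-< (hi< x x<) (lo< v v<)))) ([q*n+x]/n≡q (hi x) low (lo< v v<))

        j : ℕ → ℕ → ℕ
        j x v = o + τ x v

        ok : ∀ {x v} → x < Y₁ → v < Y₂ → 1 ≤ χ′ x v → Ok (j x v) × j x v ∉ D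
        ok {x} {v} x< v< h = admit (block-< b< (cell-< (hi< x x<) (lo< v v<))) h

        0<∸ : ∀ {m n} → m < m + n → 0 < n
        0<∸ {m} {n} h = +-cancelˡ-< m 0 n (≤-trans (s≤s (≤-reflexive (+-identityʳ m))) h)

        corners : ∀ x dx v dv → x < Y₁ → x + dx < Y₁ → v < Y₂ → v + dv < Y₂ →
          weight (j x v ∷ j (x + dx) (v + dv) ∷ []) ≡ weight (j x (v + dv) ∷ j (x + dx) v ∷ []) + U * (dx * dv * 2 ^ (q * i + r * i′))
        corners x dx v dv x< x′< v< v′< =
          trans (cong₂ (λ s t → s + (t + 0)) (term-at x v x< v<) (term-at (x + dx) (v + dv) x′< v′<))
          (trans (box-identity U (m * 2 ^ e) (2 ^ w) c₀ k₁ k₂ R₁ R₂ g₁ g₂ x dx v dv)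
          (cong₂ _+_ (sym (cong₂ (λ s t → s + (t + 0)) (term-at x (v + dv) x< v′<) (term-at (x + dx) v x′< v<)))
            (cong (λ G → U * (dx * dv * G)) (trans (cong₂ _*_ (^-*-assoc 2 q i) (^-*-assoc 2 r i′)) (2^-+ (q * i) (r * i′))))))

        assemble : ∀ {x x′ v v′} → (∃[ dx ] x + dx ≡ x′) → (∃[ dv ] v + dv ≡ v′) → x < x′ → x′ < Y₁ → v < v′ → v′ < Y₂ →
          1 ≤ χ′ x v → 1 ≤ χ′ x v′ → 1 ≤ χ′ x′ v → 1 ≤ χ′ x′ v′ → Box D i i′
        assemble {x} {_} {v} (dx , refl) (dv , refl) x<x′ x′< v<v′ v′< xv xv′ x′v x′v′ = record
          { c   = dx * dv
          ; 1≤c = *-mono-≤ (0<∸ x<x′) (0<∸ v<v′)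
          ; c≤  = *-mono-≤ (≤-trans (m≤n+m dx x) (<⇒≤ x′<)) (≤-trans (m≤n+m dv v) (<⇒≤ v′<))
          ; swp = swap (j x v ∷ j (x + dx) (v + dv) ∷ []) (j x (v + dv) ∷ j (x + dx) v ∷ [])
              (fresh ((distinct x< x′< v< v′< x<x′ ∷ []) ∷ [] ∷ [])
                     (proj₁ (ok x< v< xv) ∷ proj₁ (ok x′< v′< x′v′) ∷ []) (proj₂ (ok x< v< xv) ∷ proj₂ (ok x′< v′< x′v′) ∷ []))
              (fresh ((distinct x< x′< v′< v< x<x′ ∷ []) ∷ [] ∷ [])
                     (proj₁ (ok x< v′< xv′) ∷ proj₁ (ok x′< v< x′v) ∷ []) (proj₂ (ok x< v′< xv′) ∷ proj₂ (ok x′< v< x′v) ∷ []))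
              ≤-refl (corners x dx v dv x< x′< v< v′<) }
          where
          x< = <-trans x<x′ x′<
          v< = <-trans v<v′ v′<

      abstract
        box : Box D i i′
        box = case rectangle Y₁ Y₂ χ′ (λ x v → ≤-trans (avoid≤ D χ (o + τ x v)) (χ≤1 (o + τ x v))) many of λ
          { (x , x′ , v , v′ , x<x′ , x′< , v<v′ , v′< , xv , xv′ , x′v , x′v′) →
            assemble (m≤n⇒∃[o]m+o≡n (<⇒≤ x<x′)) (m≤n⇒∃[o]m+o≡n (<⇒≤ v<v′)) x<x′ x′< v<v′ v′< xv xv′ x′v x′v′ }

    -- Indices congruent modulo T carry the same pattern, so that only the summand j·2^w changes.
    record Pair (D : List ℕ) (k : ℕ) : Set where
      field
        g   : ℕ
        g≥  : 2 ^ k ≤ g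
        g<  : g < 2 ^ (suc ê + k)
        swp : Swap Ok D (U * (g * T r * 2 ^ w))

    module _ (D : List ℕ) (dense : Dense D) (k l : ℕ) (l+k≡z : l + (suc ê + k) ≡ z) where
      private
        u : ℕ → ℕ
        u t = 2 ^ ê * avoid D χ (o + t)

        K = 2 ^ (suc ê + k)

        split : 2 ^ l * K ≡ 2 ^ z
        split = trans (2^-+ l (suc ê + k)) (cong (2 ^_) l+k≡z)

        column : ∃[ t ] (t < T r × 2 ^ z ≤ ∑ (2 ^ z) (λ b → u (b * T r + t)))
        column = pigeonhole-≤ (T r) (2 ^ z) _ 1≤T (≤-trans (≤-reflexive (*-comm (T r) (2 ^ z)))
          (≤-trans dense (≤-reflexive (trans (∑-blocks (2 ^ z) (T r) u) (∑-swap (2 ^ z) (T r) (λ b t → u (b * T r + t)))))))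

        t = proj₁ column
        t< = proj₁ (proj₂ column)

        segment : ∃[ β ] (β < 2 ^ l × K ≤ ∑ K (λ γ → u ((β * K + γ) * T r + t)))
        segment = pigeonhole-≤ (2 ^ l) K _ (1≤2^ l) (≤-trans (≤-reflexive split) (≤-trans (proj₂ (proj₂ column))
          (≤-reflexive (trans (cong (λ n → ∑ n (λ b → u (b * T r + t))) (sym split)) (∑-blocks (2 ^ l) K (λ b → u (b * T r + t)))))))

        β = proj₁ segment
        β< = proj₁ (proj₂ segment)

        j : ℕ → ℕ
        j γ = o + ((β * K + γ) * T r + t)

        -- K = 2^(ê+1+k) blocks at density 2^(-ê) contain 2·2^k hits, and 2^k + 1 hits already
        -- contain two at distance 2^k.
        enough : suc (2 ^ k) ≤ ∑ K (λ γ → avoid D χ (j γ))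
        enough = *-cancelˡ-≤ (2 ^ ê) {{2^≢0 ê}} (begin
          2 ^ ê * suc (2 ^ k)                     ≤⟨ *-monoʳ-≤ (2 ^ ê) (+-monoˡ-≤ (2 ^ k) (1≤2^ k)) ⟩
          2 ^ ê * (2 ^ k + 2 ^ k)                 ≡⟨ shuffle (2 ^ ê) (2 ^ k) ⟩
          2 * 2 ^ ê * 2 ^ k                       ≡⟨ 2^-+ (suc ê) k ⟩
          K                                       ≤⟨ proj₂ (proj₂ segment) ⟩
          ∑ K (λ γ → 2 ^ ê * avoid D χ (j γ))     ≡⟨ ∑-* K (2 ^ ê) (λ γ → avoid D χ (j γ)) ⟩
          2 ^ ê * ∑ K (λ γ → avoid D χ (j γ))     ∎)
          where
          open ≤-Reasoning
          shuffle : ∀ E t → E * (t + t) ≡ 2 * E * t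
          shuffle = solve-∀

        b< : ∀ {γ} → γ < K → β * K + γ < 2 ^ z
        b< γ< = <-≤-trans (+-monoʳ-< (β * K) γ<) (≤-trans (≤-reflexive (+-comm (β * K) K)) (≤-trans (*-monoˡ-≤ K β<) (≤-reflexive split)))

        ok : ∀ {γ} → γ < K → 1 ≤ avoid D χ (j γ) → Ok (j γ) × j γ ∉ D
        ok γ< h = admit (block-< (b< γ<) t<) h

        ends : ∀ γ g → γ + g < K → weight (j (γ + g) ∷ []) ≡ weight (j γ ∷ []) + U * (g * T r * 2 ^ w)
        ends γ g γ′< = trans (cong (_+ 0) (a-block (b< γ′<) t<))
          (trans (ring U (m * 2 ^ e) o (β * K) γ g (T r) t (2 ^ w) (pattern-at r q t))
            (cong (λ v → v + 0 + U * (g * T r * 2 ^ w)) (sym (a-block (b< (≤-<-trans (m≤m+n γ g) γ′<)) t<))))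
          where
          ring : ∀ U M o B γ g T t W P → suc (U * (M + (o + ((B + (γ + g)) * T + t)) * W + P)) + 0 ≡ suc (U * (M + (o + ((B + γ) * T + t)) * W + P)) + 0 + U * (g * T * W)
          ring = solve-∀

        assemble : ∀ {γ γ′} → (∃[ g ] γ + g ≡ γ′) → 1 ≤ avoid D χ (j γ) → 1 ≤ avoid D χ (j γ′) → γ + 2 ^ k ≤ γ′ → γ′ < K → Pair D k
        assemble {γ} (g , refl) hγ hγ′ far γ′< = record
          { g = g
          ; g≥ = +-cancelˡ-≤ γ _ _ far
          ; g< = ≤-<-trans (m≤n+m g γ) γ′<
          ; swp = swap (j (γ + g) ∷ []) (j γ ∷ [])
              (fresh ([] ∷ []) (proj₁ (ok γ′< hγ′) ∷ []) (proj₂ (ok γ′< hγ′) ∷ []))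
              (fresh ([] ∷ []) (proj₁ (ok γ< hγ) ∷ []) (proj₂ (ok γ< hγ) ∷ []))
              (s≤s (s≤s z≤n)) (ends γ g γ′<) }
          where γ< = ≤-<-trans (m≤m+n γ g) γ′<

      abstract
        pair : Pair D k
        pair = case far-apart-hits K (2 ^ k) (λ γ → avoid D χ (j γ)) (λ γ → ≤-trans (avoid≤ D χ (j γ)) (χ≤1 (j γ))) (1≤2^ k) enough of λ
          { (γ , γ′ , hγ , hγ′ , far , γ′<) → assemble (m≤n⇒∃[o]m+o≡n (≤-trans (m≤m+n γ (2 ^ k)) far)) hγ hγ′ far γ′< }

    module Supply (ρ X τ z′ : ℕ) (z≡ : z ≡ suc ê + z′) (q≤ : q ≤ r * suc ω) (w≤ : w ≤ q * suc r + r * ω + τ)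
      (ρ-box : Y₁ * Y₂ * 2 ^ r ≤ ρ) (ρ-top : T r * 2 ^ (suc ê + τ) ≤ ρ) (ρ-pair : 2 ^ suc (suc ê) ≤ ρ)
      (ρ-end : X ≤ ρ * (U * (2 ^ z′ * T r * 2 ^ w))) where

      Step : List ℕ → ℕ → Set
      Step D I = ∃[ d ] (d ≤ I × I ≤ ρ * d × Swap Ok D d)

      private
        -- As c ≤ Y₁Y₂, an interval of this length can be extended by any box of level l, whatever c
        -- turns out to be.
        threshold : ℕ → ℕ
        threshold l = U * (Y₁ * Y₂ * 2 ^ l)

        box-step : ∀ {D I} → Dense D → ∀ i i′ → i ≤ suc r → i′ ≤ ω →
          threshold (q * i + r * i′) ≤ I → I ≤ ρ * (U * 2 ^ (q * i + r * i′)) → Step D I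
        box-step {D} {I} dense i i′ i≤ i′≤ lower upper =
          U * (c * 2 ^ l) , ≤-trans (*-monoʳ-≤ U (*-monoˡ-≤ (2 ^ l) c≤)) lower ,
          ≤-trans upper (*-monoʳ-≤ ρ (*-monoʳ-≤ U (m≤n*m (2 ^ l) c {{>-nonZero 1≤c}}))) , swp
          where
          l = q * i + r * i′
          open Box (box D dense i i′ (s≤s i≤) (s≤s i′≤))

        box-range : ∀ {I} l l′ → l′ ≤ l + r → I < threshold l′ → I ≤ ρ * (U * 2 ^ l)
        box-range {I} l l′ l′≤ I< = begin
          I                                ≤⟨ <⇒≤ I< ⟩
          U * (Y₁ * Y₂ * 2 ^ l′)           ≤⟨ *-monoʳ-≤ U (*-monoʳ-≤ (Y₁ * Y₂) (≤-trans (2^-mono l′≤) (≤-reflexive (sym (2^-+ l r))))) ⟩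
          U * (Y₁ * Y₂ * (2 ^ l * 2 ^ r))  ≡⟨ shuffle U (Y₁ * Y₂) (2 ^ l) (2 ^ r) ⟩
          Y₁ * Y₂ * 2 ^ r * (U * 2 ^ l)    ≤⟨ *-monoˡ-≤ _ ρ-box ⟩
          ρ * (U * 2 ^ l)                  ∎
          where
          open ≤-Reasoning
          shuffle : ∀ U Y a b → U * (Y * (a * b)) ≡ Y * b * (U * a)
          shuffle = solve-∀

        reach-pair : ℕ → ℕ
        reach-pair k = U * (T r * 2 ^ (suc ê + k) * 2 ^ w)

        top-range : ∀ {I} → I < reach-pair 0 → I ≤ ρ * (U * 2 ^ (q * suc r + r * ω))
        top-range {I} I< = begin
          I                                            ≤⟨ <⇒≤ I< ⟩
          U * (T r * 2 ^ (suc ê + 0) * 2 ^ w)          ≤⟨ *-monoʳ-≤ U (*-monoʳ-≤ (T r * 2 ^ (suc ê + 0)) (≤-trans (2^-mono w≤) (≤-reflexive (sym (2^-+ l τ))))) ⟩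
          U * (T r * 2 ^ (suc ê + 0) * (2 ^ l * 2 ^ τ)) ≡⟨ shuffle U (T r) (2 ^ (suc ê + 0)) (2 ^ l) (2 ^ τ) ⟩
          T r * (2 ^ (suc ê + 0) * 2 ^ τ) * (U * 2 ^ l) ≡⟨ cong (λ x → T r * x * (U * 2 ^ l)) (trans (2^-+ (suc ê + 0) τ) (cong (λ n → 2 ^ (n + τ)) (+-identityʳ (suc ê)))) ⟩
          T r * 2 ^ (suc ê + τ) * (U * 2 ^ l)          ≤⟨ *-monoˡ-≤ _ ρ-top ⟩
          ρ * (U * 2 ^ l)                              ∎
          where
          open ≤-Reasoning
          l = q * suc r + r * ω
          shuffle : ∀ U T a b c → U * (T * a * (b * c)) ≡ T * (a * c) * (U * b)
          shuffle = solve-∀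

        pair-step : ∀ {D I} → Dense D → ∀ k → k ≤ z′ → reach-pair k ≤ I → I ≤ ρ * (U * (2 ^ k * T r * 2 ^ w)) → Step D I
        pair-step {D} {I} dense k k≤ lower upper = step (m≤n⇒∃[o]m+o≡n k≤)
          where
          step : ∃[ l ] k + l ≡ z′ → Step D I
          step (l , eq) = U * (g * T r * 2 ^ w) ,
            ≤-trans (*-monoʳ-≤ U (*-monoˡ-≤ (2 ^ w) (≤-trans (*-monoˡ-≤ (T r) (<⇒≤ g<)) (≤-reflexive (*-comm _ (T r)))))) lower ,
            ≤-trans upper (*-monoʳ-≤ ρ (*-monoʳ-≤ U (*-monoˡ-≤ (2 ^ w) (*-monoˡ-≤ (T r) g≥)))) , swp
            where
            sizes : l + (suc ê + k) ≡ z
            sizes = trans (shuffle l (suc ê) k) (trans (cong (suc ê +_) eq) (sym z≡))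
              where
              shuffle : ∀ l s k → l + (s + k) ≡ s + (k + l)
              shuffle = solve-∀
            open Pair (pair D dense k l sizes)

        pair-range : ∀ {I} k → I < reach-pair (suc k) → I ≤ ρ * (U * (2 ^ k * T r * 2 ^ w))
        pair-range {I} k I< = begin
          I                                          ≤⟨ <⇒≤ I< ⟩
          U * (T r * 2 ^ (suc ê + suc k) * 2 ^ w)    ≡⟨ cong (λ n → U * (T r * 2 ^ n * 2 ^ w)) (+-suc (suc ê) k) ⟩
          U * (T r * 2 ^ (suc (suc ê) + k) * 2 ^ w)  ≡⟨ cong (λ x → U * (T r * x * 2 ^ w)) (sym (2^-+ (suc (suc ê)) k)) ⟩
          U * (T r * (2 ^ suc (suc ê) * 2 ^ k) * 2 ^ w) ≡⟨ shuffle U (T r) (2 ^ suc (suc ê)) (2 ^ k) (2 ^ w) ⟩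
          2 ^ suc (suc ê) * (U * (2 ^ k * T r * 2 ^ w)) ≤⟨ *-monoˡ-≤ _ ρ-pair ⟩
          ρ * (U * (2 ^ k * T r * 2 ^ w))            ∎
          where
          open ≤-Reasoning
          shuffle : ∀ U T a b c → U * (T * (a * b) * c) ≡ a * (U * (b * T * c))
          shuffle = solve-∀

        top : ∀ {D I} → Dense D → I < X → threshold (q * suc r + r * ω) ≤ I → Step D I
        top {D} {I} dense I<X lower = case reach-pair 0 ≤? I of λ
          { (no ¬h) → box-step dense (suc r) ω ≤-refl ≤-refl lower (top-range (≰⇒> ¬h))
          ; (yes h) → case maximal (λ k → reach-pair k ≤ I) (λ k → reach-pair k ≤? I) h z′ of λ
            { (k , k≤ , hk , inj₁ refl) → pair-step dense k k≤ hk (≤-trans (<⇒≤ I<X) ρ-end)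
            ; (k , k≤ , hk , inj₂ ¬h)   → pair-step dense k k≤ hk (pair-range k (≰⇒> ¬h)) } }

        inner : ∀ {D I} → Dense D → I < X → ∀ i → i ≤ suc r → threshold (q * i) ≤ I → i ≡ suc r ⊎ ¬ (threshold (q * suc i) ≤ I) → Step D I
        inner {D} {I} dense I<X i i≤ hi alt =
          case maximal (λ i′ → threshold (q * i + r * i′) ≤ I) (λ i′ → threshold (q * i + r * i′) ≤? I)
                 (subst (λ l → threshold l ≤ I) (sym (trans (cong (q * i +_) (*-zeroʳ r)) (+-identityʳ _))) hi) ω of λ
          { (i′ , i′≤ , h , inj₂ ¬h)   → box-step dense i i′ i≤ i′≤ h (box-range (q * i + r * i′) _ (≤-reflexive (next i′)) (≰⇒> ¬h))
          ; (i′ , i′≤ , h , inj₁ refl) → case alt of λ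
            { (inj₁ refl) → top dense I<X h
            ; (inj₂ ¬h)   → box-step dense i i′ i≤ i′≤ h (box-range (q * i + r * i′) (q * suc i) far (≰⇒> ¬h)) } }
          where
          next : ∀ i′ → q * i + r * suc i′ ≡ q * i + r * i′ + r
          next i′ = shuffle (q * i) r i′
            where
            shuffle : ∀ x r i → x + r * suc i ≡ x + r * i + r
            shuffle = solve-∀
          far : q * suc i ≤ q * i + r * ω + r
          far = ≤-trans (≤-reflexive (trans (*-suc q i) (+-comm q (q * i)))) (≤-trans (+-monoʳ-≤ (q * i) q≤) (≤-reflexive (next ω)))

      -- The levels qi + ri′ leave gaps of at most r, also from i′ = ω to the next i since q ≤ r(ω +
      -- 1); the last level with threshold up to I serves. Above the highest level pairs take over,
      -- with k in place of the level.
      supply : ∀ D I → Dense D → U * (Y₁ * Y₂) ≤ I → I < X → Step D I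
      supply D I dense I≥ I<X =
        case maximal (λ i → threshold (q * i) ≤ I) (λ i → threshold (q * i) ≤? I)
               (subst (λ l → threshold l ≤ I) (sym (*-zeroʳ q)) (≤-trans (≤-reflexive (cong (U *_) (*-identityʳ (Y₁ * Y₂)))) I≥)) (suc r) of λ
        { (i , i≤ , hi , alt) → inner dense I<X i i≤ hi alt }

-- Residues modulo U² and the first interval

%-≡⇒multiple : ∀ n .{{_ : NonZero n}} {x v} → x % n ≡ v % n → x ≤ v → ∃[ k ] v ≡ x + k * n
%-≡⇒multiple n {x} {v} eq x≤v with m≤n⇒∃[o]m+o≡n (/-monoˡ-≤ n x≤v)
... | k , eq′ = k , (begin
  v                            ≡⟨ m≡m%n+[m/n]*n v n ⟩
  v % n + v / n * n            ≡⟨ cong₂ (λ a b → a + b * n) (sym eq) (sym eq′) ⟩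
  x % n + (x / n + k) * n      ≡⟨ shuffle (x % n) (x / n) k n ⟩
  x % n + x / n * n + k * n    ≡⟨ cong (_+ k * n) (sym (m≡m%n+[m/n]*n x n)) ⟩
  x + k * n                    ∎)
  where
  open ≡-Reasoning
  shuffle : ∀ a b k n → a + (b + k) * n ≡ a + b * n + k * n
  shuffle = solve-∀

-- 1 + Uα is invertible modulo U², with inverse 1 + Uα(U - 1).
unit-mod-square : ∀ u α → let U = suc u in (1 + U * α) * (1 + U * α * u) ≡ 1 + (α + α * α * u) * (U * U)
unit-mod-square = solve-∀

module Residues (em : ExcludedMiddle 0ℓ) (a : ℕ → ℕ) (χ : ℕ → ℕ) (U : ℕ) .{{U≢0 : NonZero U}}
  (a≡1 : ∀ j → ∃[ α ] a j ≡ 1 + U * α) (infinite : ∀ D → ∃[ j ] (1 ≤ χ j × j ∉ D)) where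
  open SubsetSums a

  R : ℕ
  R = U * U

  private
    instance
      R≢0 : NonZero R
      R≢0 = m*n≢0 U U

  private
    Member : ℕ → List ℕ → Set
    Member c D = ∃[ j ] (1 ≤ χ j × j ∉ D × a j % R ≡ c)

    -- One class must keep members outside every short list, so that U² distinct members can be
    -- drawn one after another.
    class : ∃[ c ] (c < R × (∀ D → length D ≤ R → Member c D))
    class = uniform-choice em R Member
      (λ c D E (j , h , ∉ , eq) → (j , h , (λ p → ∉ (∈-++⁺ˡ p)) , eq) , (j , h , (λ p → ∉ (∈-++⁺ʳ D p)) , eq))
      R λ D _ → case infinite D of λ { (j , h , j∉) → a j % R , m%n<n (a j) R , j , h , j∉ , refl }

    ρ = proj₁ class

    members : ∀ n → n ≤ R → ∃[ D ] (length D ≡ n × Unique D × All (λ j → 1 ≤ χ j × a j % R ≡ ρ) D)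
    members zero    _ = [] , refl , [] , []
    members (suc n) n< with members n (<⇒≤ n<)
    ... | D , len , uniq , all with proj₂ (proj₂ class) D (≤-trans (≤-reflexive len) (<⇒≤ n<))
    ...   | j , h , j∉ , eq = j ∷ D , cong suc len , All.tabulate (λ p j≡ → j∉ (subst (_∈ D) (sym j≡) p)) ∷ uniq , (h , eq) ∷ all

    abstract
      found : ∃[ D ] (length D ≡ R × Unique D × All (λ j → 1 ≤ χ j × a j % R ≡ ρ) D)
      found = members R ≤-refl

  prefix : List ℕ
  prefix = proj₁ found

  length-prefix : length prefix ≡ R
  length-prefix = proj₁ (proj₂ found)

  prefix⊆ : ∀ {j} → j ∈ prefix → 1 ≤ χ j
  prefix⊆ j∈ = proj₁ (All.lookup (proj₂ (proj₂ (proj₂ found))) j∈)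

  private
    Sums : List ℕ → ℕ → ℕ → Set
    Sums D k z = Rep D z × z ≤ weight D × z % R ≡ (k * ρ) % R

    partial : ∀ D → Unique D → All (λ j → 1 ≤ χ j × a j % R ≡ ρ) D → ∀ k → k ≤ length D → ∃[ z ] Sums D k z
    partial D       uniq all zero    _ = 0 , ([] , [] , [] , refl) , z≤n , refl
    partial (j ∷ D) (j∉ ∷ uniq) ((_ , eq) ∷ all) (suc k) (s≤s k≤) with partial D uniq all k k≤
    ... | z , (xs , uxs , xs⊆ , refl) , z≤ , z≡ = a j + z ,
      (j ∷ xs , All.tabulate (λ p j≡ → All.lookup j∉ (subst (_∈ D) (sym j≡) (All.lookup xs⊆ p)) refl) ∷ uxs , here refl ∷ All.map there xs⊆ , refl) ,
      +-monoʳ-≤ (a j) z≤ ,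
      trans (%-distribˡ-+ (a j) z R) (trans (cong₂ (λ x y → (x + y) % R) (trans eq (sym ρ%)) z≡) (sym (%-distribˡ-+ ρ (k * ρ) R)))
      where
      ρ% : ρ % R ≡ ρ
      ρ% = m<n⇒m%n≡m (proj₁ (proj₂ class))

    inverse : ∀ α τ → (τ * (1 + U * α * pred U)) % R * ((1 + U * α) % R) % R ≡ τ % R
    inverse α τ = begin
      (τ * ν) % R * ((1 + U * α) % R) % R ≡⟨ sym (%-distribˡ-* (τ * ν) (1 + U * α) R) ⟩
      τ * ν * (1 + U * α) % R             ≡⟨ cong (_% R) (trans (shuffle τ ν (1 + U * α)) (trans (cong (τ *_) square) (expand τ x R))) ⟩
      (τ + τ * x * R) % R                 ≡⟨ [m+kn]%n≡m%n τ (τ * x) R ⟩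
      τ % R                               ∎
      where
      open ≡-Reasoning
      ν = 1 + U * α * pred U
      x = α + α * α * pred U
      square : (1 + U * α) * ν ≡ 1 + x * R
      square = subst (λ V → (1 + V * α) * (1 + V * α * pred U) ≡ 1 + x * (V * V)) (suc-pred U) (unit-mod-square (pred U) α)
      shuffle : ∀ t n x → t * n * x ≡ t * (x * n)
      shuffle = solve-∀
      expand : ∀ t x r → t * (1 + x * r) ≡ t + t * x * r
      expand = solve-∀

    ρ-unit : ∃[ ν ] (∀ τ → (τ * ν) % R * ρ % R ≡ τ % R)
    ρ-unit = case proj₂ (proj₂ class) [] z≤n of λ
      { (j , _ , _ , eq) → case a≡1 j of λ
        { (α , eq′) → 1 + U * α * pred U , λ τ → trans
            (cong (λ x → (τ * (1 + U * α * pred U)) % R * x % R) (trans (sym eq) (cong (_% R) eq′))) (inverse α τ) } }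

  -- The members of `prefix` share a residue ρ ≡ 1 modulo U, a unit modulo U². The sum of k of them
  -- is kρ, and k = τ/ρ reaches τ.
  residue : ∀ τ → ∃[ z ] (Rep prefix z × z ≤ weight prefix × z % R ≡ τ % R)
  residue τ = case partial prefix (proj₁ (proj₂ (proj₂ found))) (proj₂ (proj₂ (proj₂ found))) ((τ * proj₁ ρ-unit) % R)
                   (≤-trans (<⇒≤ (m%n<n (τ * proj₁ ρ-unit) R)) (≤-reflexive (sym length-prefix))) of λ
    { (z , rep , z≤ , z≡) → z , rep , z≤ , trans z≡ (proj₂ ρ-unit τ) }

  module Progression (Ok : ℕ → Set) (β c : ℕ) (1≤c : 1 ≤ c) (c∣U : c ∣ U)
    (swaps : ∀ D → length D ≤ β → Swap Ok D (U * c)) where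

    private
      Shifted : List ℕ → ℕ → ℕ → Set
      Shifted D x n = ∀ z t → Rep prefix z → t ≤ n → Rep D (x + z + U * c * t)

    progression : ∀ n → length prefix + n * 4 ≤ β →
      ∃[ D ] ∃[ x ] (Shifted D x n × length D ≤ length prefix + n * 4 × (∀ {j} → j ∈ D → j ∈ prefix ⊎ Ok j))
    progression zero    _ = prefix , 0 , (λ { z zero rep _ → subst (Rep prefix) (sym (trans (cong (z +_) (*-zeroʳ (U * c))) (+-identityʳ z))) rep }) , m≤m+n _ _ , inj₁
    progression (suc n) n< with progression n (≤-trans (+-monoʳ-≤ (length prefix) (m≤n+m (n * 4) 4)) n<)
    ... | D , x , shifted , len , origin with swaps D (≤-trans len (≤-trans (+-monoʳ-≤ (length prefix) (m≤n+m (n * 4) 4)) n<))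
    ...   | sw@(swap P N FP FN _ gap) = (P ++ N) ++ D , x + weight N , shifted′ ,
            ≤-trans (length-swap sw) (≤-trans (+-monoʳ-≤ 4 len) (≤-reflexive (four (length prefix) (n * 4)))) ,
            (λ j∈ → [ origin , inj₂ ]′ (∈-swap sw j∈))
      where
      four : ∀ l m → 4 + (l + m) ≡ l + (4 + m)
      four = solve-∀
      shifted′ : Shifted ((P ++ N) ++ D) (x + weight N) (suc n)
      shifted′ z t rep t≤ with m≤n⇒m<n∨m≡n t≤
      ... | inj₁ t<   = subst (Rep _) (shuffle x z (U * c * t) (weight N)) (Rep-++ FN (∈-++⁺ʳ (P ++ N)) (λ p → ∈-++⁺ˡ (∈-++⁺ʳ P p)) (shifted z t rep (s≤s⁻¹ t<)))
        where
        shuffle : ∀ x z g w → x + z + g + w ≡ x + w + z + g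
        shuffle = solve-∀
      ... | inj₂ refl = subst (Rep _) (trans (cong (x + z + U * c * n +_) gap) (shuffle x z (U * c) n (weight N))) (Rep-++ FP (∈-++⁺ʳ (P ++ N)) (λ p → ∈-++⁺ˡ (∈-++⁺ˡ p)) (shifted z n rep ≤-refl))
        where
        shuffle : ∀ x z g n w → x + z + g * n + (w + g) ≡ x + w + z + g * suc n
        shuffle = solve-∀

    private
      d = quotient c∣U

      multiple : ∀ k → U * c * (d * k) ≡ k * R
      multiple k = trans (shuffle U c d k) (cong (λ x → k * (U * x)) (sym (_∣_.equality c∣U)))
        where
        shuffle : ∀ U c d k → U * c * (d * k) ≡ k * (U * (d * c))
        shuffle = solve-∀

      fill : ∀ {D x I} → Shifted D x (weight prefix + I) → ∀ {t} → t < I → ∀ {z} → Rep prefix z →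
        ∃[ k ] weight prefix + t ≡ z + k * R → Rep D (x + weight prefix + t)
      fill {D} {x} {I} shifted {t} t<I {z} rep (k , eq) = subst (Rep D) number (shifted z (d * k) rep small)
        where
        number : x + z + U * c * (d * k) ≡ x + weight prefix + t
        number = trans (cong (x + z +_) (multiple k)) (trans (+-assoc x z (k * R)) (trans (cong (x +_) (sym eq)) (sym (+-assoc x (weight prefix) t))))
        small : d * k ≤ weight prefix + I
        small = ≤-trans (m≤n*m (d * k) (U * c) {{m*n≢0 U c {{U≢0}} {{>-nonZero 1≤c}}}})
          (≤-trans (≤-reflexive (multiple k)) (≤-trans (m≤n+m (k * R) z) (≤-trans (≤-reflexive (sym eq)) (+-monoʳ-≤ (weight prefix) (<⇒≤ t<I)))))

    -- The prefix supplies some z congruent to weight prefix + t modulo U². The offset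
    -- `weight prefix` makes the difference nonnegative, and as a multiple of U² it is a multiple of
    -- Uc because c divides U.
    start : ∀ I → length prefix + (weight prefix + I) * 4 ≤ β →
      ∃[ D ] ∃[ x ] (Cover D x I × length D ≤ length prefix + (weight prefix + I) * 4 × (∀ {j} → j ∈ D → j ∈ prefix ⊎ Ok j))
    start I n≤ = case progression (weight prefix + I) n≤ of λ
      { (D , x , shifted , len , origin) → D , x + weight prefix ,
          (λ t t<I → case residue (weight prefix + t) of λ
            { (z , rep , z≤ , z≡) → fill {D} {x} {I} shifted t<I rep (%-≡⇒multiple R z≡ (≤-trans z≤ (m≤m+n _ t))) }) ,
          len , (λ {j} → origin {j}) }

-- Each window that is not good either has few members of χ or moves the monotone key.
good-window : ∀ (χ : ℕ → ℕ) (χ≤1 : ∀ j → χ j ≤ 1) (kk : ℕ → ℕ) → ∀ o Z E M → (∀ i → i < M → kk i ≤ kk (suc i)) →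
  (∃[ i ] (i < M × kk (suc i) ≡ kk i × Z ≤ E * ∑ Z (λ t → χ (o + (i * Z + t))))) ⊎
  (E * ∑ (M * Z) (λ t → χ (o + t)) + E * Z * kk 0 ≤ M * Z + E * Z * kk M)
good-window χ χ≤1 kk o Z E zero    mono = inj₂ (≤-reflexive (cong (_+ E * Z * kk 0) (*-zeroʳ E)))
good-window χ χ≤1 kk o Z E (suc M) mono with good-window χ χ≤1 kk o Z E M (λ i i<M → mono i (m<n⇒m<1+n i<M))
... | inj₁ (i , i<M , good) = inj₁ (i , m<n⇒m<1+n i<M , good)
... | inj₂ h = decide (kk M <? kk (suc M)) (Z ≤? E * c)
  where
  c = ∑ Z (λ t → χ (o + (M * Z + t)))
  sums : ∑ (suc M * Z) (λ t → χ (o + t)) ≡ ∑ (M * Z) (λ t → χ (o + t)) + c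
  sums = trans (cong (λ n → ∑ n (λ t → χ (o + t))) (+-comm Z (M * Z))) (∑-split (M * Z) Z _)
  c≤Z : c ≤ Z
  c≤Z = ≤-trans (∑-mono Z λ t _ → χ≤1 _) (≤-reflexive (trans (∑-const Z 1) (*-identityʳ Z)))
  Result : Set
  Result = (∃[ i ] (i < suc M × kk (suc i) ≡ kk i × Z ≤ E * ∑ Z (λ t → χ (o + (i * Z + t))))) ⊎
    (E * ∑ (suc M * Z) (λ t → χ (o + t)) + E * Z * kk 0 ≤ suc M * Z + E * Z * kk (suc M))
  decide : Dec (kk M < kk (suc M)) → Dec (Z ≤ E * c) → Result
  decide (yes lt) _ = inj₂ (subst (λ x → E * x + E * Z * kk 0 ≤ suc M * Z + E * Z * kk (suc M)) (sym sums)
    (by-cert Z (+-mono-≤ h (+-mono-≤ (*-monoʳ-≤ E c≤Z) (*-monoʳ-≤ (E * Z) lt))) (identity E (∑ (M * Z) (λ t → χ (o + t))) c Z (kk 0) M (kk M) (kk (suc M)))))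
    where
    identity : ∀ E S c Z k₀ M k k′ → E * (S + c) + E * Z * k₀ + (M * Z + E * Z * k + (E * Z + E * Z * k′)) + Z ≡ suc M * Z + E * Z * k′ + (E * S + E * Z * k₀ + (E * c + E * Z * suc k))
    identity = solve-∀
  decide (no ¬lt) (yes good) = inj₁ (M , n<1+n M , ≤-antisym (≮⇒≥ ¬lt) (mono M (n<1+n M)) , good)
  decide (no ¬lt) (no ¬good) = inj₂ (subst (λ x → E * x + E * Z * kk 0 ≤ suc M * Z + E * Z * kk (suc M)) (sym sums)
    (by-cert 0 (+-mono-≤ h (+-mono-≤ (<⇒≤ (≰⇒> ¬good)) (*-monoʳ-≤ (E * Z) (mono M (n<1+n M))))) (identity E (∑ (M * Z) (λ t → χ (o + t))) c Z (kk 0) M (kk M) (kk (suc M)))))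
    where
    identity : ∀ E S c Z k₀ M k k′ → E * (S + c) + E * Z * k₀ + (M * Z + E * Z * k + (Z + E * Z * k′)) + 0 ≡ suc M * Z + E * Z * k′ + (E * S + E * Z * k₀ + (E * c + E * Z * k))
    identity = solve-∀

-- A dense window in a stage

module Selections {ε : ℝ} (fl : Floor ε) (constants : Constants (Floor.p fl)) where
  open Floor fl
  open FloorFacts fl
  open Constants constants
  open Growth fl constants

  module Selection (χ : ℕ → ℕ) (χ≤1 : ∀ j → χ j ≤ 1) (J₁ : ℕ) (count-lower : ∀ J → J₁ ≤ J → κ (pred J) ≤ ∑ J χ)
    (r z n₁ E : ℕ) (r₀≤r : r₀ ≤ r) (O≡ : 2 ^ (A * r) ≡ n₁ * (2 ^ z * T r)) (J₁≤ : J₁ ≤ 2 ^ (A * r))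
    (8p≤ : 8 * p ≤ 2 ^ A) (4p≤E : 4 * p ≤ E)
    (few : E * (2 ^ z * T r) * ((bits r + 3) * 2 ^ (2 * r)) ≤ 2 ^ (A * suc r)) where

    record Selected : Set where
      field
        W₀ e m  : ℕ
        room    : A * suc r + overhead r ≤ e
        shape   : ∀ t → t < 2 ^ z * T r → a (W₀ * T r + t) ≡ suc (U * value r (W₀ * T r + t) e m)
        dense   : 2 ^ z * T r ≤ E * ∑ (2 ^ z * T r) (λ t → χ (W₀ * T r + t))
        after   : 2 ^ (A * r) ≤ W₀ * T r
        before  : W₀ * T r + 2 ^ z * T r ≤ 2 ^ (A * suc r)
        mantissa : 2 ^ (2 * r) ≤ m × m < 2 ^ suc (2 * r)
        total   : U * (m * 2 ^ e + 2 ^ e) ≤ 2 ^ suc (suc (bits r))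
        e≤      : e ≤ suc (bits r)

    private
      O Z Jr M : ℕ
      O = 2 ^ (A * r)
      Z = 2 ^ z * T r
      Jr = 2 ^ (A * suc r)
      M = pred (2 ^ A) * n₁

      Jr≡ : Jr ≡ 2 ^ A * O
      Jr≡ = trans (cong (2 ^_) (*-suc A r)) (sym (2^-+ A (A * r)))

      O+MZ : O + M * Z ≡ Jr
      O+MZ = begin
        O + M * Z                  ≡⟨ cong (O +_) (trans (*-assoc (pred (2 ^ A)) n₁ Z) (cong (pred (2 ^ A) *_) (sym O≡))) ⟩
        suc (pred (2 ^ A)) * O     ≡⟨ cong (_* O) (suc-pred (2 ^ A) {{2^≢0 A}}) ⟩
        2 ^ A * O                  ≡⟨ sym Jr≡ ⟩
        Jr                         ∎
        where open ≡-Reasoning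

      1≤O : 1 ≤ O
      1≤O = 1≤2^ (A * r)

      j₀≤O : j₀ ≤ O
      j₀≤O = 2^-mono (*-monoʳ-≤ A r₀≤r)

      O<Jr : O < Jr
      O<Jr = ^-monoʳ-< 2 (s≤s (s≤s z≤n)) (*-monoʳ-< A {{>-nonZero 1≤A}} (n<1+n r))

      stage≡ : ∀ {j} → O ≤ j → j < Jr → stage j ≡ r
      stage≡ O≤j j<Jr = ≤-antisym (stage-≤ j<Jr (≤-trans 1≤O O≤j)) (≤-stage O≤j)

      big : ∀ {j} → O ≤ j → 2 * (U * 2 ^ (A * r * μ)) ≤ s j
      big {j} O≤j = ≤-trans (subst (λ r → 2 * (U * 2 ^ (A * r * μ)) ≤ s O) (stage≡ ≤-refl O<Jr) (s-large (≥j₀⇒late j₀≤O))) (s-mono O≤j)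

      ex ma : ℕ → ℕ
      ex j = expo r (σ r (s j))
      ma j = mant r (σ r (s j))

      kk : ℕ → ℕ
      kk i = key r (σ r (s (O + i * Z)))

      σ-large′ : ∀ {j} → O ≤ j → 2 ^ (2 * r) ≤ σ r (s j)
      σ-large′ {j} O≤j = Room.σ-large {r} {s j} r₀≤r (big O≤j)

      key-mono : ∀ {i j} → O ≤ i → i ≤ j → key r (σ r (s i)) ≤ key r (σ r (s j))
      key-mono {i} {j} O≤i i≤j = case float-step r (σ-large′ O≤i) (σ-mono r (s-mono i≤j)) of λ
        { (inj₁ (e≡ , m≡)) → ≤-reflexive (cong₂ (λ e m → e * 2 ^ (2 * r) + m) e≡ m≡)
        ; (inj₂ (lt , _)) → <⇒≤ lt }

      kk-step : ∀ i → i < M → kk i ≤ kk (suc i)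
      kk-step i _ = key-mono (m≤m+n O _) (+-monoʳ-≤ O (m≤n+m (i * Z) Z))

      ex-≤ : ∀ {j} → O ≤ j → j ≤ Jr → ex j ≤ suc (bits r)
      ex-≤ {j} O≤j j≤ = ≤-trans (m≤m+n (ex j) (2 * r)) (2^-cancel-≤ (begin
        2 ^ (ex j + 2 * r)   ≤⟨ expo-lower r (σ r (s j)) (σ-large′ O≤j) ⟩
        σ r (s j)            ≤⟨ m≤n*m (σ r (s j)) U {{U≢0}} ⟩
        U * σ r (s j)        ≤⟨ Uσ≤ r (s j) ⟩
        s j                  ≤⟨ s-bits r₀≤r (≤-trans j₀≤O O≤j) j≤ ⟩
        2 ^ suc (bits r)     ∎))
        where open ≤-Reasoning

      kk-M : kk M ≤ (bits r + 3) * 2 ^ (2 * r)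
      kk-M = ≤-trans (key-≤ r (σ r (s (O + M * Z)))) (*-monoˡ-≤ (2 ^ (2 * r))
        (≤-trans (+-monoˡ-≤ 2 (ex-≤ (m≤m+n O _) (≤-reflexive O+MZ))) (≤-reflexive (sym (+-suc (bits r) 2)))))

      -- The set has nearly Jr/p members below Jr. At most O ≤ Jr/8p of them precede the stage, and
      -- without a good window the stage holds at most 2Jr/E ≤ Jr/2p; the sum is too small.
      impossible : ¬ (E * ∑ (M * Z) (λ t → χ (O + t)) + E * Z * kk 0 ≤ M * Z + E * Z * kk M)
      impossible h = <⇒≱ (≤-trans 1≤O (<⇒≤ O<Jr)) (by-cert (E * Z * kk 0 + O)
        (+-mono-≤ (*-monoʳ-≤ 4 count) (+-mono-≤ (*-monoʳ-≤ (4 * p) initial) (+-mono-≤ (*-monoˡ-≤ C 4p≤E) (+-mono-≤ h (+-mono-≤ (≤-trans (*-monoʳ-≤ (E * Z) kk-M) few)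
          (+-mono-≤ (≤-reflexive O+MZ) (+-mono-≤ (*-monoʳ-≤ (4 * p) 1≤O) (≤-trans (*-monoˡ-≤ O 8p≤) (≤-reflexive (sym Jr≡))))))))))
        (identity Jr p O C (∑ O χ) (E * C) (E * Z * kk 0) (M * Z) (E * Z * kk M)))
        where
        C = ∑ (M * Z) (λ t → χ (O + t))
        count : Jr ≤ p * suc (∑ O χ + C)
        count = ≤-trans (≤pκpred Jr) (*-monoʳ-≤ p (s≤s (≤-trans (count-lower Jr (≤-trans J₁≤ (<⇒≤ O<Jr)))
          (≤-reflexive (trans (cong (λ n → ∑ n χ) (sym O+MZ)) (∑-split O (M * Z) χ))))))
        initial : ∑ O χ ≤ O
        initial = ≤-trans (∑-mono O λ j _ → χ≤1 j) (≤-reflexive (trans (∑-const O 1) (*-identityʳ O)))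
        identity : ∀ J p O S C ES K₀ MZ KM → J + (4 * (p * suc (C + S)) + (4 * p * O + (ES + (MZ + KM + (J + (J + (4 * p * O + J))))))) + (K₀ + O)
          ≡ 0 + (4 * J + (4 * p * C + (4 * p * S + (ES + K₀ + (KM + (O + MZ + (4 * p * 1 + 8 * p * O)))))))
        identity = solve-∀

      select : (∃[ i ] (i < M × kk (suc i) ≡ kk i × Z ≤ E * ∑ Z (λ t → χ (O + (i * Z + t))))) → Selected
      select (i , i<M , same , dense) = record
        { W₀ = W₀ ; e = ex o ; m = ma o
        ; room = Room.room {r} {s o} r₀≤r (big O≤o)
        ; shape = shape
        ; dense = ≤-trans dense (≤-reflexive (cong (E *_) (∑-cong Z λ t _ → cong χ (trans (sym (+-assoc O (i * Z) t)) (cong (_+ t) o≡)))))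
        ; after = ≤-trans O≤o (≤-reflexive o≡)
        ; before = ≤-trans (≤-reflexive (trans (cong (_+ Z) (sym o≡)) next≡)) end
        ; mantissa = mant-≥ r (σ-large′ O≤o) , mant-< r
        ; total = total
        ; e≤ = ex-≤ O≤o (≤-trans (m≤m+n o Z) (≤-trans (≤-reflexive next≡) end)) }
        where
        o = O + i * Z
        W₀ = (n₁ + i) * 2 ^ z
        O≤o : O ≤ o
        O≤o = m≤m+n O (i * Z)
        o≡ : o ≡ W₀ * T r
        o≡ = trans (cong (_+ i * Z) O≡) (trans (sym (*-distribʳ-+ Z n₁ i)) (sym (*-assoc (n₁ + i) (2 ^ z) (T r))))
        next≡ : o + Z ≡ O + suc i * Z
        next≡ = trans (+-assoc O (i * Z) Z) (cong (O +_) (+-comm (i * Z) Z))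
        end : O + suc i * Z ≤ Jr
        end = ≤-trans (+-monoʳ-≤ O (*-monoˡ-≤ Z i<M)) (≤-reflexive O+MZ)
        -- The keys at both ends of the window agree, so by monotonicity the rounded target cannot
        -- change in between.
        constant : ∀ t → t < Z → ex o ≡ ex (o + t) × ma o ≡ ma (o + t)
        constant t t<Z = case float-step r (σ-large′ O≤o) (σ-mono r (s-mono (m≤m+n o t))) of λ
          { (inj₁ eq) → eq
          ; (inj₂ (lt , _)) → contradiction (≤-trans (key-mono (≤-trans O≤o (m≤m+n o t)) (≤-trans (+-monoʳ-≤ o (<⇒≤ t<Z)) (≤-reflexive next≡))) (≤-reflexive same)) (<⇒≱ lt) }
        shape′ : ∀ t → t < Z → a (o + t) ≡ suc (U * value r (o + t) (ex o) (ma o))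
        shape′ t t<Z = trans (a-late (≤-trans r₀≤r (≤-reflexive (sym st)))) (trans (cong (λ r → suc (U * α r (o + t) (s (o + t)))) st)
          (cong₂ (λ e m → suc (U * value r (o + t) e m)) (sym (proj₁ (constant t t<Z))) (sym (proj₂ (constant t t<Z)))))
          where
          st : stage (o + t) ≡ r
          st = stage≡ (≤-trans O≤o (m≤m+n o t)) (<-≤-trans (+-monoʳ-< o t<Z) (≤-trans (≤-reflexive next≡) end))
        shape : ∀ t → t < Z → a (W₀ * T r + t) ≡ suc (U * value r (W₀ * T r + t) (ex o) (ma o))
        shape t t<Z = subst (λ o′ → a (o′ + t) ≡ suc (U * value r (o′ + t) (ex o) (ma o))) o≡ (shape′ t t<Z)
        mant2^ : ma o * 2 ^ ex o ≤ σ r (s o)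
        mant2^ = m/n*n≤m (σ r (s o)) (2 ^ ex o) {{2^≢0 (ex o)}}
        total : U * (ma o * 2 ^ ex o + 2 ^ ex o) ≤ 2 ^ suc (suc (bits r))
        total = begin
          U * (ma o * 2 ^ ex o + 2 ^ ex o)   ≤⟨ *-monoʳ-≤ U (+-mono-≤ mant2^ (≤-trans (2^-mono (m≤m+n (ex o) (2 * r))) (expo-lower r (σ r (s o)) (σ-large′ O≤o)))) ⟩
          U * (σ r (s o) + σ r (s o))        ≡⟨ shuffle U (σ r (s o)) ⟩
          2 * (U * σ r (s o))                ≤⟨ *-monoʳ-≤ 2 (≤-trans (Uσ≤ r (s o)) (s-bits r₀≤r (≤-trans j₀≤O O≤o) (≤-trans (m≤m+n o Z) (≤-trans (≤-reflexive next≡) end)))) ⟩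
          2 ^ suc (suc (bits r))             ∎
          where
          open ≤-Reasoning
          shuffle : ∀ U x → U * (x + x) ≡ 2 * (U * x)
          shuffle = solve-∀

    abstract
      selected : Selected
      selected = case good-window χ χ≤1 kk O Z E M kk-step of λ
        { (inj₁ good) → select good
        ; (inj₂ bad)  → contradiction bad impossible }

count<index : ∀ (χ : ℕ → ℕ) → (∀ j → χ j ≤ 1) → χ 0 ≡ 0 → ∀ J → ∑ (suc J) χ ≤ J
count<index χ χ≤1 χ0 zero    = ≤-reflexive χ0
count<index χ χ≤1 χ0 (suc J) = ≤-trans (+-mono-≤ (count<index χ χ≤1 χ0 J) (χ≤1 (suc J))) (≤-reflexive (+-comm J 1))

-- The i-th member of χ has index at least i.
S-count≤ : ∀ (χ a : ℕ → ℕ) → (∀ j → χ j ≤ 1) → χ 0 ≡ 0 → (∀ {i j} → 1 ≤ i → i ≤ j → a i ≤ a j) →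
  ∀ J → S a (∑ J χ) ≤ ∑ J (λ j → χ j * a j)
S-count≤ χ a χ≤1 χ0 mono zero    = z≤n
S-count≤ χ a χ≤1 χ0 mono (suc J) = step (χ J) refl (χ≤1 J)
  where
  IH = S-count≤ χ a χ≤1 χ0 mono J
  step : ∀ c → χ J ≡ c → c ≤ 1 → S a (∑ J χ + χ J) ≤ ∑ J (λ j → χ j * a j) + χ J * a J
  step zero    eq _ = subst (λ c → S a (∑ J χ + c) ≤ ∑ J (λ j → χ j * a j) + c * a J) (sym eq)
    (≤-trans (≤-reflexive (cong (S a) (+-identityʳ (∑ J χ)))) (≤-trans IH (≤-reflexive (sym (+-identityʳ _)))))
  step (suc zero) eq _ = subst (λ c → S a (∑ J χ + c) ≤ ∑ J (λ j → χ j * a j) + c * a J) (sym eq)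
    (≤-trans (≤-reflexive (cong (S a) (+-comm (∑ J χ) 1))) (+-mono-≤ IH (≤-trans (mono (s≤s z≤n) small) (≤-reflexive (sym (+-identityʳ _))))))
    where
    small : suc (∑ J χ) ≤ J
    small = ≤-trans (≤-reflexive (trans (+-comm 1 _) (cong (∑ J χ +_) (sym eq)))) (count<index χ χ≤1 χ0 J)
  step (suc (suc c)) eq (s≤s ())

weight≤ : ∀ (a : ℕ → ℕ) X D → (∀ {j} → j ∈ D → a j ≤ X) → sum (map a D) ≤ length D * X
weight≤ a X []      h = z≤n
weight≤ a X (j ∷ D) h = +-mono-≤ (h (here refl)) (weight≤ a X D (h ∘ there))

Swap-⊆ : ∀ a {Ok D E d} → (∀ {j} → j ∈ D → j ∈ E) → SubsetSums.Swap a Ok E d → SubsetSums.Swap a Ok D d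
Swap-⊆ a {Ok} {D} {E} sub (SubsetSums.swap P N FP FN size gap) = SubsetSums.swap P N (weaken FP) (weaken FN) size gap
  where
  open SubsetSums a
  weaken : ∀ {P} → Fresh Ok E P → Fresh Ok D P
  weaken (fresh u ok ∉) = fresh u ok (All.map (λ j∉ p → j∉ (sub p)) ∉)

-- The loss w is absorbed by the slack 5s/2θ.
absorb : ∀ {θ a s S w} → 5 ≤ 2 * θ → s ≤ S → 2 * θ * a + 5 * s ≤ 2 * θ * s → θ * w ≤ 2 * S → a + w ≤ S
absorb {θ} {a} {s} {S} {w} 5≤ s≤S upper loss with m≤n⇒∃[o]m+o≡n s≤S
... | d , refl = *-cancelˡ-≤ (2 * θ) {{>-nonZero (≤-trans (s≤s z≤n) 5≤)}} (by-cert (s + d)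
        (+-mono-≤ upper (+-mono-≤ (*-monoˡ-≤ d 5≤) (*-monoʳ-≤ 2 loss))) (identity θ a s d w))
  where
  identity : ∀ θ a s d w → 2 * θ * (a + w) + (2 * θ * s + (2 * θ * d + 2 * (2 * (s + d)))) + (s + d) ≡ 2 * θ * (s + d) + (2 * θ * a + 5 * s + (5 * d + 2 * (θ * w)))
  identity = solve-∀

-- Completeness of dense subsets

record Calibrated {p : ℕ} (constants : Constants p) : Set where
  open Constants constants
  field
    y≡       : y ≡ suc (p + 3)
    y′≡      : y′ ≡ suc (y + y)
    A≡       : A ≡ y′ + 20
    divisors : ∀ c → 1 ≤ c → c ≤ 2 ^ y′ * 2 ^ y → c ∣ U
    ω-big    : ∀ r → 1 ≤ r → suc (A * suc r * (p * (A * suc r)) + r * r) ≤ r * suc ω * suc r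

module Completeness (em : ExcludedMiddle 0ℓ) {ε : ℝ} (fl : Floor ε) (constants : Constants (Floor.p fl)) (calibrated : Calibrated constants) where
  open Floor fl
  open FloorFacts fl
  open Constants constants
  open Calibrated calibrated
  open Growth fl constants
  open SubsetSums a
  open Windows fl constants using (module Window)
  open Selections fl constants using (module Selection)

  a≡1modU : ∀ j → ∃[ x ] a j ≡ 1 + U * x
  a≡1modU j = case r₀ ≤? stage j of λ
    { (yes h) → _ , a-late h
    ; (no ¬h) → _ , a-early (≰⇒> ¬h) }

  I₀ : ℕ
  I₀ = U * (Y₁ * Y₂)

  K : ℕ
  K = 3 * y′ + y * suc ω + y + ω + A + p + 10

  p+4≤y : p + 4 ≤ y
  p+4≤y = ≤-reflexive (trans (+-suc p 3) (sym y≡))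

  y≤y′ : y ≤ y′
  y≤y′ = ≤-trans (≤-trans (m≤m+n y y) (n≤1+n _)) (≤-reflexive (sym y′≡))

  module AtStage (χ : ℕ → ℕ) (χ≤1 : ∀ j → χ j ≤ 1) (χ0 : χ 0 ≡ 0) (J₁ : ℕ) (count-lower : ∀ J → J₁ ≤ J → κ (pred J) ≤ ∑ J χ)
    (prefix : List ℕ) (prefix⊆ : ∀ {j} → j ∈ prefix → 1 ≤ χ j) (β₀ r : ℕ) (r₀≤r : r₀ ≤ r) (K≤r : K ≤ r) (prefix≤r : sum prefix ≤ r)
    (J₁≤r : J₁ ≤ r) (β₁≤r : suc (Y₁ * Y₂) * β₀ ≤ r) (bits≤ : bits r + 3 ≤ 2 ^ r) where

    3≤r : 3 ≤ r
    3≤r = ≤-trans 3≤r₀ r₀≤r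

    open Sizes p y y′ ω A r A≡ p+4≤y y≤y′ K≤r

    z tE ρE βE ρ β E : ℕ
    z = 14 * r
    tE = y′ * suc (suc r) + y * suc ω
    ρE = (y′ + 9) * r
    βE = (y′ + 12) * r
    ρ = 2 ^ ρE
    β = 2 ^ βE
    E = 2 ^ (p + 2)

    T≡ : T r ≡ 2 ^ tE
    T≡ = trans (cong₂ _*_ (^-*-assoc 2 y′ (suc (suc r))) (^-*-assoc 2 y (suc ω))) (2^-+ (y′ * suc (suc r)) (y * suc ω))

    Z≡ : 2 ^ z * T r ≡ 2 ^ (z + tE)
    Z≡ = trans (cong (2 ^ z *_) T≡) (2^-+ z tE)

    n₁ : ℕ
    n₁ = proj₁ (m≤n⇒∃[o]m+o≡n window-fits)

    O≡ : 2 ^ (A * r) ≡ 2 ^ n₁ * (2 ^ z * T r)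
    O≡ = trans (cong (2 ^_) (sym (proj₂ (m≤n⇒∃[o]m+o≡n window-fits)))) (trans (sym (2^-+ (z + tE) n₁)) (trans (*-comm (2 ^ (z + tE)) (2 ^ n₁)) (cong (2 ^ n₁ *_) (sym Z≡))))

    r<2^Ar : r < 2 ^ (A * r)
    r<2^Ar = <-≤-trans (n<2^n r) (2^-mono (m≤n*m r A {{>-nonZero 1≤A}}))

    few : E * (2 ^ z * T r) * ((bits r + 3) * 2 ^ (2 * r)) ≤ 2 ^ (A * suc r)
    few = begin
      E * (2 ^ z * T r) * ((bits r + 3) * 2 ^ (2 * r))   ≤⟨ *-mono-≤ (≤-reflexive (cong (E *_) Z≡)) (*-monoˡ-≤ (2 ^ (2 * r)) bits≤) ⟩
      E * 2 ^ (z + tE) * (2 ^ r * 2 ^ (2 * r))           ≡⟨ cong₂ _*_ (2^-+ (p + 2) (z + tE)) (2^-+ r (2 * r)) ⟩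
      2 ^ (p + 2 + (z + tE)) * 2 ^ (r + 2 * r)           ≡⟨ 2^-+ (p + 2 + (z + tE)) (r + 2 * r) ⟩
      2 ^ (p + 2 + (z + tE) + (r + 2 * r))               ≤⟨ 2^-mono few-keys ⟩
      2 ^ (A * suc r)                                    ∎
      where open ≤-Reasoning

    open Selection χ χ≤1 J₁ count-lower r z (2 ^ n₁) E r₀≤r O≡ (≤-trans J₁≤r (<⇒≤ r<2^Ar)) 8p≤2^A 4p≤ few public using (Selected; selected)

    Z : ℕ
    Z = 2 ^ z * T r

    β₁≤β : suc (Y₁ * Y₂) * β₀ ≤ β
    β₁≤β = ≤-trans β₁≤r (≤-trans (<⇒≤ (n<2^n r)) (2^-mono (m≤n*m r (y′ + 12) {{>-nonZero (≤-trans (s≤s z≤n) (m≤n+m 12 y′))}})))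

    χ⇒1≤ : ∀ {j} → 1 ≤ χ j → 1 ≤ j
    χ⇒1≤ {zero}  h = contradiction (≤-trans h (≤-reflexive χ0)) λ ()
    χ⇒1≤ {suc j} h = s≤s z≤n

    module Chosen (sel : Selected) where
      open Selected sel
      open Window χ χ≤1 (p + 3) y≡ y′≡ r e m W₀ z shape public using (o; w; q; Ok; Dense; Box; box; module Supply)

      -- The window has density at least 2^(-p-2). Half of this more than covers the at most β
      -- indices of D, which leaves 2^(-ê) with ê = p + 3.
      dense-avoiding : ∀ D → length D ≤ β → Dense D
      dense-avoiding D D≤ = subst (Z ≤_) (sym (∑-* Z (2 ^ (p + 3)) (λ t → avoid D χ (o + t)))) (+-cancelʳ-≤ Z _ _ (begin
        Z + Z                                      ≤⟨ +-mono-≤ dense dense ⟩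
        E * C + E * C                              ≡⟨ double E C ⟩
        2 * E * C                                  ≡⟨ cong (_* C) E′≡ ⟩
        2 ^ (p + 3) * C                            ≤⟨ *-monoʳ-≤ (2 ^ (p + 3)) (∑-avoid-count D χ χ≤1 o Z) ⟩
        2 ^ (p + 3) * (C′ + length D)              ≡⟨ *-distribˡ-+ (2 ^ (p + 3)) C′ (length D) ⟩
        2 ^ (p + 3) * C′ + 2 ^ (p + 3) * length D  ≤⟨ +-monoʳ-≤ (2 ^ (p + 3) * C′) (≤-trans (*-monoʳ-≤ (2 ^ (p + 3)) D≤)
                                                       (≤-trans (≤-reflexive (2^-+ (p + 3) βE)) (≤-trans (2^-mono dense-size) (≤-reflexive (sym Z≡))))) ⟩
        2 ^ (p + 3) * C′ + Z                       ∎))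
        where
        open ≤-Reasoning
        C = ∑ Z (λ t → χ (o + t))
        C′ = ∑ Z (λ t → avoid D χ (o + t))
        double : ∀ E C → E * C + E * C ≡ 2 * E * C
        double = solve-∀
        E′≡ : 2 * E ≡ 2 ^ (p + 3)
        E′≡ = cong (2 ^_) (sym (+-suc p 2))

      Level₀ : ℕ → List ℕ → Set
      Level₀ c D = 1 ≤ c × Swap Ok D (U * c)

      from-box : ∀ {D} → Box D 0 0 → ∃[ c ] (c < suc (Y₁ * Y₂) × Level₀ c D)
      from-box {D} b = c , s≤s c≤ , 1≤c , subst (λ x → Swap Ok D (U * x)) (trans (cong (λ n → c * 2 ^ n) (cong₂ _+_ (*-zeroʳ q) (*-zeroʳ r))) (*-identityʳ c)) swp
        where open Box b

      -- The c of a box may vary with D, whereas the progression at the start needs the same amount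
      -- Uc every time.
      uniform : ∃[ c ] (c < suc (Y₁ * Y₂) × (∀ D → length D ≤ β₀ → Level₀ c D))
      uniform = uniform-choice em β₀ Level₀
        (λ c D E′ (1≤c , sw) → (1≤c , Swap-⊆ a ∈-++⁺ˡ sw) , (1≤c , Swap-⊆ a (∈-++⁺ʳ D) sw)) (suc (Y₁ * Y₂))
        λ D D≤ → from-box (box D (dense-avoiding D (≤-trans D≤ β₁≤β)) 0 0 (s≤s z≤n) (s≤s z≤n))

      -- The length to be reached: it bounds the terms up to the end of the window, and is at most
      -- twice the first term of the window.
      X : ℕ
      X = U * (m * 2 ^ e + 2 ^ e)

      q≤ : q ≤ r * suc ω
      q≤ = *-cancelʳ-≤ q (r * suc ω) (suc r) (begin
        q * suc r            ≤⟨ m/n*n≤m (w ∸ overhead r) (suc r) ⟩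
        w ∸ overhead r       ≤⟨ m∸n≤m w (overhead r) ⟩
        w                    ≤⟨ m∸n≤m e (A * suc r) ⟩
        e                    ≤⟨ e≤ ⟩
        suc (bits r)         ≤⟨ ω-big r (≤-trans (s≤s z≤n) 3≤r) ⟩
        r * suc ω * suc r    ∎)
        where open ≤-Reasoning

      -- What separates w from the highest level: the overhead other than rω, and the remainder of
      -- at most r in the division that defines q.
      τ : ℕ
      τ = y′ + y + ω + 3 + 2 * r

      w≤ : w ≤ q * suc r + r * ω + τ
      w≤ = begin
        w                                      ≡⟨ sym (m+[n∸m]≡n (overhead≤unit r room)) ⟩
        overhead r + (w ∸ overhead r)          ≡⟨ cong (overhead r +_) (m≡m%n+[m/n]*n (w ∸ overhead r) (suc r)) ⟩
        overhead r + ((w ∸ overhead r) % suc r + q * suc r) ≤⟨ +-monoʳ-≤ (overhead r) (+-monoˡ-≤ (q * suc r) (s≤s⁻¹ (m%n<n (w ∸ overhead r) (suc r)))) ⟩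
        overhead r + (r + q * suc r)           ≡⟨ identity y′ r y ω (q * suc r) ⟩
        q * suc r + r * ω + τ                  ∎
        where
        open ≤-Reasoning
        identity : ∀ y′ r y ω x → y′ + suc (suc r) + (y + suc ω) + r * ω + (r + x) ≡ x + r * ω + (y′ + y + ω + 3 + 2 * r)
        identity = solve-∀

      ρ-box : Y₁ * Y₂ * 2 ^ r ≤ ρ
      ρ-box = ≤-trans (≤-reflexive (trans (cong (_* 2 ^ r) (2^-+ y′ y)) (2^-+ (y′ + y) r))) (2^-mono box-size)

      ρ-top : T r * 2 ^ (suc (p + 3) + τ) ≤ ρ
      ρ-top = ≤-trans (≤-reflexive (trans (cong (_* 2 ^ (suc (p + 3) + τ)) T≡) (2^-+ tE (suc (p + 3) + τ)))) (2^-mono top-size)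

      z-split : ∃[ z′ ] suc (p + 3) + z′ ≡ z
      z-split = m≤n⇒∃[o]m+o≡n (≤-trans (≤-trans (≤-reflexive (sym y≡)) (≤-trans y≤K K≤r)) (m≤n*m r 14))
        where
        y≤K : y ≤ K
        y≤K = ≤-trans (m≤n+m y (3 * y′ + y * suc ω)) (≤-trans (m≤m+n _ ω) (≤-trans (m≤m+n _ A) (≤-trans (m≤m+n _ p) (m≤m+n _ 10))))

      z′ : ℕ
      z′ = proj₁ z-split

      ρ-end : X ≤ ρ * (U * (2 ^ z′ * T r * 2 ^ w))
      ρ-end = begin
        U * (m * 2 ^ e + 2 ^ e)                       ≡⟨ cong (U *_) (+-comm (m * 2 ^ e) (2 ^ e)) ⟩
        U * (suc m * 2 ^ e)                           ≤⟨ *-monoʳ-≤ U (*-mono-≤ (proj₂ mantissa) (≤-reflexive (sym (2^-unit r room)))) ⟩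
        U * (2 ^ suc (2 * r) * (2 ^ (A * suc r) * 2 ^ w)) ≡⟨ cong (U *_) (trans (sym (*-assoc (2 ^ suc (2 * r)) (2 ^ (A * suc r)) (2 ^ w))) (cong (_* 2 ^ w) (2^-+ (suc (2 * r)) (A * suc r)))) ⟩
        U * (2 ^ (suc (2 * r) + A * suc r) * 2 ^ w)   ≤⟨ *-monoʳ-≤ U (*-monoˡ-≤ (2 ^ w) (2^-mono (end-size z′ (proj₂ z-split)))) ⟩
        U * (2 ^ (ρE + (z′ + tE)) * 2 ^ w)            ≡⟨ cong (λ x → U * (x * 2 ^ w)) (trans (sym (2^-+ ρE (z′ + tE))) (cong (ρ *_) (trans (sym (2^-+ z′ tE)) (cong (2 ^ z′ *_) (sym T≡))))) ⟩
        U * (ρ * (2 ^ z′ * T r) * 2 ^ w)              ≡⟨ shuffle U ρ (2 ^ z′ * T r) (2 ^ w) ⟩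
        ρ * (U * (2 ^ z′ * T r * 2 ^ w))              ∎
        where
        open ≤-Reasoning
        shuffle : ∀ U ρ x w → U * (ρ * x * w) ≡ ρ * (U * (x * w))
        shuffle = solve-∀

      open Supply ρ X τ z′ (sym (proj₂ z-split)) q≤ w≤ ρ-box ρ-top (2^-mono pair-size) ρ-end using (supply)

      L : ℕ
      L = suc (suc (bits r))

      total-budget : β₀ + L * (ρ * 4) ≤ β
      total-budget = begin
        β₀ + L * (ρ * 4)                            ≤⟨ +-mono-≤ (≤-trans (m≤n*m β₀ (suc (Y₁ * Y₂))) (≤-trans β₁≤r (<⇒≤ (n<2^n r)))) (*-mono-≤ (≤-trans L≤ bits≤) (≤-reflexive (2^-+ ρE 2))) ⟩
        2 ^ r + 2 ^ r * 2 ^ (ρE + 2)                ≡⟨ cong (2 ^ r +_) (2^-+ r (ρE + 2)) ⟩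
        2 ^ r + 2 ^ (r + (ρE + 2))                  ≤⟨ +-monoˡ-≤ _ (2^-mono (m≤m+n r (ρE + 2))) ⟩
        2 ^ (r + (ρE + 2)) + 2 ^ (r + (ρE + 2))     ≡⟨ cong (2 ^ (r + (ρE + 2)) +_) (sym (+-identityʳ _)) ⟩
        2 ^ suc (r + (ρE + 2))                      ≡⟨ cong (2 ^_) (identity y′ r) ⟩
        2 ^ ((y′ + 10) * r + 3)                     ≤⟨ 2^-mono budget-size ⟩
        β                                           ∎
        where
        open ≤-Reasoning
        L≤ : L ≤ bits r + 3
        L≤ = ≤-trans (n≤1+n L) (≤-reflexive (+-comm 3 (bits r)))
        identity : ∀ y′ r → suc (r + ((y′ + 9) * r + 2)) ≡ (y′ + 10) * r + 3
        identity = solve-∀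

      reached : ∀ {D₁ x₁} → Cover D₁ x₁ I₀ → length D₁ ≤ β₀ → Grown Ok D₁ (L * (ρ * 4)) (X ≤_)
      reached cover₁ D₁≤ = Engine.reach Ok ρ X β I₀ (λ D I D≤ → supply D I (dense-avoiding D D≤)) {{2^≢0 ρE}} L ≤-refl cover₁
        (≤-trans (+-monoˡ-≤ (L * (ρ * 4)) D₁≤) total-budget)
        (≤-trans total (m≤m*n (2 ^ L) I₀ {{m*n≢0 U (Y₁ * Y₂) {{U≢0}} {{m*n≢0 Y₁ Y₂}}}}))

      window-upper : ∀ t → t < Z → a (o + t) ≤ X
      window-upper t t<Z = begin
        a (o + t)                                 ≡⟨ shape t t<Z ⟩
        suc (U * value r (o + t) e m)             ≤⟨ +-monoˡ-≤ (U * value r (o + t) e m) (≤-trans (s≤s z≤n) 2≤U) ⟩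
        U + U * value r (o + t) e m               ≡⟨ sym (*-suc U _) ⟩
        U * suc (value r (o + t) e m)             ≤⟨ *-monoʳ-≤ U (value-<-block r (o + t) e m room (≤-trans (+-monoʳ-< o t<Z) before)) ⟩
        X                                         ∎
        where open ≤-Reasoning

      1≤Z : 1 ≤ Z
      1≤Z = ≤-trans (1≤2^ (z + tE)) (≤-reflexive (sym Z≡))

      1≤o : 1 ≤ o
      1≤o = ≤-trans (1≤2^ (A * r)) after

      window-lower : X ≤ 2 * a o
      window-lower = begin
        U * (m * 2 ^ e + 2 ^ e)            ≤⟨ *-monoʳ-≤ U (+-monoʳ-≤ (m * 2 ^ e) (m≤n*m (2 ^ e) m {{>-nonZero (≤-trans (1≤2^ (2 * r)) (proj₁ mantissa))}})) ⟩
        U * (m * 2 ^ e + m * 2 ^ e)        ≡⟨ shuffle U (m * 2 ^ e) ⟩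
        2 * (U * (m * 2 ^ e))              ≤⟨ *-monoʳ-≤ 2 (≤-trans (*-monoʳ-≤ U (≤-trans (m≤m+n _ _) (m≤m+n _ _))) (n≤1+n _)) ⟩
        2 * suc (U * value r (o + 0) e m)  ≡⟨ cong (2 *_) (sym (shape 0 1≤Z)) ⟩
        2 * a (o + 0)                      ≡⟨ cong (λ j → 2 * a j) (+-identityʳ o) ⟩
        2 * a o                            ∎
        where
        open ≤-Reasoning
        shuffle : ∀ U x → U * (x + x) ≡ 2 * (U * x)
        shuffle = solve-∀

      below-window : ∀ {j} → 1 ≤ j → j < o + Z → a j ≤ X
      below-window {j} 1≤j j< = case o ≤? j of λ
        { (no o≰j)  → ≤-trans (a-mono 1≤j (<⇒≤ (≰⇒> o≰j))) (subst (λ k → a k ≤ X) (+-identityʳ o) (window-upper 0 1≤Z))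
        ; (yes o≤j) → case m≤n⇒∃[o]m+o≡n o≤j of λ { (t , eq) → subst (λ k → a k ≤ X) eq
            (window-upper t (+-cancelˡ-< o t Z (subst (_< o + Z) (sym eq) j<))) } }

      -- For terms of stage up to r + 1 the members of χ in the window alone outnumber β by the
      -- factor θ that `absorb` requires.
      near-count : 2 ^ suc r * β ≤ ∑ Z (λ t → χ (o + t))
      near-count = *-cancelˡ-≤ E {{2^≢0 (p + 2)}} (begin
        E * (2 ^ suc r * β)                ≡⟨ trans (cong (E *_) (2^-+ (suc r) βE)) (2^-+ (p + 2) (suc r + βE)) ⟩
        2 ^ (p + 2 + (suc r + βE))         ≤⟨ 2^-mono near-size ⟩
        2 ^ (z + tE)                       ≡⟨ sym Z≡ ⟩
        Z                                  ≤⟨ dense ⟩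
        E * ∑ Z (λ t → χ (o + t))          ∎)
        where open ≤-Reasoning

      -- In later stages θ may be too large for the window alone, but there the density of χ takes
      -- over: κ (N - 1) is about N/p, and o is negligible against it.
      far-count : ∀ d → suc (suc r) ≤ stage (o + d) → J₁ ≤ o + d → 2 ^ stage (o + d) * β ≤ ∑ d (λ t → χ (o + t))
      far-count d r<R J₁≤ = +-cancelʳ-≤ o _ _ (begin
        2 ^ R * β + o                        ≤⟨ +-monoʳ-≤ (2 ^ R * β) (≤-trans (m≤m+n o Z) before) ⟩
        2 ^ R * β + 2 ^ (A * suc r)          ≤⟨ s≤s⁻¹ (*-cancelˡ-≤ p {{>-nonZero 1≤p}} (≤-trans quarter (≤pκpred (o + d)))) ⟩
        κ (pred (o + d))                     ≤⟨ count-lower (o + d) J₁≤ ⟩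
        ∑ (o + d) χ                          ≡⟨ ∑-split o d χ ⟩
        ∑ o χ + ∑ d (λ t → χ (o + t))        ≤⟨ +-monoˡ-≤ _ (≤-trans (∑-mono o λ j _ → χ≤1 j) (≤-reflexive (trans (∑-const o 1) (*-identityʳ o)))) ⟩
        o + ∑ d (λ t → χ (o + t))            ≡⟨ +-comm o _ ⟩
        ∑ d (λ t → χ (o + t)) + o            ∎)
        where
        open ≤-Reasoning
        R = stage (o + d)
        N = o + d
        AR≤N : 2 ^ (A * R) ≤ N
        AR≤N = stage-lower N (≤-trans 1≤o (m≤m+n o d))
        four : ∀ x → p * 2 ^ x * 4 ≤ 2 ^ (p + x + 2)
        four x = ≤-trans (*-monoˡ-≤ 4 (*-monoˡ-≤ (2 ^ x) (<⇒≤ (n<2^n p)))) (≤-reflexive (trans (cong (_* 4) (2^-+ p x)) (2^-+ (p + x) 2)))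
        first : p * (2 ^ R * β) * 4 ≤ N
        first = ≤-trans (≤-reflexive (cong (λ x → p * x * 4) (2^-+ R βE))) (≤-trans (four (R + βE)) (≤-trans (2^-mono (far-size R r<R)) AR≤N))
        second : p * 2 ^ (A * suc r) * 4 ≤ N
        second = ≤-trans (four (A * suc r)) (≤-trans (2^-mono (farther-size R r<R)) AR≤N)
        third : p * 1 * 4 ≤ N
        third = ≤-trans (*-monoˡ-≤ 4 (*-monoʳ-≤ p (1≤2^ (A * suc r)))) second
        quarter : p * suc (2 ^ R * β + 2 ^ (A * suc r)) ≤ N
        quarter = *-cancelˡ-≤ 4 (by-cert N (+-mono-≤ first (+-mono-≤ second third)) (identity p (2 ^ R * β) (2 ^ (A * suc r)) N))
          where
          identity : ∀ p x y N → 4 * (p * suc (x + y)) + (N + (N + N)) + N ≡ 4 * N + (p * x * 4 + (p * y * 4 + p * 1 * 4))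
          identity = solve-∀

      module Final (D : List ℕ) (x I : ℕ) (cover : Cover D x I) (length-D : length D ≤ β) (X≤I : X ≤ I)
        (D-origin : ∀ {j} → j ∈ D → j ∈ prefix ⊎ Ok j) where

        D⊆χ : ∀ {j} → j ∈ D → 1 ≤ χ j
        D⊆χ j∈ = case D-origin j∈ of λ
          { (inj₁ j∈prefix) → prefix⊆ j∈prefix
          ; (inj₂ (h , _))  → h }

        D-small : ∀ {j} → j ∈ D → a j ≤ X
        D-small j∈ = below-window (χ⇒1≤ (D⊆χ j∈)) (case D-origin j∈ of λ
          { (inj₁ j∈prefix) → <-≤-trans (≤-<-trans (≤-trans (member≤sum j∈prefix) prefix≤r) r<2^Ar) (≤-trans after (m≤m+n o Z))
          ; (inj₂ (_ , _ , j<)) → j< })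

        weight-D : weight D ≤ β * X
        weight-D = ≤-trans (weight≤ a X D D-small) (*-monoˡ-≤ X length-D)

        count : ∀ d → Z ≤ d → 2 ^ stage (o + d) * β ≤ ∑ d (λ t → χ (o + t))
        count d Z≤d = case stage (o + d) ≤? suc r of λ
          { (yes h) → ≤-trans (*-monoˡ-≤ β (2^-mono h)) (≤-trans near-count (∑-monoˡ (λ t → χ (o + t)) Z≤d))
          ; (no ¬h) → far-count d (≰⇒> ¬h) (≤-trans J₁≤r (≤-trans (<⇒≤ r<2^Ar) (≤-trans after (m≤m+n o d)))) }

        -- D weighs at most βX ≤ 2β·a o, whereas at least θβ members of χ from o on weigh at least a
        -- o each; so the loss is within the slack.
        beyond : ∀ d → Z ≤ d → a (o + d) + weight D ≤ ∑ (o + d) (λ j → χ j * a j)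
        beyond d Z≤d = absorb {2 ^ stage N} {a N} {s N} (≤-trans (s≤s (s≤s (s≤s (s≤s (s≤s (z≤n {11})))))) (*-monoʳ-≤ 2 (8≤2^ (≤-trans 3≤r₀ late-N)))) s≤ (late-upper late-N) loss
          where
          open ≤-Reasoning
          N = o + d
          O≤N : 2 ^ (A * r) ≤ N
          O≤N = ≤-trans after (m≤m+n o d)
          late-N : r₀ ≤ stage N
          late-N = ≥j₀⇒late (≤-trans (2^-mono (*-monoʳ-≤ A r₀≤r)) O≤N)
          total-sum = ∑ N (λ j → χ j * a j)
          s≤ : s N ≤ total-sum
          s≤ = ≤-trans (∑-monoˡ (a ∘ suc) (count-lower N (≤-trans J₁≤r (≤-trans (<⇒≤ r<2^Ar) O≤N)))) (S-count≤ χ a χ≤1 χ0 a-mono N)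
          tail : a o * ∑ d (λ t → χ (o + t)) ≤ total-sum
          tail = begin
            a o * ∑ d (λ t → χ (o + t))             ≡⟨ sym (∑-* d (a o) (λ t → χ (o + t))) ⟩
            ∑ d (λ t → a o * χ (o + t))             ≤⟨ ∑-mono d (λ t _ → ≤-trans (≤-reflexive (*-comm (a o) (χ (o + t)))) (*-monoʳ-≤ (χ (o + t)) (a-mono 1≤o (m≤m+n o t)))) ⟩
            ∑ d (λ t → χ (o + t) * a (o + t))       ≤⟨ m≤n+m _ (∑ o (λ j → χ j * a j)) ⟩
            ∑ o (λ j → χ j * a j) + ∑ d (λ t → χ (o + t) * a (o + t)) ≡⟨ sym (∑-split o d (λ j → χ j * a j)) ⟩
            total-sum                               ∎
          loss : 2 ^ stage N * weight D ≤ 2 * total-sum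
          loss = begin
            2 ^ stage N * weight D                  ≤⟨ *-monoʳ-≤ (2 ^ stage N) weight-D ⟩
            2 ^ stage N * (β * X)                   ≡⟨ sym (*-assoc (2 ^ stage N) β X) ⟩
            2 ^ stage N * β * X                     ≤⟨ *-mono-≤ (count d Z≤d) window-lower ⟩
            ∑ d (λ t → χ (o + t)) * (2 * a o)       ≡⟨ shuffle (∑ d (λ t → χ (o + t))) (a o) ⟩
            2 * (a o * ∑ d (λ t → χ (o + t)))       ≤⟨ *-monoʳ-≤ 2 tail ⟩
            2 * total-sum                           ∎
            where
            shuffle : ∀ c a → c * (2 * a) ≡ 2 * (a * c)
            shuffle = solve-∀

        grows : ∀ N → 1 ≤ χ N → N ∉ D → a N ≤ I + ∑ N (λ j → avoid D χ j * a j)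
        grows N hit _ = case N <? o + Z of λ
          { (yes lt) → ≤-trans (≤-trans (below-window (χ⇒1≤ hit) lt) X≤I) (m≤m+n I _)
          ; (no ¬lt) → case m≤n⇒∃[o]m+o≡n (≤-trans (m≤m+n o Z) (≮⇒≥ ¬lt)) of λ
            { (d , refl) → ≤-trans (+-cancelʳ-≤ (weight D) _ _ (≤-trans (beyond d (+-cancelˡ-≤ o Z d (≮⇒≥ ¬lt))) (∑-avoid D χ a χ≤1 0 (o + d)))) (m≤n+m _ I) } }

        open Finish χ D D⊆χ x I cover grows χ≤1 using (represents)

        -- Every term is at least 1, so the number of adjoined members is a lower bound for the
        -- length reached.
        represented : ∀ t N → t + length D < ∑ N χ → ∃[ xs ] (Unique xs × All (λ j → 1 ≤ χ j) xs × x + t ≡ weight xs)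
        represented t N h = represents t N (<-≤-trans (+-cancelʳ-< (length D) t _ (<-≤-trans h (∑-avoid-count D χ χ≤1 0 N)))
          (≤-trans (∑-mono N λ j _ → m≤m*n (avoid D χ j) (a j) {{>-nonZero (1≤a j)}}) (m≤n+m _ I)))
          where
          1≤a : ∀ j → 1 ≤ a j
          1≤a j = ≤-trans (s≤s z≤n) (≤-reflexive (sym (proj₂ (a≡1modU j))))

module Assembly (em : ExcludedMiddle 0ℓ) {ε : ℝ} (fl : Floor ε) (constants : Constants (Floor.p fl)) (calibrated : Calibrated constants) where
  open Floor fl
  open FloorFacts fl
  open Constants constants
  open Calibrated calibrated
  open Growth fl constants
  open SubsetSums a
  open Completeness em fl constants calibrated

  module DenseSet (χ : ℕ → ℕ) (χ≤1 : ∀ j → χ j ≤ 1) (χ0 : χ 0 ≡ 0) (J₁ : ℕ)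
    (count-lower : ∀ J → J₁ ≤ J → κ (pred J) ≤ ∑ J χ) where

    many : ∀ c → ∃[ N ] (c < ∑ N χ)
    many c = N , ≤-trans (κ-exceeds (*-monoʳ-≤ p (s≤s (m≤m+n c J₁)))) (count-lower N J₁≤)
      where
      N : ℕ
      N = suc (p * suc (c + J₁))
      J₁≤ : J₁ ≤ N
      J₁≤ = ≤-trans (≤-trans (m≤n+m J₁ c) (n≤1+n _)) (≤-trans (m≤n*m (suc (c + J₁)) p {{>-nonZero 1≤p}}) (n≤1+n _))

    infinite : ∀ D → ∃[ j ] (1 ≤ χ j × j ∉ D)
    infinite D = case many (length D) of λ { (N , lt) →
      case first-hit N 1 (avoid D χ) (λ j → ≤-trans (avoid≤ D χ j) (χ≤1 j)) ≤-refl
             (+-cancelʳ-≤ (length D) 1 _ (≤-trans lt (∑-avoid-count D χ χ≤1 0 N))) of λ { (j , hit , _) → j , avoid-hit D χ hit } }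

    open Residues em a χ U {{U≢0}} a≡1modU infinite using (prefix; prefix⊆; module Progression)

    -- The cost of the first interval. It is determined before any stage is chosen, so r may be
    -- taken beyond it.
    β₀ : ℕ
    β₀ = length prefix + (weight prefix + I₀) * 4

    Result : Set
    Result = ∃[ N ] (∀ n → N ≤ n → ∃[ xs ] (Unique xs × All (λ j → 1 ≤ χ j) xs × n ≡ weight xs))

    at-stage : ∀ r → r₀ ≤ r → K ≤ r → sum prefix ≤ r → J₁ ≤ r → suc (Y₁ * Y₂) * β₀ ≤ r → bits r + 3 ≤ 2 ^ r → Result
    at-stage r r₀≤r K≤r prefix≤r J₁≤r β₁≤r bits≤ = from-selected selected
      where
      open AtStage χ χ≤1 χ0 J₁ count-lower prefix prefix⊆ β₀ r r₀≤r K≤r prefix≤r J₁≤r β₁≤r bits≤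

      from-selected : Selected → Result
      from-selected sel = from-uniform uniform
        where
        open Chosen sel

        from-grown : ∀ {D₁} → length D₁ ≤ β₀ → (∀ {j} → j ∈ D₁ → j ∈ prefix ⊎ Ok j) → Grown Ok D₁ (L * (ρ * 4)) (X ≤_) → Result
        from-grown D₁≤ origin₁ (grown D x I cover small origin X≤I) = x , λ n x≤n →
          case many (n ∸ x + length D) of λ { (N , lt) →
            case represented (n ∸ x) N lt of λ { (xs , u , all , eq) → xs , u , all , trans (sym (m+[n∸m]≡n x≤n)) eq } }
          where
          D-origin : ∀ {j} → j ∈ D → j ∈ prefix ⊎ Ok j
          D-origin j∈ = [ origin₁ , inj₂ ]′ (origin j∈)
          length-D : length D ≤ β
          length-D = ≤-trans small (≤-trans (+-monoˡ-≤ (L * (ρ * 4)) D₁≤) total-budget)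
          open Final D x I cover length-D X≤I D-origin using (represented)

        from-uniform : ∃[ c ] (c < suc (Y₁ * Y₂) × (∀ D → length D ≤ β₀ → Level₀ c D)) → Result
        from-uniform (c , c< , swaps) =
          case start I₀ ≤-refl of λ { (D₁ , x₁ , cover₁ , D₁≤ , origin₁) → from-grown D₁≤ (λ {j} → origin₁ {j}) (reached cover₁ D₁≤) }
          where
          1≤c : 1 ≤ c
          1≤c = proj₁ (swaps [] z≤n)
          swaps′ : ∀ D → length D ≤ β₀ → Swap Ok D (U * c)
          swaps′ D D≤ = proj₂ (swaps D D≤)
          open Progression Ok β₀ c 1≤c (divisors c 1≤c (s≤s⁻¹ c<)) swaps′ using (start)

    bits-≤ : ∀ r → (A * (p * A) + 4) * (suc r * suc r) ≤ 2 ^ r → bits r + 3 ≤ 2 ^ r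
    bits-≤ r h = ≤-trans (by-cert (3 * (r * r) + 8 * r + 1) (z≤n {0}) (identity A p r)) h
      where
      identity : ∀ A p r → A * suc r * (p * (A * suc r)) + r * r + 3 + 0 + (3 * (r * r) + 8 * r + 1) ≡ (A * (p * A) + 4) * (suc r * suc r) + 0
      identity = solve-∀

    conclusion : Result
    conclusion = at-stage r (m≤m+n r₀ _) (≤-trans (m≤m+n K _) (m≤n+m _ r₀))
      (≤-trans (≤-trans (m≤m+n (sum prefix) _) (m≤n+m _ K)) (m≤n+m _ r₀))
      (≤-trans (≤-trans (≤-trans (m≤m+n J₁ _) (m≤n+m _ (sum prefix))) (m≤n+m _ K)) (m≤n+m _ r₀))
      (≤-trans (≤-trans (≤-trans (≤-trans (m≤m+n _ _) (m≤n+m _ J₁)) (m≤n+m _ (sum prefix))) (m≤n+m _ K)) (m≤n+m _ r₀))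
      (bits-≤ r (proj₂ quad r (≤-trans (≤-trans (≤-trans (≤-trans (m≤n+m _ (suc (Y₁ * Y₂) * β₀)) (m≤n+m _ J₁)) (m≤n+m _ (sum prefix))) (m≤n+m _ K)) (m≤n+m _ r₀))))
      where
      quad = quadratic≤2^ (A * (p * A) + 4)
      r = r₀ + (K + (sum prefix + (J₁ + (suc (Y₁ * Y₂) * β₀ + proj₁ quad))))

-- Choice of the constants

∣! : ∀ {c n} → 1 ≤ c → c ≤ n → c ∣ n !
∣! {suc c} _ c≤n = ∣-trans (m∣m*n (c !)) (m≤n⇒m!∣n! c≤n)

module Choice (p : ℕ) where

  -- y = ê + 1 for ê = p + 3, and Y₁ = 2Y₂² for `rectangle`. U is a factorial so that every c ≤ Y₁Y₂
  -- divides it. With ω = 2pA² and (r + 1)² ≤ 2r(r + 1), the bits, about pA²(r + 1)², stay within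
  -- r(ω + 1)(r + 1). `r₀` adds up all thresholds.
  y y′ A ω μ U P Q c r₀ : ℕ
  y = suc (p + 3)
  y′ = suc (y + y)
  A = y′ + 20
  ω = 2 * (p * (A * A))
  μ = y′ + y + 2 * ω + 8
  U = (2 ^ y′ * 2 ^ y) !
  P = 2 * (4 * p) ^ suc μ
  c = 4 * (suc (p * A) * suc (p * A))
  Q = proj₁ (quadratic≤2^ c)
  r₀ = 3 + (P + (Q + (A + (1 + (U + A * μ)))))

  abstract
    r₀-P : P ≤ r₀
    r₀-P = ≤-trans (m≤m+n P _) (m≤n+m _ 3)

    r₀-Q : Q ≤ r₀
    r₀-Q = ≤-trans (≤-trans (m≤m+n Q _) (m≤n+m _ P)) (m≤n+m _ 3)

    r₀-A : A + (1 + (U + A * μ)) ≤ r₀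
    r₀-A = ≤-trans (≤-trans (m≤n+m _ Q) (m≤n+m _ P)) (m≤n+m _ 3)

    r₀-3 : 3 ≤ r₀
    r₀-3 = m≤m+n 3 _

    2≤U : 2 ≤ U
    2≤U = ∣⇒≤ {{≢-nonZero (m!≢0 (2 ^ y′ * 2 ^ y))}} (∣! {2} (s≤s z≤n) (*-mono-≤ (2^-mono {1} {y′} (s≤s z≤n)) (1≤2^ y)))
      where
      m!≢0 : ∀ m → m ! ≢ 0
      m!≢0 m = ≢-nonZero⁻¹ (m !) {{m !≢0}}

    divisors : ∀ c → 1 ≤ c → c ≤ 2 ^ y′ * 2 ^ y → c ∣ U
    divisors c = ∣!

  h-μ′ : ∀ A r y y′ ω → 2 * suc r + (suc A * suc (suc r) + (y′ + suc (suc (suc r)) + (y + suc ω) + suc r * ω)) ≤ suc A * suc r * (y′ + y + 2 * ω + 8)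
  h-μ′ A r y y′ ω = by-cert (A * r * y + A * r * y′ + 2 * A * r * ω + 7 * A * r + A * y + A * y′ + 2 * A * ω + r * y + r * y′ + r * ω + 6 * A + 4 * r) (z≤n {0}) (identity A r y y′ ω)
    where
    identity : ∀ A r y y′ ω → 2 * suc r + (suc A * suc (suc r) + (y′ + suc (suc (suc r)) + (y + suc ω) + suc r * ω)) + 0 + (A * r * y + A * r * y′ + 2 * A * r * ω + 7 * A * r + A * y + A * y′ + 2 * A * ω + r * y + r * y′ + r * ω + 6 * A + 4 * r) ≡ suc A * suc r * (y′ + y + 2 * ω + 8) + 0
    identity = solve-∀

  h-μ : ∀ r → 1 ≤ r → 2 * r + (A * suc r + (y′ + suc (suc r) + (y + suc ω) + r * ω)) ≤ A * r * μ
  h-μ (suc r) _ = subst (λ B → 2 * suc r + (B * suc (suc r) + (y′ + suc (suc (suc r)) + (y + suc ω) + suc r * ω)) ≤ B * suc r * μ)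
    (sym (+-suc y′ 19)) (h-μ′ (y′ + 19) r y y′ ω)

  h-θ : ∀ r → r₀ ≤ r → 4 * (suc (p * (A * suc r)) * suc (p * (A * suc r))) ≤ 2 ^ r
  h-θ r r₀≤r = ≤-trans (*-monoʳ-≤ 4 (*-mono-≤ (linear p A r) (linear p A r))) (≤-trans (≤-reflexive (shuffle (suc (p * A)) (suc r))) (proj₂ (quadratic≤2^ c) r (≤-trans r₀-Q r₀≤r)))
    where
    linear : ∀ p A r → suc (p * (A * suc r)) ≤ suc (p * A) * suc r
    linear p A r = by-cert r (z≤n {0}) (identity p A r)
      where
      identity : ∀ p A r → suc (p * (A * suc r)) + 0 + r ≡ suc (p * A) * suc r + 0
      identity = solve-∀
    shuffle : ∀ x z → 4 * (x * z * (x * z)) ≡ 4 * (x * x) * (z * z)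
    shuffle = solve-∀

  h-p : P ≤ 2 ^ (A * r₀)
  h-p = ≤-trans (<⇒≤ (n<2^n P)) (2^-mono (≤-trans r₀-P (m≤n*m r₀ A {{>-nonZero (≤-trans (s≤s z≤n) (m≤n+m 20 y′))}})))

  h-a₀ : 2 ^ (A * r₀) * suc (U * (2 ^ (A * r₀)) ^ μ) ≤ 2 ^ (r₀ * r₀)
  h-a₀ = begin
    N * suc (U * N ^ μ)                        ≤⟨ *-monoʳ-≤ N (+-monoˡ-≤ (U * N ^ μ) (*-mono-≤ (≤-trans (s≤s z≤n) 2≤U) (m^n>0 N {{m^n≢0 2 (A * r₀)}} μ))) ⟩
    N * (U * N ^ μ + U * N ^ μ)                ≡⟨ shuffle N U (N ^ μ) ⟩
    N * (2 * (U * N ^ μ))                      ≤⟨ *-monoʳ-≤ N (*-monoʳ-≤ 2 (*-mono-≤ (<⇒≤ (n<2^n U)) (≤-reflexive (^-*-assoc 2 (A * r₀) μ)))) ⟩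
    N * (2 * (2 ^ U * 2 ^ (A * r₀ * μ)))       ≡⟨ cong (λ x → N * (2 * x)) (2^-+ U (A * r₀ * μ)) ⟩
    N * 2 ^ suc (U + A * r₀ * μ)               ≡⟨ 2^-+ (A * r₀) (suc (U + A * r₀ * μ)) ⟩
    2 ^ (A * r₀ + suc (U + A * r₀ * μ))        ≤⟨ 2^-mono (≤-trans (exponent A U μ r₀ (≤-trans (s≤s z≤n) r₀-3)) (*-monoˡ-≤ r₀ r₀-A)) ⟩
    2 ^ (r₀ * r₀)                              ∎
    where
    open ≤-Reasoning
    N = 2 ^ (A * r₀)
    shuffle : ∀ N U x → N * (U * x + U * x) ≡ N * (2 * (U * x))
    shuffle = solve-∀
    exponent : ∀ A U μ r → 1 ≤ r → A * r + suc (U + A * r * μ) ≤ (A + (1 + (U + A * μ))) * r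
    exponent A U μ (suc r) _ = by-cert (r + U * r) (z≤n {0}) (identity A U μ r)
      where
      identity : ∀ A U μ r → A * suc r + suc (U + A * suc r * μ) + 0 + (r + U * r) ≡ (A + (1 + (U + A * μ))) * suc r + 0
      identity = solve-∀

  ω-big′ : ∀ A p r → 1 ≤ r → suc (A * suc r * (p * (A * suc r)) + r * r) ≤ r * suc (2 * (p * (A * A))) * suc r
  ω-big′ A p (suc r) _ = by-cert (A * A * p * (r * r) + 2 * (A * A * p * r) + r) (z≤n {0}) (identity A p r)
    where
    identity : ∀ A p r → suc (A * suc (suc r) * (p * (A * suc (suc r))) + suc r * suc r) + 0 + (A * A * p * (r * r) + 2 * (A * A * p * r) + r)
      ≡ suc r * suc (2 * (p * (A * A))) * suc (suc r) + 0
    identity = solve-∀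

  constants : Constants p
  constants = record
    { A = A ; U = U ; μ = μ ; ω = ω ; y = y ; y′ = y′ ; r₀ = r₀
    ; 1≤A = ≤-trans (s≤s z≤n) (m≤n+m 20 y′)
    ; 2≤U = 2≤U
    ; 3≤r₀ = r₀-3
    ; 1≤μ = ≤-trans (s≤s z≤n) (m≤n+m 8 (y′ + y + 2 * ω))
    ; h-μ = λ r r₀≤r → h-μ r (≤-trans (≤-trans (s≤s z≤n) r₀-3) r₀≤r)
    ; h-p = h-p
    ; h-θ = h-θ
    ; h-a₀ = h-a₀
    }

  calibrated : Calibrated constants
  calibrated = record { y≡ = refl ; y′≡ = refl ; A≡ = refl ; divisors = divisors ; ω-big = λ r → ω-big′ A p r }

-- From subsequences to index sets, and the theorem

module _ (em : ExcludedMiddle 0ℓ) {ε : ℝ} (fl : Floor ε) (constants : Constants (Floor.p fl)) (calibrated : Calibrated constants) where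
  open Floor fl
  open Growth fl constants
  open SubsetSums a using (weight)

  private
    Subset : (ℕ → ℕ) → ℕ → Set
    Subset φ j = ∃[ i ] (1 ≤ i × φ i ≡ j)

    indicator : ∀ {P : Set} → Dec P → ℕ
    indicator (yes _) = 1
    indicator (no  _) = 0

    indicator≤1 : ∀ {P : Set} (d : Dec P) → indicator d ≤ 1
    indicator≤1 (yes _) = ≤-refl
    indicator≤1 (no  _) = z≤n

    indicator-yes : ∀ {P : Set} (d : Dec P) → P → 1 ≤ indicator d
    indicator-yes (yes _) _ = ≤-refl
    indicator-yes (no ¬p) p = contradiction p ¬p

    indicator-hit : ∀ {P : Set} (d : Dec P) → 1 ≤ indicator d → P
    indicator-hit (yes p) _ = p

    indicator-no : ∀ {P : Set} (d : Dec P) → ¬ P → indicator d ≡ 0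
    indicator-no (yes p) ¬p = contradiction p ¬p
    indicator-no (no _)  _  = refl

    unique-image : ∀ {xs} → Unique xs → All (1 ≤_) xs → Unique (map a xs)
    unique-image []         []          = []
    unique-image {x ∷ xs} (x∉ ∷ u) (1≤x ∷ pos) = AllP.map⁺ (All.tabulate λ {y} y∈ eq →
      All.lookup x∉ y∈ (≤-antisym (strict⇒reflects-≤ a-inc (All.lookup pos y∈) (≤-reflexive eq))
                                  (strict⇒reflects-≤ a-inc 1≤x (≤-reflexive (sym eq))))) ∷ unique-image u pos

  module Subsequence (B : Sequence) (φ : ℕ → ℕ) (φ⁺ : Positive φ) (φ-inc : StrictlyIncreasing φ)
    (B≡ : ∀ n → 1 ≤ n → term B n ≡ a (φ n)) (N : ℕ) (κ≤count : ∀ n → N ≤ n → κ ∣ sequence ∩[ n ]∣ ≤ ∣ B ∩[ n ]∣) where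

    χ : ℕ → ℕ
    χ j = indicator (em {Subset φ j})

    χ0 : χ 0 ≡ 0
    χ0 = indicator-no em λ (i , 1≤i , eq) → <⇒≱ (φ⁺ i 1≤i) (≤-reflexive eq)

    hit : ∀ {j} → 1 ≤ χ j → Subset φ j
    hit = indicator-hit em

    members : ∀ l → 1 ≤ l → l ≤ ∑ (suc (φ l)) χ
    members (suc zero)    _ = ≤-trans (indicator-yes em (1 , ≤-refl , refl)) (m≤n+m _ (∑ (φ 1) χ))
    members (suc (suc l)) _ = ≤-trans (≤-reflexive (+-comm 1 (suc l))) (+-mono-≤
      (≤-trans (members (suc l) (s≤s z≤n)) (∑-monoˡ χ (φ-inc (suc l) (suc (suc l)) (s≤s z≤n) ≤-refl)))
      (indicator-yes em (suc (suc l) , s≤s z≤n , refl)))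

    -- The density hypothesis is used at n = a J - 1: [n] contains precisely the first J - 1 terms
    -- of the sequence, and the terms of B in it have indices below J.
    count-lower : ∀ J → suc N ≤ J → κ (pred J) ≤ ∑ J χ
    count-lower J N<J = ≤-trans (κ-mono below) (≤-trans (κ≤count n N≤n) (above ∣ B ∩[ n ]∣ refl))
      where
      n = pred (a J)
      1≤J = ≤-trans (s≤s z≤n) N<J
      1≤aJ = a-pos J 1≤J
      suc-n : suc n ≡ a J
      suc-n = suc-pred (a J) {{>-nonZero 1≤aJ}}
      N≤n : N ≤ n
      N≤n = s≤s⁻¹ (≤-trans N<J (≤-trans (n≤term sequence J 1≤J) (≤-reflexive (sym suc-n))))
      small : ∀ i → suc i < J → suc i ≤ ∣ sequence ∩[ n ]∣
      small i i<J = Equivalence.to (count-spec sequence n (suc i) (s≤s z≤n)) (s≤s⁻¹ (≤-trans (a-inc (suc i) J (s≤s z≤n) i<J) (≤-reflexive (sym suc-n))))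
      below : pred J ≤ ∣ sequence ∩[ n ]∣
      below = index J 1≤J small
        where
        index : ∀ J → 1 ≤ J → (∀ i → suc i < J → suc i ≤ ∣ sequence ∩[ n ]∣) → pred J ≤ ∣ sequence ∩[ n ]∣
        index (suc zero)    _ _ = z≤n
        index (suc (suc i)) _ h = h i ≤-refl
      above : ∀ l → ∣ B ∩[ n ]∣ ≡ l → l ≤ ∑ J χ
      above zero    _  = z≤n
      above (suc l) eq = ≤-trans (members (suc l) (s≤s z≤n)) (∑-monoˡ χ φ<J)
        where
        φ<J : φ (suc l) < J
        φ<J = ≰⇒> λ J≤φ → <⇒≱ (≤-<-trans (Equivalence.from (count-spec B n (suc l) (s≤s z≤n)) (≤-reflexive (sym eq))) (≤-reflexive suc-n))
          (≤-trans (a-mono 1≤J J≤φ) (≤-reflexive (sym (B≡ (suc l) (s≤s z≤n)))))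

    open Assembly.DenseSet em fl constants calibrated χ (λ j → indicator≤1 em) χ0 (suc N) count-lower using (conclusion)

    complete : Complete B
    complete = proj₁ conclusion , λ n N≤n → sums n (proj₂ conclusion n N≤n)
      where
      sums : ∀ n → ∃[ xs ] (Unique xs × All (λ j → 1 ≤ χ j) xs × n ≡ weight xs) → n ∈Σ B
      sums n (xs , u , all , eq) = map a xs ,
        unique-image u (All.map (λ h → case hit h of λ { (i , 1≤i , refl) → φ⁺ i 1≤i }) all) ,
        AllP.map⁺ (All.map (λ h → case hit h of λ { (i , 1≤i , refl) → i , 1≤i , sym (B≡ i 1≤i) }) all) , eq

  sequence-complete : ε -Complete sequence
  sequence-complete B (φ , φ⁺ , φ-inc , B≡) (N , dense) = Subsequence.complete B φ φ⁺ φ-inc B≡ N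
    λ n N≤n → κ-least {∣ sequence ∩[ n ]∣} {∣ B ∩[ n ]∣} (dense n N≤n)

theorem1p3 : ExcludedMiddle 0ℓ →
    (ε : ℝ) → InUnitInterval ε →
    (f : ℕ → ℕ) → Positive f → SatisfiesRecurrence ε f →
    ((A : Sequence) → ε -Complete A → term A =O f)
    × (∃[ A ] (ε -Complete A × term A =Θ f))
theorem1p3 em ε ε∈ f f⁺ (n₀ , rec) =
  (λ A complete → case complete⇒recursion-bound em fl A complete of λ
    { (r , N , bound) → Comparison.=O-from-recursion fl f f⁺ n₀ f-rec (term A) r N bound }) ,
  sequence , sequence-complete em fl constants calibrated , Theta.a=Θ[f] fl constants f f⁺ n₀ f-rec
  where
  fl = floor em ε ε∈
  open Floor fl
  open Choice p using (constants; calibrated)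
  open Construction fl constants using (sequence)

  κ-unique : ∀ n k → (∀ i → 1 ≤ i → (i ≤ k) ⇔ (i ≤ ε · n)) → k ≡ κ n
  κ-unique n k spec = ≤-antisym (up k spec) (down (κ n) refl)
    where
    up : ∀ k → (∀ i → 1 ≤ i → (i ≤ k) ⇔ (i ≤ ε · n)) → k ≤ κ n
    up zero    _    = z≤n
    up (suc k) spec = Equivalence.from (κ-spec (suc k) n) (Equivalence.to (spec (suc k) (s≤s z≤n)) ≤-refl)
    down : ∀ l → κ n ≡ l → l ≤ k
    down zero    _  = z≤n
    down (suc l) eq = Equivalence.from (spec (suc l) (s≤s z≤n)) (Equivalence.to (κ-spec (suc l) n) (≤-reflexive (sym eq)))

  f-rec : ∀ n → n₀ ≤ n → f n ≡ S f (κ n)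
  f-rec n n₀≤n = from (rec n n₀≤n)
    where
    from : ∃[ k ] ((∀ i → 1 ≤ i → (i ≤ k) ⇔ (i ≤ ε · n)) × f n ≡ sum (map f [1⋯ k ])) → f n ≡ S f (κ n)
    from (k , spec , eq) = trans eq (trans (sum-[1⋯] f k) (cong (S f) (κ-unique n k spec)))
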